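{- A graph language is star-free if and only if it is definable in separator logic.
   Context: Graphs are finite, undirected and nonempty. A graph with $i$ ports is a graph together with a tuple of $i$ pairwise distinct distinguished vertices (the ports); $i$ is its arity. A graph language is a set of graphs with ports all of the same arity; complement is taken relative to all graphs of that arity. Treewidth operations: (fusion) for each $k\ge 0$, $k$-fusion takes two graphs of arity $k$, forms their disjoint union and identifies, for each $i\le k$, the $i$-th ports of the two graphs (edges are accumulated); (forget) $k$-forget takes a graph of arity $k+1$ and stops distinguishing port $k+1$; (add) $k$-add takes a graph of arity $k$ and adds a fresh isolated vertex which becomes port $k+1$; (permute) for each $k$ and each permutation of $\{1,\dots,k\}$, reorder the ports. Operations are lifted to languages elementwise. The star-free graph languages form the least class of graph languages containing all finite languages and closed under Boolean operations (union, intersection, complement) and the treewidth operations. Separator logic: first-order logic over the structure whose universe is the set of vertices, with the edge relation $E(x,y)$ and, for every $n\ge 0$, a relation $S_n(x,y,z_1,\dots,z_n)$ holding iff every path from $x$ to $y$ uses some vertex from $\{z_1,\dots,z_n\}$ ($S_0(x,y)$ says $x,y$ are in different connected components). A formula $\varphi(x_1,\dots,x_k)$ with free variables among $x_1,\dots,x_k$ defines the language of arity $k$ consisting of those graphs of arity $k$ that satisfy $\varphi$ when $x_i$ is interpreted as the $i$-th port. A graph language is definable in separator logic if it is the language of such a formula. -}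

module Defs where

open import Data.Nat using (ℕ; zero; suc; _<_)
open import Data.Bool using (Bool; true; false)
open import Data.Fin using (Fin; zero; suc; inject₁; fromℕ)
open import Data.Fin.Properties using (inject₁-injective)
open import Data.Fin.Permutation using (Permutation; _⟨$⟩ʳ_; _⟨$⟩ˡ_; inverseˡ)
open import Data.List using (List; []; _∷_)
open import Data.List.Relation.Unary.Any using (Any)
open import Data.List.Relation.Unary.Unique.Propositional using (Unique)
open import Data.List.Membership.Propositional using (_∈_)
open import Data.Vec using (Vec)
open import Data.Vec.Membership.Propositional using () renaming (_∈_ to _∈ᵥ_)
import Data.Vec as Vec
open import Data.Vec.Functional using () renaming (_∷_ to _∷ᶠ_)
open import Data.Product using (Σ; ∃; ∃-syntax; _×_; _,_)
open import Data.Sum using (_⊎_)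
open import Data.Empty using (⊥)
open import Relation.Nullary using (¬_)
open import Relation.Binary.PropositionalEquality using (_≡_; refl; cong)
open import Function.Bundles using (_↔_; _⇔_; Inverse)

record Graph (k : ℕ) : Set where
  field
    n        : ℕ
    nonempty : 0 < n
    adj      : Fin n → Fin n → Bool
    sym      : ∀ u v → adj u v ≡ adj v u
    irrefl   : ∀ u → adj u u ≡ false
    port     : Fin k → Fin n
    port-inj : ∀ {i j} → port i ≡ port j → i ≡ j

open Graph public

record Iso {k : ℕ} (G H : Graph k) : Set where
  field
    bij      : Fin (n G) ↔ Fin (n H)
    adj-pres : ∀ u v → adj H (Inverse.to bij u) (Inverse.to bij v) ≡ adj G u v
    port-pres : ∀ i → Inverse.to bij (port G i) ≡ port H i

Language : ℕ → Set₁
Language k = Graph k → Set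

-- k-fusion: G is (up to isomorphism) the k-fusion of G₁ and G₂, i.e. G is
-- the disjoint union of G₁ and G₂ with the i-th ports identified, edges
-- accumulated.  Expressed via the two canonical embeddings.
record IsFusion {k : ℕ} (G₁ G₂ G : Graph k) : Set where
  field
    e₁      : Fin (n G₁) → Fin (n G)
    e₂      : Fin (n G₂) → Fin (n G)
    e₁-inj  : ∀ {u v} → e₁ u ≡ e₁ v → u ≡ v
    e₂-inj  : ∀ {u v} → e₂ u ≡ e₂ v → u ≡ v
    port₁   : ∀ i → e₁ (port G₁ i) ≡ port G i
    port₂   : ∀ i → e₂ (port G₂ i) ≡ port G i
    shared  : ∀ u v → e₁ u ≡ e₂ v → ∃[ i ] (u ≡ port G₁ i × v ≡ port G₂ i)
    cover   : ∀ w → (∃[ u ] e₁ u ≡ w) ⊎ (∃[ v ] e₂ v ≡ w)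
    edges   : ∀ a b →
      (adj G a b ≡ true) ⇔
      ((∃[ u ] ∃[ v ] (e₁ u ≡ a × e₁ v ≡ b × adj G₁ u v ≡ true)) ⊎
       (∃[ u ] ∃[ v ] (e₂ u ≡ a × e₂ v ≡ b × adj G₂ u v ≡ true)))

forget : {k : ℕ} → Graph (suc k) → Graph k
forget G = record
  { n = n G ; nonempty = nonempty G ; adj = adj G ; sym = sym G
  ; irrefl = irrefl G
  ; port = λ i → port G (inject₁ i)
  ; port-inj = λ e → inject₁-injective (port-inj G e) }

-- k-add: G' is (up to isomorphism) G with a fresh isolated vertex added,
-- which becomes port k+1 (the last port).
record IsAdd {k : ℕ} (G : Graph k) (G' : Graph (suc k)) : Set where
  field
    e        : Fin (n G) → Fin (n G')
    e-inj    : ∀ {u v} → e u ≡ e v → u ≡ v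
    adj-pres : ∀ u v → adj G' (e u) (e v) ≡ adj G u v
    fresh    : ∀ u → ¬ (e u ≡ port G' (fromℕ k))
    isolated : ∀ w → adj G' (port G' (fromℕ k)) w ≡ false
    cover    : ∀ w → (∃[ u ] e u ≡ w) ⊎ (w ≡ port G' (fromℕ k))
    old-ports : ∀ i → e (port G i) ≡ port G' (inject₁ i)

permute : {k : ℕ} → Permutation k k → Graph k → Graph k
permute π G = record
  { n = n G ; nonempty = nonempty G ; adj = adj G ; sym = sym G
  ; irrefl = irrefl G
  ; port = λ i → port G (π ⟨$⟩ʳ i)
  ; port-inj = λ {i} {j} eq → inj-π (port-inj G eq) }
  where
  inj-π : ∀ {i j} → π ⟨$⟩ʳ i ≡ π ⟨$⟩ʳ j → i ≡ j
  inj-π {i} {j} eq =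
    Relation.Binary.PropositionalEquality.trans (Relation.Binary.PropositionalEquality.sym (inverseˡ π {i}))
      (Relation.Binary.PropositionalEquality.trans (cong (π ⟨$⟩ˡ_) eq) (inverseˡ π {j}))
    where import Relation.Binary.PropositionalEquality

fuseL : {k : ℕ} → Language k → Language k → Language k
fuseL L₁ L₂ G = ∃[ G₁ ] ∃[ G₂ ] (L₁ G₁ × L₂ G₂ × IsFusion G₁ G₂ G)

forgetL : {k : ℕ} → Language (suc k) → Language k
forgetL L G = ∃[ H ] (L H × Iso (forget H) G)

addL : {k : ℕ} → Language k → Language (suc k)
addL L G' = ∃[ G ] (L G × IsAdd G G')

permuteL : {k : ℕ} → Permutation k k → Language k → Language k
permuteL π L G = ∃[ H ] (L H × Iso (permute π H) G)

finiteL : {k : ℕ} → List (Graph k) → Language k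
finiteL Gs G = Any (Iso G) Gs

-- Star-free graph languages: the least class containing the finite
-- languages, closed under Boolean operations and treewidth operations.
-- Languages are sets, so the class is closed under extensional equality.

data StarFree : (k : ℕ) → Language k → Set₁ where
  finite  : ∀ {k} (Gs : List (Graph k)) → StarFree k (finiteL Gs)
  union   : ∀ {k L₁ L₂} → StarFree k L₁ → StarFree k L₂ →
            StarFree k (λ G → L₁ G ⊎ L₂ G)
  inter   : ∀ {k L₁ L₂} → StarFree k L₁ → StarFree k L₂ →
            StarFree k (λ G → L₁ G × L₂ G)
  compl   : ∀ {k L} → StarFree k L → StarFree k (λ G → ¬ L G)
  fusion  : ∀ {k L₁ L₂} → StarFree k L₁ → StarFree k L₂ →
            StarFree k (fuseL L₁ L₂)
  forgetS : ∀ {k L} → StarFree (suc k) L → StarFree k (forgetL L)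
  addS    : ∀ {k L} → StarFree k L → StarFree (suc k) (addL L)
  permS   : ∀ {k L} (π : Permutation k k) → StarFree k L →
            StarFree k (permuteL π L)
  ext     : ∀ {k L L'} → StarFree k L → (∀ G → L G ⇔ L' G) → StarFree k L'

data Walk {k : ℕ} (G : Graph k) : Fin (n G) → Fin (n G) → List (Fin (n G)) → Set where
  here : ∀ x → Walk G x x (x ∷ [])
  step : ∀ {x y z vs} → adj G x y ≡ true → Walk G y z vs → Walk G x z (x ∷ vs)

IsPath : {k : ℕ} (G : Graph k) → Fin (n G) → Fin (n G) → List (Fin (n G)) → Set
IsPath G x y vs = Walk G x y vs × Unique vs

Separates : {k m : ℕ} (G : Graph k) → Fin (n G) → Fin (n G) → Vec (Fin (n G)) m → Set
Separates G x y zs = ∀ vs → IsPath G x y vs → Any (λ v → v ∈ᵥ zs) vs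

-- First-order formulas with variables drawn from Fin m (de Bruijn: the
-- quantifier ∃ binds variable zero).
data Formula (m : ℕ) : Set where
  edge  : Fin m → Fin m → Formula m
  equal : Fin m → Fin m → Formula m
  sep   : (l : ℕ) → Fin m → Fin m → Vec (Fin m) l → Formula m
  neg   : Formula m → Formula m
  and   : Formula m → Formula m → Formula m
  or    : Formula m → Formula m → Formula m
  ex′ : Formula (suc m) → Formula m
  all′ : Formula (suc m) → Formula m

Sat : {k m : ℕ} (G : Graph k) → (Fin m → Fin (n G)) → Formula m → Set
Sat G ρ (edge i j)   = adj G (ρ i) (ρ j) ≡ true
Sat G ρ (equal i j)  = ρ i ≡ ρ j
Sat G ρ (sep l x y zs) = Separates G (ρ x) (ρ y) (Vec.map ρ zs)
Sat G ρ (neg φ)      = ¬ Sat G ρ φ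
Sat G ρ (and φ ψ)    = Sat G ρ φ × Sat G ρ ψ
Sat G ρ (or φ ψ)     = Sat G ρ φ ⊎ Sat G ρ ψ
Sat G ρ (ex′ φ)   = ∃[ v ] Sat G (v ∷ᶠ ρ) φ
Sat G ρ (all′ φ)   = ∀ v → Sat G (v ∷ᶠ ρ) φ

langOf : {k : ℕ} → Formula k → Language k
langOf φ G = Sat G (port G) φ

Definable : (k : ℕ) → Language k → Set
Definable k L = Σ (Formula k) λ φ → ∀ G → L G ⇔ langOf φ G

{-# OPTIONS --safe #-}

-- Delete the ports of G.  For a star-free language, membership of G depends only on the edges between
-- the ports and on the numbers, up to a threshold, of components of the rest on which an invariant takes
-- each of its finitely many values.  Fusion adds these numbers, and every splitting of them is realised
-- by distributing the components over two graphs.  Forgetting a port v puts v back into a component, so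
-- the new invariant of a component records what can be seen after deleting one of its vertices: the
-- adjacencies of that vertex and the capped numbers of the remaining pieces of each kind.  Two vertices
-- lie in one component iff the ports do not separate them, so such conditions are first-order in
-- separator logic.
-- Conversely a formula is translated by induction, its variables being assigned to ports; a quantifier
-- ranges over the ports and, through forgetting, over the other vertices.  That a set of ports separates
-- two others means that G is a fusion of two graphs, each port outside the set being isolated in one.


module Submission where

open import Defs
open import Data.Nat using (ℕ; zero; suc; _+_; _*_; _∸_; _^_; _≤_; _<_; z≤n; s≤s; s≤s⁻¹; _⊔_; _⊓_)
import Data.Nat.Properties as ℕ
open import Data.Bool using (Bool; true; false; _∨_; _∧_; not; if_then_else_)
import Data.Bool.Properties as Bool
open import Data.Fin using (Fin; zero; suc; toℕ; inject₁; fromℕ; fromℕ<; _≟_; combine; remQuot; finToFun; funToFin; _↑ˡ_; _↑ʳ_)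
import Data.Fin.Properties as Fin
open import Data.Fin.Permutation using (Permutation; _⟨$⟩ʳ_; _⟨$⟩ˡ_; inverseˡ; inverseʳ; flip)
open import Data.Fin.Relation.Unary.Top using (view; ‵fromℕ; ‵inj₁)
open import Data.List using (List; []; _∷_; length; filter; take; lookup)
import Data.List as List
import Data.List.Properties as List
open import Data.List.Relation.Unary.Any using (Any; here; there; any?; index)
import Data.List.Relation.Unary.Any as Any
import Data.List.Relation.Unary.Any.Properties as Any
open import Data.List.Relation.Unary.All using (All; []; _∷_)
import Data.List.Relation.Unary.All as All
import Data.List.Relation.Unary.All.Properties as All
open import Data.List.Relation.Unary.AllPairs using (AllPairs; []; _∷_)
import Data.List.Relation.Unary.AllPairs as AllPairs
import Data.List.Relation.Unary.AllPairs.Properties as AllPairs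
open import Data.List.Membership.Propositional using (_∈_)
open import Data.List.Membership.Propositional.Properties using (∈-allFin; ∈-lookup)
open import Data.Vec using (Vec; []; _∷_)
import Data.Vec as Vec
import Data.Vec.Properties as Vec
open import Data.Vec.Membership.Propositional using () renaming (_∈_ to _∈ᵥ_)
import Data.Vec.Relation.Unary.Any.Properties as VecAny
open import Data.Vec.Functional using () renaming (_∷_ to _∷ᶠ_)
import Data.Maybe as Maybe
open import Data.Maybe using (Maybe; just; nothing; maybe; _>>=_)
open import Data.Product using (∃; ∃-syntax; _×_; _,_; proj₁; proj₂; uncurry)
open import Data.Sum using (_⊎_; inj₁; inj₂; [_,_]′; swap)
open import Data.Empty using (⊥; ⊥-elim)
open import Data.Unit using (⊤; tt)
open import Function using (_∘_; id; case_of_)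
open import Function.Bundles using (_⇔_; mk⇔; mk↔ₛ′; Equivalence; Inverse)
open import Relation.Nullary using (¬_; Dec; yes; no; does; contradiction)
open import Relation.Nullary.Decidable using (¬?; _×-dec_; _⊎-dec_; map′; decidable-stable; dec-true; dec-false)
open import Relation.Unary using (Decidable)
open import Relation.Binary.Definitions using (tri<; tri≈; tri>)
open import Relation.Binary.PropositionalEquality using (_≡_; _≢_; _≗_; refl; cong; cong₂; trans; subst; subst₂) renaming (sym to ≡-sym)

-- Components after deletion of vertices

-- The obstacle is an invariant of components that survives forgetting and is still first-order.
-- `Inv` is therefore built only from colours, capped counting and the deletion of one vertex at a
-- time; each forgetting adds one layer of `ex`. Languages with different invariants are brought
-- together by pairing the invariants, since the counts for either one are sums of counts for the
-- pair. The thresholds have two sources. Forgetting costs one unit, because the component that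
-- absorbs the port leaves the count. Fusion doubles the threshold: a number that is at least
-- `s + s` can be re-split so that each part looks the same up to `s`. Graphs are nonempty, so a
-- factor without ports must own a component; hence zero and positive counts have to be told apart.
-- A `Language` need not respect isomorphism, and the logic of Agda is constructive. Recognition
-- repairs both: it yields invariance under isomorphism and a decision procedure. So the translation
-- of formulas also relies on the passage from star-free to recognised languages, for forgetting and
-- for universal quantifiers.

infixl 6 _⊕_

_⊕_ : ∀ {m} → (Fin m → Bool) → Fin m → Fin m → Bool
(D ⊕ x) y = D y ∨ does (y ≟ x)

⊕-false⁻ : ∀ {m} (D : Fin m → Bool) {x y} → (D ⊕ x) y ≡ false → D y ≡ false × y ≢ x
⊕-false⁻ D {x} {y} e with D y | y ≟ x
... | false | no y≢x = refl , y≢x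

⊕-false : ∀ {m} (D : Fin m → Bool) {x y} → D y ≡ false → y ≢ x → (D ⊕ x) y ≡ false
⊕-false D {x} {y} e y≢x rewrite e = dec-false (y ≟ x) y≢x

false-or-true : (b : Bool) → b ≡ false ⊎ b ≡ true
false-or-true false = inj₁ refl
false-or-true true = inj₂ refl

true≢false : ∀ {b : Bool} → b ≡ true → b ≡ false → ⊥
true≢false refl ()

bool-ext : ∀ {b c : Bool} → (b ≡ true → c ≡ true) → (c ≡ true → b ≡ true) → b ≡ c
bool-ext {false} {false} f g = refl
bool-ext {false} {true} f g = g refl
bool-ext {true} f g = ≡-sym (f refl)

does-ext : ∀ {A B : Set} (A? : Dec A) (B? : Dec B) → (A → B) → (B → A) → does A? ≡ does B?
does-ext (yes a) (yes b) f g = refl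
does-ext (no a) (no b) f g = refl
does-ext (yes a) (no b) f g = contradiction (f a) b
does-ext (no a) (yes b) f g = contradiction (g b) a

does-true : ∀ {A : Set} (A? : Dec A) → does A? ≡ true → A
does-true (yes a) _ = a

does-false : ∀ {A : Set} (A? : Dec A) → does A? ≡ false → ¬ A
does-false (no a) _ = a

-- Connectedness in the graph with adjacency a after deletion of the vertices marked by D.
data Conn {m : ℕ} (a : Fin m → Fin m → Bool) (D : Fin m → Bool) : Fin m → Fin m → Set where
  stop : ∀ {x} → D x ≡ false → Conn a D x x
  go   : ∀ {x y z} → D x ≡ false → a x y ≡ true → Conn a D y z → Conn a D x z

module _ {m : ℕ} {a : Fin m → Fin m → Bool} where

  Conn-start : ∀ {D x y} → Conn a D x y → D x ≡ false
  Conn-start (stop d) = d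
  Conn-start (go d _ _) = d

  Conn-end : ∀ {D x y} → Conn a D x y → D y ≡ false
  Conn-end (stop d) = d
  Conn-end (go _ _ c) = Conn-end c

  Conn-trans : ∀ {D x y z} → Conn a D x y → Conn a D y z → Conn a D x z
  Conn-trans (stop _) c′ = c′
  Conn-trans (go d e c) c′ = go d e (Conn-trans c c′)

  Conn-mono : ∀ {D D′ x y} → (∀ v → D v ≡ false → D′ v ≡ false) → Conn a D x y → Conn a D′ x y
  Conn-mono h (stop d) = stop (h _ d)
  Conn-mono h (go d e c) = go (h _ d) e (Conn-mono h c)

  Conn-⊕⁻ : ∀ {D x y} v → Conn a (D ⊕ v) x y → Conn a D x y
  Conn-⊕⁻ {D} v = Conn-mono λ w e → proj₁ (⊕-false⁻ D e)

  module _ (a-sym : ∀ u v → a u v ≡ a v u) where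

    Conn-sym : ∀ {D x y} → Conn a D x y → Conn a D y x
    Conn-sym (stop d) = stop d
    Conn-sym (go {x} {y} d e c) =
      Conn-trans (Conn-sym c) (go (Conn-start c) (trans (a-sym y x) e) (stop d))

  -- The part of the walk after its last visit to x.
  last-visit : ∀ {D u y} x → Conn a D u y →
    Conn a (D ⊕ x) u y ⊎ (x ≡ y ⊎ ∃ λ z → a x z ≡ true × Conn a (D ⊕ x) z y)
  last-visit {D} {u} x (stop d) with u ≟ x
  ... | yes refl = inj₂ (inj₁ refl)
  ... | no u≢x = inj₁ (stop (⊕-false D d u≢x))
  last-visit {D} {u} x (go d e c) with last-visit x c
  ... | inj₂ r = inj₂ r
  ... | inj₁ c′ with u ≟ x
  ...   | yes refl = inj₂ (inj₂ (_ , e , c′))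
  ...   | no u≢x = inj₁ (go (⊕-false D d u≢x) e c′)

  -- After the last visit to the start the walk avoids `x`, so one more vertex may be deleted. The
  -- drop of `#free` is the termination measure for deciding `Conn` and for extracting simple paths.
  unfold-Conn : ∀ {D x y} → Conn a D x y → x ≡ y ⊎ ∃ λ z → a x z ≡ true × Conn a (D ⊕ x) z y
  unfold-Conn {D} {x} c with last-visit x c
  ... | inj₁ c′ = ⊥-elim (proj₂ (⊕-false⁻ D (Conn-start c′)) refl)
  ... | inj₂ r = r

#free : ∀ {m} → (Fin m → Bool) → ℕ
#free {zero} D = 0
#free {suc m} D with D zero
... | false = suc (#free (D ∘ suc))
... | true = #free (D ∘ suc)

#free-cong : ∀ {m} {D D′ : Fin m → Bool} → D ≗ D′ → #free D ≡ #free D′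
#free-cong {zero} h = refl
#free-cong {suc m} {D} {D′} h with D zero | D′ zero | h zero
... | false | .false | refl = cong suc (#free-cong (h ∘ suc))
... | true | .true | refl = #free-cong (h ∘ suc)

#free-⊕ : ∀ {m} (D : Fin m → Bool) x → D x ≡ false → #free D ≡ suc (#free (D ⊕ x))
#free-⊕ {suc m} D zero e with D zero
#free-⊕ {suc m} D zero refl | false = cong suc (#free-cong λ i → ≡-sym (Bool.∨-identityʳ (D (suc i))))
#free-⊕ {suc m} D (suc x) e with D zero
... | false = cong suc (#free-⊕ (D ∘ suc) x e)
... | true = #free-⊕ (D ∘ suc) x e

module _ {m : ℕ} (a : Fin m → Fin m → Bool) where

  conn-fuel? : ∀ f D → #free D < f → ∀ x y → Dec (Conn a D x y)
  conn-fuel? (suc f) D (s≤s l) x y with false-or-true (D x)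
  ... | inj₂ t = no λ c → true≢false t (Conn-start c)
  ... | inj₁ d = map′ fold unfold-Conn
      ((x ≟ y) ⊎-dec Fin.any? λ z → (a x z Bool.≟ true) ×-dec
        conn-fuel? f (D ⊕ x) (subst (_≤ f) (#free-⊕ D x d) l) z y)
    where
    fold : x ≡ y ⊎ (∃ λ z → a x z ≡ true × Conn a (D ⊕ x) z y) → Conn a D x y
    fold (inj₁ refl) = stop d
    fold (inj₂ (z , e , c)) = go d e (Conn-⊕⁻ x c)

  abstract
    conn? : ∀ D x y → Dec (Conn a D x y)
    conn? D = conn-fuel? (suc (#free D)) D ℕ.≤-refl

module _ {k : ℕ} (G : Graph k) where

  -- The deleted set grows along the recursion, so the tail avoids every earlier vertex; this is the
  -- uniqueness that `IsPath` demands.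
  conn⇒path-fuel : ∀ f D → #free D < f → ∀ {x y} → Conn (adj G) D x y →
    ∃ λ vs → IsPath G x y vs × All (λ v → D v ≡ false) vs
  conn⇒path-fuel (suc f) D (s≤s l) {x} {y} c with Conn-start c | unfold-Conn c
  ... | d | inj₁ refl = x ∷ [] , (Walk.here x , [] ∷ []) , d ∷ []
  ... | d | inj₂ (z , e , c′)
      with conn⇒path-fuel f (D ⊕ x) (subst (_≤ f) (#free-⊕ D x d) l) c′
  ...   | vs , (w , u) , h = x ∷ vs
      , (Walk.step e w , All.map (λ p q → proj₂ (⊕-false⁻ D p) (≡-sym q)) h ∷ u)
      , d ∷ All.map (λ p → proj₁ (⊕-false⁻ D p)) h

  walk⇒conn : ∀ {D x y vs} → Walk G x y vs → All (λ v → D v ≡ false) vs → Conn (adj G) D x y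
  walk⇒conn (Walk.here x) (d ∷ _) = stop d
  walk⇒conn (Walk.step e w) (d ∷ h) = go d e (walk⇒conn w h)

  -- `Separates` quantifies over simple paths and `Conn` over walks; shortening a walk bridges the
  -- two. The conventions agree at the ends: a path contains its endpoints, and `Conn` requires
  -- unmarked endpoints, so an endpoint in `zs` counts as separated on both sides.
  separates⇔¬conn : ∀ {l} {zs : Vec (Fin (n G)) l} {D} → (∀ v → (D v ≡ true) ⇔ (v ∈ᵥ zs)) →
    ∀ {x y} → Separates G x y zs ⇔ (¬ Conn (adj G) D x y)
  separates⇔¬conn {zs = zs} {D} h {x} {y} = mk⇔ to from
    where
    to : Separates G x y zs → ¬ Conn (adj G) D x y
    to s c with conn⇒path-fuel (suc (#free D)) D ℕ.≤-refl c
    ... | vs , p , f with All.lookupAny f (s vs p)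
    ...   | d , v∈zs = true≢false (Equivalence.from (h _) v∈zs) d
    from : ¬ Conn (adj G) D x y → Separates G x y zs
    from ¬c vs (w , _) with any? (λ v → D v Bool.≟ true) vs
    ... | yes p = Any.map (Equivalence.to (h _)) p
    ... | no ¬p = ⊥-elim (¬c (walk⇒conn w (All.map Bool.¬-not (All.¬Any⇒All¬ vs ¬p))))

-- Systems of representatives and numbers of components

record Reps {m : ℕ} (A : Fin m → Set) (_~_ : Fin m → Fin m → Set) : Set where
  field
    list  : List (Fin m)
    all-A : All A list
    apart : AllPairs (λ x y → ¬ x ~ y) list
    covered : ∀ x → A x → Any (x ~_) list

open Reps

module _ {m : ℕ} {A : Fin m → Set} {_~_ : Fin m → Fin m → Set}
         (A? : Decidable A) (_~?_ : ∀ x y → Dec (x ~ y)) (~-refl : ∀ x → A x → x ~ x) where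

  greedy : ∀ xs → ∃ λ ys → All A ys × AllPairs (λ x y → ¬ x ~ y) ys ×
    (∀ x → x ∈ xs → A x → Any (x ~_) ys)
  greedy [] = [] , [] , [] , λ _ ()
  greedy (x ∷ xs) with greedy xs | A? x
  ... | ys , p , q , r | no ¬Ax = ys , p , q , λ
    { _ (here refl) Ay → contradiction Ay ¬Ax ; y (there i) Ay → r y i Ay }
  ... | ys , p , q , r | yes Ax with any? (x ~?_) ys
  ...   | yes c = ys , p , q , λ { _ (here refl) Ay → c ; y (there i) Ay → r y i Ay }
  ...   | no ¬c = x ∷ ys , Ax ∷ p , All.¬Any⇒All¬ ys ¬c ∷ q , λ
    { _ (here refl) Ay → here (~-refl x Ay) ; y (there i) Ay → there (r y i Ay) }

  reps : Reps A _~_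
  reps with greedy (List.allFin m)
  ... | ys , p , q , r = record
    { list = ys ; all-A = p ; apart = q ; covered = λ x Ax → r x (∈-allFin x) Ax }

AllPairs-lookup : ∀ {X : Set} {R : X → X → Set} {xs} → AllPairs R xs →
  ∀ i j → toℕ i < toℕ j → R (lookup xs i) (lookup xs j)
AllPairs-lookup (p ∷ ps) zero (suc j) _ = All.lookup p (∈-lookup j)
AllPairs-lookup (p ∷ ps) (suc i) (suc j) (s≤s l) = AllPairs-lookup ps i j l

module _ {m m′ : ℕ} {A : Fin m → Set} {A′ : Fin m′ → Set}
         {_~_ : Fin m → Fin m → Set} {_~′_ : Fin m′ → Fin m′ → Set}
         (~′-sym : ∀ {x y} → x ~′ y → y ~′ x) (~′-trans : ∀ {x y z} → x ~′ y → y ~′ z → x ~′ z)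
         (R : Fin m → Fin m′ → Set)
         (total : ∀ x → A x → ∃ λ x′ → A′ x′ × R x x′)
         (inj : ∀ {x y x′ y′} → A x → A y → R x x′ → R y y′ → x′ ~′ y′ → x ~ y) where

  -- Each representative goes to the position of the class that its `R`-image meets, and `inj` makes
  -- this map of positions injective. A relation `R` rather than a function allows partial
  -- correspondences to be read in either direction.
  Reps-≤ : (T : Reps A _~_) (T′ : Reps A′ _~′_) → length (list T) ≤ length (list T′)
  Reps-≤ T T′ = Fin.injective⇒≤ {f = f} f-inj
    where
    xs = list T
    ys = list T′
    at : ∀ i → A (lookup xs i)
    at i = All.lookup (all-A T) (∈-lookup i)
    img : ∀ i → ∃ λ x′ → A′ x′ × R (lookup xs i) x′
    img i = total _ (at i)
    hit : ∀ i → Any (proj₁ (img i) ~′_) ys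
    hit i = covered T′ _ (proj₁ (proj₂ (img i)))
    f : Fin (length xs) → Fin (length ys)
    f i = index (hit i)
    collide : ∀ i j → f i ≡ f j → lookup xs i ~ lookup xs j
    collide i j e = inj (at i) (at j) (proj₂ (proj₂ (img i))) (proj₂ (proj₂ (img j)))
      (~′-trans (Any.lookup-index (hit i))
        (~′-sym (subst (λ z → proj₁ (img j) ~′ lookup ys z) (≡-sym e) (Any.lookup-index (hit j)))))
    f-inj : ∀ {i j} → f i ≡ f j → i ≡ j
    f-inj {i} {j} e with Fin.<-cmp i j
    ... | tri< l _ _ = contradiction (collide i j e) (AllPairs-lookup (apart T) i j l)
    ... | tri≈ _ p _ = p
    ... | tri> _ _ l = contradiction (collide j i (≡-sym e)) (AllPairs-lookup (apart T) j i l)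

Free : ∀ {m} → (Fin m → Bool) → (Fin m → Set) → Fin m → Set
Free D A x = D x ≡ false × A x

module _ {m : ℕ} (a : Fin m → Fin m → Bool) (D : Fin m → Bool) {A : Fin m → Set} (A? : Decidable A) where

  components : Reps (Free D A) (Conn a D)
  components = reps (λ x → (D x Bool.≟ false) ×-dec A? x) (conn? a D) (λ _ p → stop (proj₁ p))

  -- The number of components of a − D that meet A.
  opaque
    # : ℕ
    # = length (list components)

opaque
  unfolding #

  #-≤ : ∀ {m m′} {a : Fin m → Fin m → Bool} {a′ : Fin m′ → Fin m′ → Bool} {D D′} {A A′}
    {A? : Decidable A} {A′? : Decidable A′} → (∀ u v → a′ u v ≡ a′ v u) →
    (R : Fin m → Fin m′ → Set) →
    (∀ x → Free D A x → ∃ λ x′ → Free D′ A′ x′ × R x x′) →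
    (∀ {x y x′ y′} → Free D A x → Free D A y → R x x′ → R y y′ → Conn a′ D′ x′ y′ → Conn a D x y) →
    # a D A? ≤ # a′ D′ A′?
  #-≤ {A? = A?} {A′?} s R total inj =
    Reps-≤ (Conn-sym s) Conn-trans R total inj (components _ _ A?) (components _ _ A′?)

module _ {m : ℕ} {a : Fin m → Fin m → Bool} (a-sym : ∀ u v → a u v ≡ a v u) {D : Fin m → Bool} where

  Reps-length : ∀ {A A′} (T : Reps A (Conn a D)) (T′ : Reps A′ (Conn a D)) →
    (∀ x → A x → A′ x) → (∀ x → A′ x → A x) → length (list T) ≡ length (list T′)
  Reps-length T T′ f g = ℕ.≤-antisym
    (Reps-≤ (Conn-sym a-sym) Conn-trans _≡_ (λ x p → x , f x p , refl) (λ { _ _ refl refl c → c }) T T′)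
    (Reps-≤ (Conn-sym a-sym) Conn-trans _≡_ (λ x p → x , g x p , refl) (λ { _ _ refl refl c → c }) T′ T)

  opaque
    unfolding #

    #-cong : ∀ {A A′} {A? : Decidable A} {A′? : Decidable A′} →
      (∀ x → Free D A x → A′ x) → (∀ x → Free D A′ x → A x) → # a D A? ≡ # a D A′?
    #-cong f g = Reps-length (components _ _ _) (components _ _ _)
      (λ x p → proj₁ p , f x p) (λ x p → proj₁ p , g x p)

  module _ {A : Fin m → Set} (A? : Decidable A) where

    Reps-filter : ∀ {P : Fin m → Set} (P? : Decidable P) →
      (∀ {x y} → Conn a D x y → P x → P y) → (T : Reps (Free D A) (Conn a D)) →
      Reps (Free D (λ x → A x × P x)) (Conn a D)
    Reps-filter P? inv T = record
      { list = filter P? (list T)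
      ; all-A = All.zipWith (λ { ((d , p) , q) → d , p , q })
          (All.filter⁺ P? (all-A T) , All.all-filter P? (list T))
      ; apart = AllPairs.filter⁺ P? (apart T)
      ; covered = λ { x (d , p , q) → keep q (covered T x (d , p)) } }
      where
      keep : ∀ {x ys} → _ → Any (Conn a D x) ys → Any (Conn a D x) (filter P? ys)
      keep {ys = y ∷ ys} q (here c) with P? y
      ... | yes _ = here c
      ... | no ¬p = contradiction (inv c q) ¬p
      keep {ys = y ∷ ys} q (there i) with does (P? y)
      ... | true = there (keep q i)
      ... | false = keep q i

    module _ {P : Fin m → Set} (P? : Decidable P) (inv : ∀ {x y} → Conn a D x y → P x → P y) where

      opaque
        unfolding #

        #-filter : # a D (λ x → A? x ×-dec P? x) ≡ length (filter P? (list (components a D A?)))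
        #-filter = Reps-length (components _ _ _) (Reps-filter P? inv (components a D A?))
          (λ _ p → p) (λ _ p → p)

    module _ {P : Fin m → Set} (P? : Decidable P) (inv : ∀ {x y} → Conn a D x y → P x → P y) where

      opaque
        unfolding #

        -- `P` is invariant along `Conn`, hence selects whole components and none is counted on both
        -- sides.
        #-split : # a D A? ≡ # a D (λ x → A? x ×-dec P? x) + # a D (λ x → A? x ×-dec ¬? (P? x))
        #-split = trans (count (list (components a D A?)))
          (≡-sym (cong₂ _+_ (#-filter P? inv)
            (#-filter (λ x → ¬? (P? x)) (λ c ¬p p → ¬p (inv (Conn-sym a-sym c) p)))))
          where
          count : ∀ xs → length xs ≡ length (filter P? xs) + length (filter (λ x → ¬? (P? x)) xs)
          count [] = refl
          count (x ∷ xs) with does (P? x)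
          ... | true = cong suc (count xs)
          ... | false = trans (cong suc (count xs)) (≡-sym (ℕ.+-suc _ _))

  opaque
    unfolding #

    #≥⁻ : ∀ {A} {A? : Decidable A} {j} ys → length ys ≡ j → All (Free D A) ys →
      AllPairs (λ x y → ¬ Conn a D x y) ys → j ≤ # a D A?
    -- The relation is cut down to members of `ys`, so that `ys` is a full system of representatives
    -- for its own elements and can be compared with all components.
    #≥⁻ {A? = A?} ys refl p q = Reps-≤ {A = _∈ ys} {_~_ = λ x y → x ∈ ys × y ∈ ys × Conn a D x y}
      (Conn-sym a-sym) Conn-trans _≡_
      (λ x i → x , All.lookup p i , refl) (λ { i j refl refl c → i , j , c })
      (record { list = ys ; all-A = All.tabulate id
              ; apart = AllPairs.map (λ ¬c t → ¬c (proj₂ (proj₂ t))) q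
              ; covered = λ x i → Any.map (λ { {y} refl → i , i , stop (proj₁ (All.lookup p i)) }) i })
      (components a D A?)

opaque
  unfolding #

  #≥ : ∀ {m} {a : Fin m → Fin m → Bool} {D : Fin m → Bool} {A} {A? : Decidable A} {j} → j ≤ # a D A? →
    ∃ λ ys → length ys ≡ j × All (Free D A) ys × AllPairs (λ x y → ¬ Conn a D x y) ys
  #≥ {a = a} {D} {A? = A?} {j} l = take j (list (components a D A?))
    , trans (List.length-take j _) (ℕ.m≤n⇒m⊓n≡m l)
    , All.take⁺ j (all-A (components a D A?)) , AllPairs.take⁺ j (apart (components a D A?))

∑ : ∀ {N} → (Fin N → ℕ) → ℕ
∑ {zero} f = 0
∑ {suc N} f = f zero + ∑ (f ∘ suc)

δ : ∀ {N} → Fin N → Fin N → ℕ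
δ i t = if does (i ≟ t) then 1 else 0

∑-δ : ∀ {N} (i : Fin N) (g : Fin N → ℕ) → (∑ λ t → δ i t + g t) ≡ suc (∑ g)
∑-δ zero g = refl
∑-δ (suc i) g = trans (cong (g zero +_) (∑-δ i (g ∘ suc))) (ℕ.+-suc (g zero) (∑ (g ∘ suc)))

∑-cong : ∀ {N} {f g : Fin N → ℕ} → f ≗ g → ∑ f ≡ ∑ g
∑-cong {zero} h = refl
∑-cong {suc N} h = cong₂ _+_ (h zero) (∑-cong (h ∘ suc))

module _ {m : ℕ} {a : Fin m → Fin m → Bool} (a-sym : ∀ u v → a u v ≡ a v u) {D : Fin m → Bool} where

  opaque
    unfolding #

    #-none : ∀ {A} {A? : Decidable A} → (∀ x → ¬ Free D A x) → # a D A? ≡ 0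
    #-none {A? = A?} h with list (components a D A?) | all-A (components a D A?)
    ... | [] | _ = refl
    ... | x ∷ _ | p ∷ _ = contradiction p (h x)

  opaque
    unfolding #

    #-one : ∀ {A} {A? : Decidable A} v → Free D A v → (∀ x → Free D A x → Conn a D v x) → # a D A? ≡ 1
    #-one {A? = A?} v p h = Reps-length a-sym (components a D A?)
      (record { list = v ∷ [] ; all-A = p ∷ [] ; apart = [] ∷ [] ; covered = λ x q → here (Conn-sym a-sym (h x q)) })
      (λ _ q → q) (λ _ q → q)

  opaque
    unfolding #

    #-∑ : ∀ {N A} {A? : Decidable A} (f : Fin m → Fin N) → (∀ {x y} → Conn a D x y → f x ≡ f y) →
      # a D A? ≡ ∑ λ t → # a D (λ x → A? x ×-dec (f x ≟ t))
    #-∑ {A? = A?} f inv = trans (count f (list (components a D A?)))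
      (∑-cong λ t → ≡-sym (#-filter a-sym A? (λ x → f x ≟ t) λ c → trans (≡-sym (inv c))))
      where
      count : ∀ {N} (f : Fin m → Fin N) xs → length xs ≡ ∑ λ t → length (filter (λ x → f x ≟ t) xs)
      count {N} f [] = zeros N
        where
        zeros : ∀ N → 0 ≡ ∑ {N} λ _ → 0
        zeros zero = refl
        zeros (suc N) = zeros N
      count {N} f (x ∷ xs) = trans (cong suc (count f xs))
        (≡-sym (trans (∑-cong peel) (∑-δ (f x) (λ t → length (filter (λ x → f x ≟ t) xs)))))
        where
        peel : ∀ t → length (filter (λ x → f x ≟ t) (x ∷ xs)) ≡ δ (f x) t + length (filter (λ x → f x ≟ t) xs)
        peel t with does (f x ≟ t)
        ... | true = refl
        ... | false = refl

module _ {m : ℕ} {a : Fin m → Fin m → Bool} (a-sym : ∀ u v → a u v ≡ a v u) {D : Fin m → Bool} where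

  opaque
    unfolding #

    #-Reps : ∀ {A} {A? : Decidable A} (T : Reps (Free D A) (Conn a D)) → # a D A? ≡ length (list T)
    #-Reps T = Reps-length a-sym (components a D _) T (λ _ p → p) (λ _ p → p)

    #-components : ∀ {A} (A? : Decidable A) → # a D A? ≡ length (list (components a D A?))
    #-components A? = refl

  module _ {N : ℕ} (f : Fin m → Fin N) (f-inv : ∀ {x y} → Conn a D x y → f x ≡ f y)
           (c : Fin N → ℕ) (c≤ : ∀ t → c t ≤ # a D (λ x → f x ≟ t)) where

    private
      chosen : Fin N → List (Fin m)
      chosen t = take (c t) (list (components a D (λ x → f x ≟ t)))

      chosen? : ∀ x → Dec (Any (Conn a D x) (chosen (f x)))
      chosen? x = any? (conn? a D x) (chosen (f x))

    -- Among the components of value `t`, the first `c t` in the list of representatives are marked.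
    -- This is how a prescribed division of the components is realised when the factors of a fusion
    -- are constructed.
    select : Fin m → Bool
    select x = does (chosen? x)

    select-inv : ∀ {x y} → Conn a D x y → select x ≡ select y
    select-inv {x} {y} k = does-ext (chosen? x) (chosen? y)
      (λ p → Any.map (Conn-trans (Conn-sym a-sym k)) (subst (λ t → Any (Conn a D x) (chosen t)) (f-inv k) p))
      (λ p → Any.map (Conn-trans k) (subst (λ t → Any (Conn a D y) (chosen t)) (≡-sym (f-inv k)) p))

    #-select : ∀ t → # a D (λ x → (f x ≟ t) ×-dec (select x Bool.≟ true)) ≡ c t
    #-select t = trans (#-Reps (record
      { list = chosen t
      ; all-A = All.tabulate λ {x} i → let (d , e) = All.lookup (All.take⁺ (c t) (all-A T)) i in
          d , e , dec-true (chosen? x) (subst (λ t → Any (Conn a D x) (chosen t)) (≡-sym e) (Any.map (λ { refl → stop d }) i))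
      ; apart = AllPairs.take⁺ (c t) (apart T)
      ; covered = λ x (d , e , p) → subst (λ t → Any (Conn a D x) (chosen t)) e (does-true (chosen? x) p) }))
      (trans (List.length-take (c t) (list T)) (ℕ.m≤n⇒m⊓n≡m (ℕ.≤-trans (c≤ t) (ℕ.≤-reflexive (#-components (λ x → f x ≟ t))))))
      where
      T = components a D (λ x → f x ≟ t)

-- Counting up to a threshold, and invariants of components

infix 4 _≈[_]_

-- Equality of the minima with `s`, written as a disjunction so that proofs can split on it.
_≈[_]_ : ℕ → ℕ → ℕ → Set
a ≈[ s ] b = a ≡ b ⊎ (s ≤ a × s ≤ b)

≈-refl : ∀ {s a} → a ≈[ s ] a
≈-refl = inj₁ refl

≈-sym : ∀ {s a b} → a ≈[ s ] b → b ≈[ s ] a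
≈-sym (inj₁ e) = inj₁ (≡-sym e)
≈-sym (inj₂ (p , q)) = inj₂ (q , p)

≈-trans : ∀ {s a b c} → a ≈[ s ] b → b ≈[ s ] c → a ≈[ s ] c
≈-trans (inj₁ refl) h = h
≈-trans h@(inj₂ _) (inj₁ refl) = h
≈-trans (inj₂ (p , _)) (inj₂ (_ , q)) = inj₂ (p , q)

≈-weaken : ∀ {s s′ a b} → s ≤ s′ → a ≈[ s′ ] b → a ≈[ s ] b
≈-weaken l (inj₁ e) = inj₁ e
≈-weaken l (inj₂ (p , q)) = inj₂ (ℕ.≤-trans l p , ℕ.≤-trans l q)

≈-+ : ∀ {s a b c d} → a ≈[ s ] b → c ≈[ s ] d → a + c ≈[ s ] b + d
≈-+ (inj₁ refl) (inj₁ refl) = inj₁ refl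
≈-+ (inj₂ (p , q)) _ = inj₂ (ℕ.≤-trans p (ℕ.m≤m+n _ _) , ℕ.≤-trans q (ℕ.m≤m+n _ _))
≈-+ {a = a} {b} (inj₁ _) (inj₂ (p , q)) = inj₂ (ℕ.≤-trans p (ℕ.m≤n+m _ a) , ℕ.≤-trans q (ℕ.m≤n+m _ b))

≈-∑ : ∀ {s N} {f g : Fin N → ℕ} → (∀ t → f t ≈[ s ] g t) → ∑ f ≈[ s ] ∑ g
≈-∑ {N = zero} h = ≈-refl
≈-∑ {N = suc N} h = ≈-+ (h zero) (≈-∑ (h ∘ suc))

-- Removing at most one object costs one unit of the threshold; this is the loss incurred by
-- forgetting a port.
≈-∸δ : ∀ {s a b} {N} (i t : Fin N) → a ≈[ suc s ] b → a ∸ δ i t ≈[ s ] b ∸ δ i t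
≈-∸δ i t h with does (i ≟ t)
≈-∸δ i t h | false = ≈-weaken (ℕ.n≤1+n _) h
≈-∸δ i t (inj₁ refl) | true = inj₁ refl
≈-∸δ i t (inj₂ (s≤s p , s≤s q)) | true = inj₂ (p , q)

cap : ∀ s → ℕ → Fin (suc s)
cap s a = fromℕ< (s≤s (ℕ.m⊓n≤n a s))

toℕ-cap : ∀ s a → toℕ (cap s a) ≡ a ⊓ s
toℕ-cap s a = Fin.toℕ-fromℕ< _

cap-≈ : ∀ s a → toℕ (cap s a) ≈[ s ] a
cap-≈ s a with ℕ.≤-total a s
... | inj₁ l = inj₁ (trans (toℕ-cap s a) (ℕ.m≤n⇒m⊓n≡m l))
... | inj₂ l = inj₂ (ℕ.≤-reflexive (≡-sym (trans (toℕ-cap s a) (ℕ.m≥n⇒m⊓n≡n l))) , l)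

cap-cong : ∀ {s a b} → a ≈[ s ] b → cap s a ≡ cap s b
cap-cong (inj₁ refl) = refl
cap-cong {s} {a} {b} (inj₂ (p , q)) = Fin.toℕ-injective (trans (toℕ-cap s a)
  (trans (ℕ.m≥n⇒m⊓n≡n p) (≡-sym (trans (toℕ-cap s b) (ℕ.m≥n⇒m⊓n≡n q)))))

funToFin-cong : ∀ {k N} {f g : Fin k → Fin N} → f ≗ g → funToFin f ≡ funToFin g
funToFin-cong {zero} h = refl
funToFin-cong {suc k} h = cong₂ combine (h zero) (funToFin-cong (h ∘ suc))

bit : Bool → Fin 2
bit false = zero
bit true = suc zero

-- Boolean vectors are coded as numbers so that invariants take values in some `Fin` and searches
-- over these values are decidable.
bits : ∀ k → Fin (2 ^ k) → Fin k → Bool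
bits k c i = does (finToFun {2} {k} c i ≟ suc zero)

unbits : ∀ {k} → (Fin k → Bool) → Fin (2 ^ k)
unbits f = funToFin (bit ∘ f)

bits-unbits : ∀ {k} (f : Fin k → Bool) → bits k (unbits f) ≗ f
bits-unbits {k} f i rewrite Fin.finToFun-funToFin (bit ∘ f) i with f i
... | false = refl
... | true = refl

unbits-bits : ∀ {k} (c : Fin (2 ^ k)) → unbits (bits k c) ≡ c
unbits-bits {k} c = trans (funToFin-cong {k} {2} λ i → bit-does (finToFun {2} {k} c i)) (Fin.funToFin-finToFin {k} {2} c)
  where
  bit-does : ∀ (i : Fin 2) → bit (does (i ≟ suc zero)) ≡ i
  bit-does zero = refl
  bit-does (suc zero) = refl

unbits-cong : ∀ {k} {f g : Fin k → Bool} → f ≗ g → unbits f ≡ unbits g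
unbits-cong h = funToFin-cong (cong bit ∘ h)

-- Extends at the end because the port touched by forget and add is the last one.
snoc : ∀ {X : Set} {k} → (Fin k → X) → X → Fin (suc k) → X
snoc {k = zero} f x _ = x
snoc {k = suc k} f x zero = f zero
snoc {k = suc k} f x (suc i) = snoc (f ∘ suc) x i

snoc-inject₁ : ∀ {X : Set} {k} (f : Fin k → X) x i → snoc f x (inject₁ i) ≡ f i
snoc-inject₁ f x zero = refl
snoc-inject₁ f x (suc i) = snoc-inject₁ (f ∘ suc) x i

snoc-fromℕ : ∀ {X : Set} {k} (f : Fin k → X) x → snoc f x (fromℕ k) ≡ x
snoc-fromℕ {k = zero} f x = refl
snoc-fromℕ {k = suc k} f x = snoc-fromℕ (f ∘ suc) x

snoc-elim : ∀ {k} (Q : Fin (suc k) → Set) → (∀ i → Q (inject₁ i)) → Q (fromℕ k) → ∀ i → Q i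
snoc-elim Q f q i with view i
... | ‵fromℕ = q
... | ‵inj₁ {i = j} _ = f j

-- Finite-valued isomorphism invariants of a component whose vertices carry k unary colours;
-- the colours record the adjacencies to the deleted vertices.  N is the number of values.
data Inv : ℕ → ℕ → Set where
  triv : ∀ {k} → Inv k 1
  pair : ∀ {k M N} → Inv k M → Inv k N → Inv k (M * N)
  ren  : ∀ {k k′ N} → (Fin k → Maybe (Fin k′)) → Inv k N → Inv k′ N
  ex   : ∀ {k N} (s : ℕ) → Inv (suc k) N → Inv k (2 ^ (2 ^ k * suc s ^ N))

recolour : ∀ {m k k′} → (Fin k → Maybe (Fin k′)) → (Fin k′ → Fin m → Bool) → Fin k → Fin m → Bool
recolour r P i v = maybe (λ j → P j v) false (r i)

module _ {m N : ℕ} (a : Fin m → Fin m → Bool) (D : Fin m → Bool) (F : Fin m → Fin m → Fin N) where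

  inner : Fin m → Fin N → ℕ
  inner v t = # a (D ⊕ v) (λ y → conn? a D v y ×-dec (F v y ≟ t))

  -- Some v in the component of x has colours r, and the components left after deleting v from
  -- that component realise every value t of F v exactly ĉ t times, up to the threshold s.
  Probe : ∀ {k} (s : ℕ) → (Fin k → Fin m → Bool) → Fin m → Fin (2 ^ k) → Fin (suc s ^ N) → Set
  Probe {k} s P x r ĉ = ∃ λ v → Conn a D x v × (∀ i → P i v ≡ bits k r i) ×
    (∀ t → cap s (inner v t) ≡ finToFun ĉ t)

  probe? : ∀ {k} s (P : Fin k → Fin m → Bool) x r ĉ → Dec (Probe s P x r ĉ)
  probe? s P x r ĉ = Fin.any? λ v → conn? a D x v ×-dec
    Fin.all? (λ i → P i v Bool.≟ bits _ r i) ×-dec Fin.all? (λ t → cap s (inner v t) ≟ finToFun ĉ t)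

  -- Characteristic function of the set of realised pairs of a colour row and a vector of capped
  -- counts. There are `2 ^ k` rows and `suc s ^ N` vectors, whence the number of values of `ex`.
  probes : ∀ {k} s (P : Fin k → Fin m → Bool) → Fin m → Fin (2 ^ k * suc s ^ N) → Bool
  probes {k} s P x c = does (probe? s P x
    (proj₁ (remQuot {2 ^ k} (suc s ^ N) c)) (proj₂ (remQuot {2 ^ k} (suc s ^ N) c)))

probes-ext : ∀ {m m′ N k} a D (F : Fin m → Fin m → Fin N) a′ D′ (F′ : Fin m′ → Fin m′ → Fin N)
  s (P : Fin k → Fin m → Bool) (P′ : Fin k → Fin m′ → Bool) x x′ →
  (∀ r ĉ → Probe a D F s P x r ĉ → Probe a′ D′ F′ s P′ x′ r ĉ) →
  (∀ r ĉ → Probe a′ D′ F′ s P′ x′ r ĉ → Probe a D F s P x r ĉ) →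
  unbits (probes a D F s P x) ≡ unbits (probes a′ D′ F′ s P′ x′)
probes-ext a D F a′ D′ F′ s P P′ x x′ f g =
  unbits-cong {f = probes a D F s P x} {g = probes a′ D′ F′ s P′ x′} λ c →
  does-ext (probe? a D F s P x _ _) (probe? a′ D′ F′ s P′ x′ _ _) (f _ _) (g _ _)

module _ {m : ℕ} (a : Fin m → Fin m → Bool) where

  -- In `ex` the probed vertex joins the deleted set and its neighbourhood becomes the last colour,
  -- so `I` evaluates the pieces as if that vertex were a new port.
  val : ∀ {k N} → Inv k N → (Fin m → Bool) → (Fin k → Fin m → Bool) → Fin m → Fin N
  val triv D P x = zero
  val (pair I J) D P x = combine (val I D P x) (val J D P x)
  val (ren r I) D P x = val I D (recolour r P) x
  val (ex s I) D P x = unbits (probes a D (λ v → val I (D ⊕ v) (snoc P (a v))) s P x)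

val-ex : ∀ {m k N s} {a : Fin m → Fin m → Bool} (I : Inv (suc k) N) {D} {P : Fin k → Fin m → Bool} {x} r ĉ →
  (bits (2 ^ k * suc s ^ N) (val a (ex s I) D P x) (combine r ĉ) ≡ true) ⇔
  Probe a D (λ v → val a I (D ⊕ v) (snoc P (a v))) s P x r ĉ
val-ex {k = k} {N} {s} {a} I {D} {P} {x} r ĉ = mk⇔
  (λ e → subst Q (Fin.remQuot-combine r ĉ) (does-true (probe? a D F s P x _ _) (trans (≡-sym eq) e)))
  (λ q → trans eq (dec-true (probe? a D F s P x _ _) (subst Q (≡-sym (Fin.remQuot-combine r ĉ)) q)))
  where
  F = λ v → val a I (D ⊕ v) (snoc P (a v))
  Q : Fin (2 ^ k) × Fin (suc s ^ N) → Set
  Q (r , ĉ) = Probe a D F s P x r ĉ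
  eq = bits-unbits (probes a D F s P x) (combine r ĉ)

-- The base point enters a probe only through the component in which the probed vertex is sought.
val-conn : ∀ {m k N} {a : Fin m → Fin m → Bool} → (∀ u v → a u v ≡ a v u) → (I : Inv k N) →
  ∀ {D P x y} → Conn a D x y → val a I D P x ≡ val a I D P y
val-conn s triv c = refl
val-conn s (pair I J) c = cong₂ combine (val-conn s I c) (val-conn s J c)
val-conn s (ren r I) c = val-conn s I c
val-conn {a = a} s (ex t I) {D} {P} {x} {y} c =
  probes-ext a D (λ v → val a I (D ⊕ v) (snoc P (a v))) a D (λ v → val a I (D ⊕ v) (snoc P (a v))) t P P x y
    (λ { r ĉ (v , d , h) → v , Conn-trans (Conn-sym s c) d , h })
    (λ { r ĉ (v , d , h) → v , Conn-trans c d , h })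

-- E restricts to an isomorphism from a union of components of a − D to a union of components of a′ − D′.
record Loc {m m′ k : ℕ} (a : Fin m → Fin m → Bool) (D : Fin m → Bool) (P : Fin k → Fin m → Bool)
           (a′ : Fin m′ → Fin m′ → Bool) (D′ : Fin m′ → Bool) (P′ : Fin k → Fin m′ → Bool)
           (E : Fin m → Fin m′ → Set) : Set where
  field
    sym₁    : ∀ u v → a u v ≡ a v u
    sym₂    : ∀ u v → a′ u v ≡ a′ v u
    blocked : ∀ {y y′} → E y y′ → D y ≡ D′ y′
    colour  : ∀ {y y′} → E y y′ → ∀ i → P i y ≡ P′ i y′
    edges   : ∀ {y y′ z z′} → E y y′ → E z z′ → a y z ≡ a′ y′ z′
    fun     : ∀ {y y′ z z′} → E y y′ → E z z′ → y ≡ z → y′ ≡ z′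
    inj     : ∀ {y y′ z z′} → E y y′ → E z z′ → y′ ≡ z′ → y ≡ z
    forth   : ∀ {y y′ z} → E y y′ → D y ≡ false → a y z ≡ true → D z ≡ false → ∃ λ z′ → E z z′
    back    : ∀ {y y′ z′} → E y y′ → D′ y′ ≡ false → a′ y′ z′ ≡ true → D′ z′ ≡ false → ∃ λ z → E z z′

module _ {m m′ k : ℕ} {a : Fin m → Fin m → Bool} {D : Fin m → Bool} {P : Fin k → Fin m → Bool}
         {a′ : Fin m′ → Fin m′ → Bool} {D′ : Fin m′ → Bool} {P′ : Fin k → Fin m′ → Bool}
         {E : Fin m → Fin m′ → Set} (L : Loc a D P a′ D′ P′ E) where

  open Loc L

  Loc-swap : Loc a′ D′ P′ a D P (λ y′ y → E y y′)
  Loc-swap = record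
    { sym₁ = sym₂ ; sym₂ = sym₁ ; blocked = λ e → ≡-sym (blocked e) ; colour = λ e i → ≡-sym (colour e i)
    ; edges = λ e e′ → ≡-sym (edges e e′) ; fun = inj ; inj = fun ; forth = back ; back = forth }

  Loc-conn : ∀ {y y′ z} → E y y′ → Conn a D y z → ∃ λ z′ → E z z′ × Conn a′ D′ y′ z′
  Loc-conn e (stop d) = _ , e , stop (trans (≡-sym (blocked e)) d)
  Loc-conn e (go d g c) with forth e d g (Conn-start c)
  ... | w , e′ with Loc-conn e′ c
  ...   | z′ , e″ , c′ = z′ , e″ , go (trans (≡-sym (blocked e)) d) (trans (≡-sym (edges e e′)) g) c′

  -- `edges` turns the neighbourhoods of the deleted pair into matching colours, while `forth` and
  -- `back` survive because fewer vertices are left to reach.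
  Loc-delete : ∀ {v v′} → E v v′ → Loc a (D ⊕ v) (snoc P (a v)) a′ (D′ ⊕ v′) (snoc P′ (a′ v′)) E
  Loc-delete {v} {v′} e = record
    { sym₁ = sym₁ ; sym₂ = sym₂
    ; blocked = λ e′ → cong₂ _∨_ (blocked e′) (does-ext (_ ≟ v) (_ ≟ v′) (fun e′ e) (inj e′ e))
    ; colour = λ {y} {y′} e′ → snoc-elim (λ i → snoc P (a v) i y ≡ snoc P′ (a′ v′) i y′)
        (λ i → subst₂ (λ p q → p y ≡ q y′) (≡-sym (snoc-inject₁ P (a v) i)) (≡-sym (snoc-inject₁ P′ (a′ v′) i)) (colour e′ i))
        (subst₂ (λ p q → p y ≡ q y′) (≡-sym (snoc-fromℕ P (a v))) (≡-sym (snoc-fromℕ P′ (a′ v′))) (edges e e′))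
    ; edges = edges ; fun = fun ; inj = inj
    ; forth = λ e′ d g d′ → forth e′ (proj₁ (⊕-false⁻ D d)) g (proj₁ (⊕-false⁻ D d′))
    ; back = λ e′ d g d′ → back e′ (proj₁ (⊕-false⁻ D′ d)) g (proj₁ (⊕-false⁻ D′ d′)) }

Loc-conn⁻ : ∀ {m m′ k} {a : Fin m → Fin m → Bool} {D} {P : Fin k → Fin m → Bool}
  {a′ : Fin m′ → Fin m′ → Bool} {D′ P′ E} (L : Loc a D P a′ D′ P′ E) →
  ∀ {y y′ z z′} → E y y′ → E z z′ → Conn a′ D′ y′ z′ → Conn a D y z
Loc-conn⁻ L e e′ c with Loc-conn (Loc-swap L) e c
... | w , e″ , c′ with Loc.inj L e″ e′ refl
...   | refl = c′

inner-≤ : ∀ {m m′ k N} {a : Fin m → Fin m → Bool} {D} {P : Fin k → Fin m → Bool}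
  {a′ : Fin m′ → Fin m′ → Bool} {D′ P′ E} (L : Loc a D P a′ D′ P′ E)
  {F : Fin m → Fin m → Fin N} {F′ : Fin m′ → Fin m′ → Fin N} →
  (∀ {v v′ y y′} → E v v′ → E y y′ → F v y ≡ F′ v′ y′) →
  ∀ {v v′} t → E v v′ → inner a D F v t ≤ inner a′ D′ F′ v′ t
inner-≤ {a = a} {E = E} L {F} {F′} ih {v} {v′} t e = #-≤ (Loc.sym₂ L) E
  (λ { x (d , c , q) → let (x′ , e′ , c′) = Loc-conn L e c in
    x′ , (trans (≡-sym (Loc.blocked (Loc-delete L e) e′)) d , c′ , trans (≡-sym (ih e e′)) q) , e′ })
  (λ _ _ e₁ e₂ c → Loc-conn⁻ (Loc-delete L e) e₁ e₂ c)

Probe-loc : ∀ {m m′ k N} {a : Fin m → Fin m → Bool} {D} {P : Fin k → Fin m → Bool}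
  {a′ : Fin m′ → Fin m′ → Bool} {D′ P′ E} (L : Loc a D P a′ D′ P′ E)
  {F : Fin m → Fin m → Fin N} {F′ : Fin m′ → Fin m′ → Fin N} →
  (∀ {v v′ y y′} → E v v′ → E y y′ → F v y ≡ F′ v′ y′) →
  ∀ {s x x′ r ĉ} → E x x′ → Probe a D F s P x r ĉ → Probe a′ D′ F′ s P′ x′ r ĉ
Probe-loc L ih e (v , c , p , q) with Loc-conn L e c
... | v′ , e′ , c′ = v′ , c′ , (λ i → trans (≡-sym (Loc.colour L e′ i)) (p i))
  , λ t → trans (cong (cap _) (ℕ.≤-antisym
      (inner-≤ (Loc-swap L) (λ e₁ e₂ → ≡-sym (ih e₁ e₂)) t e′) (inner-≤ L ih t e′))) (q t)

-- Induction on the invariant: `ex` deletes a matched pair of vertices, and `Loc` survives that.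
-- Isomorphisms, embeddings into a fusion, permutations of ports and added ports are all treated as
-- instances.
val-loc : ∀ {m m′ k N} {a : Fin m → Fin m → Bool} {D} {P : Fin k → Fin m → Bool}
  {a′ : Fin m′ → Fin m′ → Bool} {D′ P′ E} (I : Inv k N) → Loc a D P a′ D′ P′ E →
  ∀ {x x′} → E x x′ → val a I D P x ≡ val a′ I D′ P′ x′
val-loc triv L e = refl
val-loc (pair I J) L e = cong₂ combine (val-loc I L e) (val-loc J L e)
val-loc {P = P} {P′ = P′} (ren r I) L e = val-loc I (record
  { sym₁ = sym₁ ; sym₂ = sym₂ ; blocked = blocked ; colour = colour′
  ; edges = edges ; fun = fun ; inj = inj ; forth = forth ; back = back }) e
  where
  open Loc L
  colour′ : ∀ {y y′} → _ → ∀ i → recolour r P i y ≡ recolour r P′ i y′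
  colour′ e i with r i
  ... | just j = colour e j
  ... | nothing = refl
val-loc {a = a} {D} {P} {a′} {D′} {P′} (ex s I) L {x} {x′} e =
  probes-ext a D (λ v → val a I (D ⊕ v) (snoc P (a v))) a′ D′ (λ v → val a′ I (D′ ⊕ v) (snoc P′ (a′ v))) s P P′ x x′
  (λ r ĉ → Probe-loc L (λ e₁ e₂ → val-loc I (Loc-delete L e₁) e₂) e)
  (λ r ĉ → Probe-loc (Loc-swap L) (λ e₁ e₂ → ≡-sym (val-loc I (Loc-delete L e₁) e₂)) e)

val-cong : ∀ {m k N} {a : Fin m → Fin m → Bool} → (∀ u v → a u v ≡ a v u) → (I : Inv k N) →
  ∀ {D D′ P P′} → D ≗ D′ → (∀ i → P i ≗ P′ i) → val a I D P ≗ val a I D′ P′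
val-cong s I {D} {D′} h h′ x = val-loc {E = _≡_} I (record
  { sym₁ = s ; sym₂ = s ; blocked = λ { refl → h _ } ; colour = λ { refl i → h′ i _ }
  ; edges = λ { refl refl → refl } ; fun = λ { refl refl e → e } ; inj = λ { refl refl e → e }
  ; forth = λ _ _ _ _ → _ , refl ; back = λ _ _ _ _ → _ , refl }) refl

-- Definable predicates

range : ∀ {m l} → (Fin l → Fin m) → Fin m → Bool
range p v = does (Fin.any? λ i → p i ≟ v)

range-true : ∀ {m l} (p : Fin l → Fin m) i → range p (p i) ≡ true
range-true p i = dec-true (Fin.any? λ j → p j ≟ p i) (i , refl)

range-true⁻ : ∀ {m l} (p : Fin l → Fin m) {v} → range p v ≡ true → ∃ λ i → p i ≡ v
range-true⁻ p = does-true (Fin.any? λ i → p i ≟ _)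

range-false⁻ : ∀ {m l} (p : Fin l → Fin m) {v} → range p v ≡ false → ∀ i → p i ≢ v
range-false⁻ p h i e = does-false (Fin.any? λ i → p i ≟ _) h (i , e)

range-false : ∀ {m l} (p : Fin l → Fin m) {v} → (∀ i → p i ≢ v) → range p v ≡ false
range-false p h = dec-false (Fin.any? λ i → p i ≟ _) λ { (i , e) → h i e }

range⇔∈ : ∀ {m l} (p : Fin l → Fin m) {v} → (range p v ≡ true) ⇔ (v ∈ᵥ Vec.tabulate p)
range⇔∈ p = mk⇔
  (λ e → let (i , e′) = range-true⁻ p e in VecAny.tabulate⁺ i (≡-sym e′))
  (λ v∈ → let (i , e) = VecAny.tabulate⁻ v∈ in subst (λ z → range p z ≡ true) (≡-sym e) (range-true p i))

range-snoc : ∀ {m l} (p : Fin l → Fin m) (q : Fin (suc l) → Fin m) v →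
  (∀ i → q (inject₁ i) ≡ p i) → q (fromℕ l) ≡ v → range q ≗ (range p ⊕ v)
range-snoc {m} {l} p q v h h′ w = bool-ext to from
  where
  to : range q w ≡ true → (range p ⊕ v) w ≡ true
  to e with range-true⁻ q e
  ... | i , refl = snoc-elim (λ i → (range p ⊕ v) (q i) ≡ true)
    (λ i → cong (_∨ does (q (inject₁ i) ≟ v)) (subst (λ z → range p z ≡ true) (≡-sym (h i)) (range-true p i)))
    (trans (cong (range p _ ∨_) (dec-true (q (fromℕ l) ≟ v) h′)) (Bool.∨-zeroʳ _)) i
  from : (range p ⊕ v) w ≡ true → range q w ≡ true
  from e with false-or-true (range p w)
  ... | inj₂ t with range-true⁻ p t
  ...   | i , refl = subst (λ z → range q z ≡ true) (h i) (range-true q (inject₁ i))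
  from e | inj₁ f rewrite f with does-true (w ≟ v) e
  ... | refl = subst (λ z → range q z ≡ true) h′ (range-true q (fromℕ l))

#-cong-blocked : ∀ {m} {a : Fin m → Fin m → Bool} → (∀ u v → a u v ≡ a v u) → ∀ {D D′ A} {A? : Decidable A} →
  D ≗ D′ → # a D A? ≡ # a D′ A?
#-cong-blocked {a = a} s {A = A} {A?} h = ℕ.≤-antisym (half h) (half (λ x → ≡-sym (h x)))
  where
  half : ∀ {D D′} → D ≗ D′ → # a D A? ≤ # a D′ A?
  half h = #-≤ s _≡_ (λ { x (d , p) → x , (trans (≡-sym (h x)) d , p) , refl })
    (λ { _ _ refl refl c → Conn-mono (λ v d → trans (h v) d) c })

Sat-ext : ∀ {k m} (G : Graph k) {ρ ρ′ : Fin m → Fin (n G)} → ρ ≗ ρ′ → ∀ φ → Sat G ρ φ → Sat G ρ′ φ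
Sat-ext G h (edge i j) s = subst₂ (λ x y → adj G x y ≡ true) (h i) (h j) s
Sat-ext G h (equal i j) s = trans (≡-sym (h i)) (trans s (h j))
Sat-ext G h (sep l x y zs) s = subst (Separates G _ _) (Vec.map-cong h zs)
  (subst₂ (λ u v → Separates G u v _) (h x) (h y) s)
Sat-ext G h (neg φ) s t = s (Sat-ext G (≡-sym ∘ h) φ t)
Sat-ext G h (and φ ψ) (s , t) = Sat-ext G h φ s , Sat-ext G h ψ t
Sat-ext G h (or φ ψ) (inj₁ s) = inj₁ (Sat-ext G h φ s)
Sat-ext G h (or φ ψ) (inj₂ s) = inj₂ (Sat-ext G h ψ s)
Sat-ext G h (ex′ φ) (v , s) = v , Sat-ext G (λ { zero → refl ; (suc i) → h i }) φ s
Sat-ext G h (all′ φ) s v = Sat-ext G (λ { zero → refl ; (suc i) → h i }) φ (s v)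

lift : ∀ {m m′} → (Fin m → Fin m′) → Fin (suc m) → Fin (suc m′)
lift f zero = zero
lift f (suc i) = suc (f i)

rename : ∀ {m m′} → (Fin m → Fin m′) → Formula m → Formula m′
rename f (edge i j) = edge (f i) (f j)
rename f (equal i j) = equal (f i) (f j)
rename f (sep l x y zs) = sep l (f x) (f y) (Vec.map f zs)
rename f (neg φ) = neg (rename f φ)
rename f (and φ ψ) = and (rename f φ) (rename f ψ)
rename f (or φ ψ) = or (rename f φ) (rename f ψ)
rename f (ex′ φ) = ex′ (rename (lift f) φ)
rename f (all′ φ) = all′ (rename (lift f) φ)

module _ {k : ℕ} (G : Graph k) where

  Sat-rename : ∀ {m m′} (f : Fin m → Fin m′) (ρ : Fin m′ → Fin (n G)) φ →
    Sat G ρ (rename f φ) ⇔ Sat G (ρ ∘ f) φ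
  Sat-rename f ρ (edge i j) = mk⇔ id id
  Sat-rename f ρ (equal i j) = mk⇔ id id
  Sat-rename f ρ (sep l x y zs) rewrite Vec.map-∘ ρ f zs = mk⇔ id id
  Sat-rename f ρ (neg φ) with Sat-rename f ρ φ
  ... | h = mk⇔ (λ s t → s (Equivalence.from h t)) (λ s t → s (Equivalence.to h t))
  Sat-rename f ρ (and φ ψ) with Sat-rename f ρ φ | Sat-rename f ρ ψ
  ... | h | h′ = mk⇔ (λ { (s , t) → Equivalence.to h s , Equivalence.to h′ t })
    (λ { (s , t) → Equivalence.from h s , Equivalence.from h′ t })
  Sat-rename f ρ (or φ ψ) with Sat-rename f ρ φ | Sat-rename f ρ ψ
  ... | h | h′ = mk⇔ [ inj₁ ∘ Equivalence.to h , inj₂ ∘ Equivalence.to h′ ]′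
    [ inj₁ ∘ Equivalence.from h , inj₂ ∘ Equivalence.from h′ ]′
  Sat-rename f ρ (ex′ φ) = mk⇔
    (λ { (v , s) → v , Sat-ext G (λ { zero → refl ; (suc i) → refl }) φ (Equivalence.to (Sat-rename (lift f) (v ∷ᶠ ρ) φ) s) })
    (λ { (v , s) → v , Equivalence.from (Sat-rename (lift f) (v ∷ᶠ ρ) φ) (Sat-ext G (λ { zero → refl ; (suc i) → refl }) φ s) })
  Sat-rename f ρ (all′ φ) = mk⇔
    (λ s v → Sat-ext G (λ { zero → refl ; (suc i) → refl }) φ (Equivalence.to (Sat-rename (lift f) (v ∷ᶠ ρ) φ) (s v)))
    (λ s v → Equivalence.from (Sat-rename (lift f) (v ∷ᶠ ρ) φ) (Sat-ext G (λ { zero → refl ; (suc i) → refl }) φ (s v)))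

Predicate : ℕ → Set₁
Predicate m = ∀ {k} (G : Graph k) → (Fin m → Fin (n G)) → Set

record Def {m : ℕ} (P : Predicate m) : Set where
  constructor def
  field
    formula : Formula m
    correct : ∀ {k} (G : Graph k) ρ → P G ρ ⇔ Sat G ρ formula

module _ {m : ℕ} where

  D-⇔ : {P Q : Predicate m} → (∀ {k} (G : Graph k) ρ → P G ρ → Q G ρ) →
    (∀ {k} (G : Graph k) ρ → Q G ρ → P G ρ) → Def P → Def Q
  D-⇔ f g (def φ c) = def φ λ G ρ → mk⇔ (Equivalence.to (c G ρ) ∘ g G ρ) (f G ρ ∘ Equivalence.from (c G ρ))

  -- Formulas have no truth constants; a quantified reflexive equation provides them even when there
  -- is no free variable.
  D-dec : ∀ {A : Set} → Dec A → Def {m} (λ G ρ → A)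
  D-dec (yes a) = def (all′ (equal zero zero)) λ G ρ → mk⇔ (λ _ _ → refl) (λ _ → a)
  D-dec (no ¬a) = def (neg (all′ (equal zero zero))) λ G ρ →
    mk⇔ (λ a → contradiction a ¬a) (λ s → contradiction (λ _ → refl) s)

  D-edge : ∀ i j → Def {m} (λ G ρ → adj G (ρ i) (ρ j) ≡ true)
  D-edge i j = def (edge i j) λ G ρ → mk⇔ id id

  D-¬ : {P : Predicate m} → Def P → Def {m} (λ G ρ → ¬ P G ρ)
  D-¬ (def φ c) = def (neg φ) λ G ρ → mk⇔ (λ h → h ∘ Equivalence.from (c G ρ)) (λ h → h ∘ Equivalence.to (c G ρ))

  D-× : {P Q : Predicate m} → Def P → Def Q → Def {m} (λ G ρ → P G ρ × Q G ρ)
  D-× (def φ c) (def ψ d) = def (and φ ψ) λ G ρ →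
    mk⇔ (λ (p , q) → Equivalence.to (c G ρ) p , Equivalence.to (d G ρ) q)
        (λ (p , q) → Equivalence.from (c G ρ) p , Equivalence.from (d G ρ) q)

  D-⊎ : {P Q : Predicate m} → Def P → Def Q → Def {m} (λ G ρ → P G ρ ⊎ Q G ρ)
  D-⊎ (def φ c) (def ψ d) = def (or φ ψ) λ G ρ →
    mk⇔ [ inj₁ ∘ Equivalence.to (c G ρ) , inj₂ ∘ Equivalence.to (d G ρ) ]′
        [ inj₁ ∘ Equivalence.from (c G ρ) , inj₂ ∘ Equivalence.from (d G ρ) ]′

  D-∃ : {P : Predicate (suc m)} → Def P → Def {m} (λ G ρ → ∃ λ v → P G (v ∷ᶠ ρ))
  D-∃ (def φ c) = def (ex′ φ) λ G ρ →
    mk⇔ (λ (v , p) → v , Equivalence.to (c G (v ∷ᶠ ρ)) p) (λ (v , p) → v , Equivalence.from (c G (v ∷ᶠ ρ)) p)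

  D-∀Fin : ∀ {N} {P : Fin N → Predicate m} → (∀ i → Def (P i)) → Def {m} (λ G ρ → ∀ i → P i G ρ)
  D-∀Fin {zero} h = D-⇔ (λ { _ _ _ () }) (λ _ _ _ → tt) (D-dec (yes tt))
  D-∀Fin {suc N} h = D-⇔ (λ { G ρ (p , q) zero → p ; G ρ (p , q) (suc i) → q i }) (λ G ρ h → h zero , h ∘ suc)
    (D-× (h zero) (D-∀Fin (h ∘ suc)))

  D-∃Fin : ∀ {N} {P : Fin N → Predicate m} → (∀ i → Def (P i)) → Def {m} (λ G ρ → ∃ λ i → P i G ρ)
  D-∃Fin {zero} h = D-⇔ (λ { _ _ () }) (λ { _ _ (() , _) }) (D-dec {A = ⊥} (no λ ()))
  D-∃Fin {suc N} h = D-⇔ (λ { G ρ (inj₁ p) → zero , p ; G ρ (inj₂ (i , p)) → suc i , p })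
    (λ { G ρ (zero , p) → inj₁ p ; G ρ (suc i , p) → inj₂ (i , p) })
    (D-⊎ (h zero) (D-∃Fin (h ∘ suc)))

  D-rename : ∀ {m′} {P : Predicate m} → Def P → (f : Fin m → Fin m′) → Def {m′} (λ G ρ → P G (ρ ∘ f))
  D-rename (def φ c) f = def (rename f φ) λ G ρ →
    mk⇔ (Equivalence.from (Sat-rename G f ρ φ) ∘ Equivalence.to (c G (ρ ∘ f)))
        (Equivalence.from (c G (ρ ∘ f)) ∘ Equivalence.to (Sat-rename G f ρ φ))

  -- The atom `sep` expresses disconnectedness; its negation gives connectedness because `Conn` is
  -- decidable.
  D-conn : ∀ {l} (ds : Fin l → Fin m) x y → Def {m} (λ G ρ → Conn (adj G) (range (ρ ∘ ds)) (ρ x) (ρ y))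
  D-conn {l} ds x y = D-⇔ (λ G ρ → decidable-stable (conn? (adj G) (range (ρ ∘ ds)) (ρ x) (ρ y))) (λ G ρ c ¬c → ¬c c)
    (D-¬ (def (sep l x y (Vec.tabulate ds)) λ G ρ → mk⇔
      (Equivalence.from (separates⇔¬conn G (among G ρ))) (Equivalence.to (separates⇔¬conn G (among G ρ)))))
    where
    among : ∀ {k} (G : Graph k) ρ v → (range (ρ ∘ ds) v ≡ true) ⇔ (v ∈ᵥ Vec.map ρ (Vec.tabulate ds))
    among G ρ v = subst (λ us → (range (ρ ∘ ds) v ≡ true) ⇔ (v ∈ᵥ us)) (Vec.tabulate-∘ ρ ds) (range⇔∈ (ρ ∘ ds))

-- Representatives of j components of G − ds meeting A are chosen one at a time; ys are those chosen before.
module _ {m l : ℕ} (ds : Fin l → Fin m) (A : ∀ {k} (G : Graph k) (ρ : Fin m → Fin (n G)) → Fin (n G) → Set)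
         (dA : Def {suc m} (λ G σ → A G (σ ∘ suc) (σ zero))) where

  Extend : ∀ {k} (G : Graph k) → (Fin m → Fin (n G)) → ℕ → List (Fin (n G)) → Set
  Extend G ρ zero ys = ⊤
  Extend G ρ (suc j) ys = ∃ λ y → (Conn (adj G) (range (ρ ∘ ds)) y y × A G ρ y) ×
    All (λ z → ¬ Conn (adj G) (range (ρ ∘ ds)) z y) ys × Extend G ρ j (y ∷ ys)

  Extend⇒list : ∀ {k} (G : Graph k) ρ j ys → Extend G ρ j ys → ∃ λ zs → length zs ≡ j ×
    All (Free (range (ρ ∘ ds)) (A G ρ)) zs × AllPairs (λ x y → ¬ Conn (adj G) (range (ρ ∘ ds)) x y) zs ×
    All (λ y → All (λ z → ¬ Conn (adj G) (range (ρ ∘ ds)) y z) zs) ys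
  Extend⇒list G ρ zero ys _ = [] , refl , [] , [] , All.universal (λ _ → []) ys
  Extend⇒list G ρ (suc j) ys (y , (c , p) , q , h) with Extend⇒list G ρ j (y ∷ ys) h
  ... | zs , l , ps , qs , r ∷ rs = y ∷ zs , cong suc l , (Conn-start c , p) ∷ ps , r ∷ qs
    , All.zipWith (λ { (s , t) → s ∷ t }) (q , rs)

  list⇒Extend : ∀ {k} (G : Graph k) ρ ys zs → All (Free (range (ρ ∘ ds)) (A G ρ)) zs →
    AllPairs (λ x y → ¬ Conn (adj G) (range (ρ ∘ ds)) x y) zs →
    All (λ z → All (λ y → ¬ Conn (adj G) (range (ρ ∘ ds)) y z) ys) zs → Extend G ρ (length zs) ys
  list⇒Extend G ρ ys [] _ _ _ = tt
  list⇒Extend G ρ ys (z ∷ zs) ((d , p) ∷ ps) (q ∷ qs) (r ∷ rs) = z , (stop d , p) , r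
    , list⇒Extend G ρ (z ∷ ys) zs ps qs (All.zipWith (λ { (s , t) → s ∷ t }) (q , rs))

  -- The `i` representatives chosen so far occupy the lowest de Bruijn variables, the newest at
  -- zero, which is also the head of the list in `Extend`.
  D-Extend : ∀ j i → Def {i + m} (λ G σ → Extend G (σ ∘ (i ↑ʳ_)) j (List.tabulate (σ ∘ (_↑ˡ m))))
  D-Extend zero i = D-dec (yes tt)
  D-Extend (suc j) i = D-∃ (D-× (D-× (D-conn (λ q → suc (i ↑ʳ ds q)) zero zero)
      (D-rename dA λ { zero → zero ; (suc q) → suc (i ↑ʳ q) }))
    (D-× (D-⇔ {Q = λ G σ → All (λ z → ¬ Conn (adj G) (range (σ ∘ suc ∘ (i ↑ʳ_) ∘ ds)) z (σ zero)) (List.tabulate (σ ∘ suc ∘ (_↑ˡ m)))}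
           (λ G σ → All.tabulate⁺) (λ G σ → All.tabulate⁻)
           (D-∀Fin λ q → D-¬ (D-conn (λ q → suc (i ↑ʳ ds q)) (suc (q ↑ˡ m)) zero)))
         (D-Extend j (suc i))))

  D-#≥ : (A? : ∀ {k} (G : Graph k) ρ → Decidable (A G ρ)) → ∀ j →
    Def {m} (λ G ρ → j ≤ # (adj G) (range (ρ ∘ ds)) (A? G ρ))
  D-#≥ A? j = D-⇔
    (λ G ρ e → let (zs , l , p , q , _) = Extend⇒list G ρ j [] e in #≥⁻ (sym G) zs l p q)
    (λ G ρ l → let (zs , e , p , q) = #≥ l in
      subst (λ j → Extend G ρ j []) e (list⇒Extend G ρ [] zs p q (All.universal (λ _ → []) zs)))
    (D-Extend j 0)

  -- A capped value below `s` is an exact number, so "at least `u` and not at least `u + 1`"; the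
  -- value `s` itself only says "at least `s`".
  D-cap : (A? : ∀ {k} (G : Graph k) ρ → Decidable (A G ρ)) → ∀ s u →
    Def {m} (λ G ρ → cap s (# (adj G) (range (ρ ∘ ds)) (A? G ρ)) ≡ u)
  D-cap A? s u = D-⇔ (λ G ρ → to) (λ G ρ → from)
    (D-× (D-#≥ A? (toℕ u)) (D-⊎ (D-dec (s ℕ.≤? toℕ u)) (D-¬ (D-#≥ A? (suc (toℕ u))))))
    where
    cap-toℕ : cap s (toℕ u) ≡ u
    cap-toℕ = Fin.toℕ-injective (trans (toℕ-cap s (toℕ u)) (ℕ.m≤n⇒m⊓n≡m (s≤s⁻¹ (Fin.toℕ<n u))))
    to : ∀ {c} → toℕ u ≤ c × (s ≤ toℕ u ⊎ ¬ suc (toℕ u) ≤ c) → cap s c ≡ u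
    to (l , inj₁ l′) = trans (cap-cong (inj₂ (ℕ.≤-trans l′ l , l′))) cap-toℕ
    to (l , inj₂ ¬l) = trans (cong (cap s) (ℕ.≤-antisym (ℕ.≮⇒≥ ¬l) l)) cap-toℕ
    from : ∀ {c} → cap s c ≡ u → toℕ u ≤ c × (s ≤ toℕ u ⊎ ¬ suc (toℕ u) ≤ c)
    from {c} refl with ℕ.≤-total c s
    ... | inj₁ l = ℕ.≤-reflexive e , inj₂ (λ l′ → ℕ.<⇒≢ l′ e)
      where e = trans (toℕ-cap s c) (ℕ.m≤n⇒m⊓n≡m l)
    ... | inj₂ l = ℕ.≤-trans (ℕ.≤-reflexive e) l , inj₁ (ℕ.≤-reflexive (≡-sym e))
      where e = trans (toℕ-cap s c) (ℕ.m≥n⇒m⊓n≡n l)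

-- Definability of the invariants of components

portColours : ∀ {k m l} (G : Graph k) → (Fin l → Maybe (Fin m)) → (Fin m → Fin (n G)) → Fin l → Fin (n G) → Bool
portColours G p ρ i v = maybe (λ j → adj G (ρ j) v) false (p i)

module _ {m : ℕ} where

  D-bool : {f : ∀ {k} (G : Graph k) → (Fin m → Fin (n G)) → Bool} →
    Def {m} (λ G ρ → f G ρ ≡ true) → ∀ b → Def {m} (λ G ρ → f G ρ ≡ b)
  D-bool d true = d
  D-bool d false = D-⇔ (λ G ρ → Bool.¬-not) (λ G ρ e e′ → true≢false e′ e) (D-¬ d)

  D-colour : ∀ {l} (p : Fin l → Maybe (Fin m)) i x b → Def {m} (λ G ρ → portColours G p ρ i (ρ x) ≡ b)
  D-colour p i x b with p i
  ... | nothing = D-dec (false Bool.≟ b)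
  ... | just j = D-bool (D-edge j x) b

  module _ {l k : ℕ} (ds : Fin l → Fin m) (p : Fin k → Maybe (Fin m)) where

    ds⁺ : Fin (suc l) → Fin (suc m)
    ds⁺ = snoc (suc ∘ ds) zero

    p⁺ : Fin (suc k) → Maybe (Fin (suc m))
    p⁺ = snoc (Maybe.map suc ∘ p) (just zero)

    range⁺ : ∀ {k} (G : Graph k) (ρ : Fin (suc m) → Fin (n G)) → range (ρ ∘ ds⁺) ≗ (range (ρ ∘ suc ∘ ds) ⊕ ρ zero)
    range⁺ G ρ = range-snoc (ρ ∘ suc ∘ ds) (ρ ∘ ds⁺) (ρ zero)
      (λ i → cong ρ (snoc-inject₁ (suc ∘ ds) zero i)) (cong ρ (snoc-fromℕ (suc ∘ ds) zero))

    colours⁺ : ∀ {k′} (G : Graph k′) (ρ : Fin (suc m) → Fin (n G)) i →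
      portColours G p⁺ ρ i ≗ snoc (portColours G p (ρ ∘ suc)) (adj G (ρ zero)) i
    colours⁺ G ρ i x = snoc-elim Q old new i
      where
      Q : Fin (suc k) → Set
      Q i = portColours G p⁺ ρ i x ≡ snoc (portColours G p (ρ ∘ suc)) (adj G (ρ zero)) i x
      colour : Maybe (Fin (suc m)) → Bool
      colour = maybe (λ j → adj G (ρ j) x) false
      shift : ∀ i → colour (Maybe.map suc (p i)) ≡ portColours G p (ρ ∘ suc) i x
      shift i with p i
      ... | nothing = refl
      ... | just j = refl
      old : ∀ i → Q (inject₁ i)
      old i = trans (cong colour (snoc-inject₁ (Maybe.map suc ∘ p) (just zero) i))
        (trans (shift i) (cong (λ f → f x) (≡-sym (snoc-inject₁ (portColours G p (ρ ∘ suc)) (adj G (ρ zero)) i))))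
      new : Q (fromℕ k)
      new = trans (cong colour (snoc-fromℕ (Maybe.map suc ∘ p) (just zero)))
        (cong (λ f → f x) (≡-sym (snoc-fromℕ (portColours G p (ρ ∘ suc)) (adj G (ρ zero)))))

-- A value of `ex` is a vector of bits, each telling whether some probe exists. A probe is a
-- quantified vertex, and its inner counts are numbers of components after deleting one more named
-- vertex, so `D-cap` applies once the smaller invariant is definable.
D-val : ∀ {m l k N} (I : Inv k N) (ds : Fin l → Fin m) (p : Fin k → Maybe (Fin m)) x t →
  Def {m} (λ G ρ → val (adj G) I (range (ρ ∘ ds)) (portColours G p ρ) (ρ x) ≡ t)
D-val triv ds p x t = D-dec (zero ≟ t)
D-val (pair {M = M} {N} I J) ds p x t = D-⇔
  (λ G ρ (e , e′) → trans (cong₂ combine e e′) (Fin.combine-remQuot {M} N t))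
  (λ G ρ e → trans (≡-sym (cong proj₁ (Fin.remQuot-combine {M} {N} _ _))) (cong (proj₁ ∘ remQuot {M} N) e)
           , trans (≡-sym (cong proj₂ (Fin.remQuot-combine {M} {N} _ _))) (cong (proj₂ ∘ remQuot {M} N) e))
  (D-× (D-val I ds p x (proj₁ (remQuot {M} N t))) (D-val J ds p x (proj₂ (remQuot {M} N t))))
D-val (ren r I) ds p x t = D-⇔
  (λ G ρ → trans (≡-sym (same G ρ))) (λ G ρ → trans (same G ρ)) (D-val I ds (λ i → r i >>= p) x t)
  where
  same : ∀ {k} (G : Graph k) ρ → val (adj G) I (range (ρ ∘ ds)) (portColours G (λ i → r i >>= p) ρ) (ρ x) ≡
    val (adj G) I (range (ρ ∘ ds)) (recolour r (portColours G p ρ)) (ρ x)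
  same G ρ = val-cong (sym G) I (λ _ → refl) colour (ρ x)
    where
    colour : ∀ i → portColours G (λ i → r i >>= p) ρ i ≗ recolour r (portColours G p ρ) i
    colour i y with r i
    ... | nothing = refl
    ... | just j = refl
D-val {m} {k = k} (ex {N = N} s I) ds p x t = D-⇔
  (λ G ρ h → trans (unbits-cong h) (unbits-bits {2 ^ k * suc s ^ N} t))
  (λ G ρ h c → trans (≡-sym (bits-unbits (body G ρ) c)) (cong (λ t → bits (2 ^ k * suc s ^ N) t c) h))
  (D-∀Fin {P = λ c G ρ → body G ρ c ≡ bits (2 ^ k * suc s ^ N) t c} λ c → D-bool {f = λ G ρ → body G ρ c}
    (D-⇔ (λ G ρ → dec-true (probe? (adj G) (range (ρ ∘ ds)) _ s (portColours G p ρ) (ρ x) _ _))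
         (λ G ρ → does-true (probe? (adj G) (range (ρ ∘ ds)) _ s (portColours G p ρ) (ρ x) _ _))
      (D-probe (proj₁ (remQuot {2 ^ k} (suc s ^ N) c)) (proj₂ (remQuot {2 ^ k} (suc s ^ N) c))))
    (bits (2 ^ k * suc s ^ N) t c))
  where
  F : ∀ {k′} (G : Graph k′) (ρ : Fin m → Fin (n G)) → Fin (n G) → Fin (n G) → Fin N
  F G ρ v = val (adj G) I (range (ρ ∘ ds) ⊕ v) (snoc (portColours G p ρ) (adj G v))
  body : ∀ {k′} (G : Graph k′) (ρ : Fin m → Fin (n G)) → Fin (2 ^ k * suc s ^ N) → Bool
  body G ρ = probes (adj G) (range (ρ ∘ ds)) (F G ρ) s (portColours G p ρ) (ρ x)
  InnerSet : ∀ {k′} (G : Graph k′) (t : Fin N) (σ : Fin (suc m) → Fin (n G)) → Fin (n G) → Set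
  InnerSet G t σ y = Conn (adj G) (range (σ ∘ suc ∘ ds)) (σ zero) y × F G (σ ∘ suc) (σ zero) y ≡ t
  D-inner : ∀ t u → Def {suc m} (λ G σ → cap s (inner (adj G) (range (σ ∘ suc ∘ ds)) (F G (σ ∘ suc)) (σ zero) t) ≡ u)
  D-inner t u = D-⇔
    (λ G σ → trans (cong (cap s) (≡-sym (#-cong-blocked (sym G) (range⁺ ds p G σ)))))
    (λ G σ → trans (cong (cap s) (#-cong-blocked (sym G) (range⁺ ds p G σ))))
    (D-cap (ds⁺ ds p) (λ G → InnerSet G t)
      -- Variable zero is the vertex being counted and `suc zero` the probed one. The counted vertex
      -- must lie in the component of the probed one before the latter is deleted, hence `ds` and
      -- not `ds⁺` in this conjunct.
      (D-× (D-conn (λ i → Fin.suc (Fin.suc (ds i))) (suc zero) zero)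
        (D-⇔ (λ G σ → trans (≡-sym (same G σ))) (λ G σ → trans (same G σ))
          (D-val I (suc ∘ ds⁺ ds p) (λ i → Maybe.map suc (p⁺ ds p i)) zero t)))
      (λ G σ y → conn? (adj G) (range (σ ∘ suc ∘ ds)) (σ zero) y ×-dec (F G (σ ∘ suc) (σ zero) y ≟ t)) s u)
    where
    same : ∀ {k} (G : Graph k) σ →
      val (adj G) I (range (σ ∘ suc ∘ ds⁺ ds p)) (portColours G (λ i → Maybe.map suc (p⁺ ds p i)) σ) (σ zero)
      ≡ F G (λ i → σ (suc (suc i))) (σ (suc zero)) (σ zero)
    same G σ = val-cong (sym G) I (range⁺ ds p G (σ ∘ suc))
      (λ i y → trans (shift i y) (colours⁺ ds p G (σ ∘ suc) i y)) (σ zero)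
      where
      shift : ∀ i → portColours G (λ i → Maybe.map suc (p⁺ ds p i)) σ i ≗ portColours G (p⁺ ds p) (σ ∘ suc) i
      shift i y with p⁺ ds p i
      ... | nothing = refl
      ... | just j = refl
  D-probe : ∀ r ĉ → Def {m} (λ G ρ → Probe (adj G) (range (ρ ∘ ds)) (F G ρ) s (portColours G p ρ) (ρ x) r ĉ)
  D-probe r ĉ = D-∃ (D-× (D-conn (λ i → Fin.suc (ds i)) (suc x) zero)
    (D-× (D-∀Fin λ i → D-⇔ (λ G σ → trans (≡-sym (shift G σ i))) (λ G σ → trans (shift G σ i))
            (D-colour (λ i → Maybe.map suc (p i)) i zero (bits k r i)))
         (D-∀Fin λ t → D-inner t (finToFun ĉ t))))
    where
    shift : ∀ {k} (G : Graph k) σ i →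
      portColours G (λ i → Maybe.map suc (p i)) σ i (σ zero) ≡ portColours G p (σ ∘ suc) i (σ zero)
    shift G σ i with p i
    ... | nothing = refl
    ... | just j = refl

-- Recognised languages and their definability

Table : ℕ → Set
Table k = Fin k → Fin k → Bool

table : ∀ {k} → Graph k → Table k
table G i j = adj G (port G i) (port G j)

portVal : ∀ {k N} → Inv k N → (G : Graph k) → Fin (n G) → Fin N
portVal I G = val (adj G) I (range (port G)) (λ i → adj G (port G i))

count : ∀ {k N} → Inv k N → (G : Graph k) → Fin N → ℕ
count I G t = # (adj G) (range (port G)) (λ x → portVal I G x ≟ t)

-- Membership of G is decided by the edges between its ports together with the numbers, up to the
-- threshold s, of components of G minus its ports on which I takes its different values.
record RecOn {k N : ℕ} (I : Inv k N) (s : ℕ) (L : Language k) : Set₁ where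
  field
    B     : Table k → (Fin N → ℕ) → Set
    B?    : ∀ E c → Dec (B E c)
    resp  : ∀ {E E′ c c′} → (∀ i j → E i j ≡ E′ i j) → (∀ t → c t ≈[ s ] c′ t) → B E c → B E′ c′
    sound : ∀ G → L G ⇔ B (table G) (count I G)

record Rec {k : ℕ} (L : Language k) : Set₁ where
  constructor rec
  field
    {N} : ℕ
    {I} : Inv k N
    {s} : ℕ
    on  : RecOn I s L
  open RecOn on public

decode : ∀ {k} → Fin ((2 ^ k) ^ k) → Table k
decode {k} e i = bits k (finToFun {2 ^ k} {k} e i)

encode : ∀ {k} → Table k → Fin ((2 ^ k) ^ k)
encode E = funToFin (λ i → unbits (E i))

decode-encode : ∀ {k} (E : Table k) i j → decode (encode E) i j ≡ E i j
decode-encode {k} E i j = trans (cong (λ r → bits k r j) (Fin.finToFun-funToFin (λ i → unbits (E i)) i)) (bits-unbits (E i) j)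

-- By `resp`, counts may be replaced by their capped values, which leaves finitely many pairs of a
-- port table and a count vector. The formula is the disjunction, over the pairs that `B` accepts,
-- of their descriptions.
Rec⇒Definable : ∀ {k L} → Rec L → Definable k L
Rec⇒Definable {k} {L} R = Def.formula D , λ G → mk⇔
  (λ p → Equivalence.to (Def.correct D G (port G)) (Equivalence.to (sound G) p))
  (λ p → Equivalence.from (sound G) (Equivalence.from (Def.correct D G (port G)) p))
  where
  open Rec R
  tableAt : ∀ {k′} (G : Graph k′) → (Fin k → Fin (n G)) → Table k
  tableAt G ρ i j = adj G (ρ i) (ρ j)
  valAt : ∀ {k′} (G : Graph k′) → (Fin k → Fin (n G)) → Fin (n G) → Fin N
  valAt G ρ = val (adj G) I (range ρ) (portColours G just ρ)
  countAt : ∀ {k′} (G : Graph k′) → (Fin k → Fin (n G)) → Fin N → ℕ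
  countAt G ρ t = # (adj G) (range ρ) (λ x → valAt G ρ x ≟ t)
  ĉ→ : Fin (suc s ^ N) → Fin N → ℕ
  ĉ→ ĉ t = toℕ (finToFun {suc s} {N} ĉ t)
  D : Def {k} (λ G ρ → B (tableAt G ρ) (countAt G ρ))
  D = D-⇔
    (λ G ρ (e , ĉ , b , h , h′) → resp h (λ t → subst (λ u → toℕ u ≈[ s ] countAt G ρ t) (h′ t) (cap-≈ s _)) b)
    (λ G ρ b → encode (tableAt G ρ) , funToFin (cap s ∘ countAt G ρ)
      , resp (λ i j → ≡-sym (decode-encode (tableAt G ρ) i j))
          (λ t → ≈-sym (subst (λ u → toℕ u ≈[ s ] countAt G ρ t) (≡-sym (Fin.finToFun-funToFin (cap s ∘ countAt G ρ) t)) (cap-≈ s _))) b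
      , decode-encode (tableAt G ρ)
      , λ t → ≡-sym (Fin.finToFun-funToFin (cap s ∘ countAt G ρ) t))
    (D-∃Fin λ e → D-∃Fin λ ĉ → D-× (D-dec (B? (decode e) (ĉ→ ĉ)))
      (D-× (D-∀Fin λ i → D-∀Fin λ j → D-⇔ (λ G ρ → ≡-sym) (λ G ρ → ≡-sym) (D-bool (D-edge i j) (decode e i j)))
           (D-∀Fin λ t → D-cap id (λ G ρ x → valAt G ρ x ≡ t)
              (D-⇔ (λ G σ e → e) (λ G σ e → e) (D-val I suc (just ∘ suc) zero t))
              (λ G ρ x → valAt G ρ x ≟ t) s (finToFun ĉ t))))

-- Closure of the recognised languages under the operations

Rec-dec : ∀ {k} {L : Language k} → Rec L → ∀ G → Dec (L G)
Rec-dec R G = map′ (Equivalence.from (sound G)) (Equivalence.to (sound G)) (B? _ _)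
  where open Rec R

#-loc-≤ : ∀ {m m′ k} {a : Fin m → Fin m → Bool} {D} {P : Fin k → Fin m → Bool}
  {a′ : Fin m′ → Fin m′ → Bool} {D′ P′ E A A′} {A? : Decidable A} {A′? : Decidable A′} → Loc a D P a′ D′ P′ E →
  (∀ {x x′} → E x x′ → A x → A′ x′) → (∀ x → Free D A x → ∃ λ x′ → E x x′) → # a D A? ≤ # a′ D′ A′?
#-loc-≤ {E = E} L f total = #-≤ (Loc.sym₂ L) E
  (λ { x (d , p) → let (x′ , e) = total x (d , p) in x′ , (trans (≡-sym (Loc.blocked L e)) d , f e p) , e })
  (λ _ _ e₁ e₂ c → Loc-conn⁻ L e₁ e₂ c)

#-loc : ∀ {m m′ k} {a : Fin m → Fin m → Bool} {D} {P : Fin k → Fin m → Bool}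
  {a′ : Fin m′ → Fin m′ → Bool} {D′ P′ E A A′} {A? : Decidable A} {A′? : Decidable A′} → Loc a D P a′ D′ P′ E →
  (∀ {x x′} → E x x′ → A x → A′ x′) → (∀ {x x′} → E x x′ → A′ x′ → A x) →
  (∀ x → Free D A x → ∃ λ x′ → E x x′) → (∀ x′ → Free D′ A′ x′ → ∃ λ x → E x x′) → # a D A? ≡ # a′ D′ A′?
#-loc L f g total total′ = ℕ.≤-antisym (#-loc-≤ L f total) (#-loc-≤ (Loc-swap L) g total′)

portLoc : ∀ {k} (G H : Graph k) → (Fin (n G) → Fin (n H) → Set) → Set
portLoc G H = Loc (adj G) (range (port G)) (λ i → adj G (port G i)) (adj H) (range (port H)) (λ i → adj H (port H i))

count-loc : ∀ {k N} (I : Inv k N) {G H : Graph k} {E} → portLoc G H E →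
  (∀ x → range (port G) x ≡ false → ∃ λ x′ → E x x′) → (∀ x′ → range (port H) x′ ≡ false → ∃ λ x → E x x′) →
  ∀ t → count I G t ≡ count I H t
count-loc I L total total′ t = #-loc L (λ e → trans (≡-sym (val-loc I L e))) (λ e → trans (val-loc I L e))
  (λ x p → total x (proj₁ p)) (λ x p → total′ x (proj₁ p))

module _ {k : ℕ} {G H : Graph k} (iso : Iso G H) where

  open Iso iso
  open Inverse bij using (to; from; strictlyInverseˡ; strictlyInverseʳ)

  to-injective : ∀ {u v} → to u ≡ to v → u ≡ v
  to-injective {u} {v} e = trans (≡-sym (strictlyInverseʳ u)) (trans (cong from e) (strictlyInverseʳ v))

  Iso-Loc : portLoc G H (λ u w → to u ≡ w)
  Iso-Loc = record
    { sym₁ = sym G ; sym₂ = sym H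
    ; blocked = λ { {y} refl → does-ext (Fin.any? λ i → port G i ≟ y) (Fin.any? λ i → port H i ≟ to y)
        (λ { (i , e) → i , trans (≡-sym (port-pres i)) (cong to e) })
        (λ { (i , e) → i , to-injective (trans (port-pres i) e) }) }
    ; colour = λ { {y} refl i → trans (≡-sym (adj-pres (port G i) y)) (cong (λ w → adj H w (to y)) (port-pres i)) }
    ; edges = λ { {y} {z = z} refl refl → ≡-sym (adj-pres y z) }
    ; fun = λ { refl refl → cong to } ; inj = λ { refl refl → to-injective }
    ; forth = λ _ _ _ _ → _ , refl ; back = λ {_} {_} {z′} _ _ _ _ → from z′ , strictlyInverseˡ z′ }

  -- Languages are predicates on presentations of graphs, so invariance under isomorphism must be
  -- proved; here it holds because tables and counts are preserved.
  Rec-iso : ∀ {L} → Rec L → L G → L H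
  Rec-iso R p = Equivalence.from (sound H) (resp
    (λ i j → trans (≡-sym (adj-pres (port G i) (port G j))) (cong₂ (adj H) (port-pres i) (port-pres j)))
    (λ t → inj₁ (count-loc (Rec.I R) {G} {H} Iso-Loc (λ x _ → to x , refl) (λ x _ → from x , strictlyInverseˡ x) t))
    (Equivalence.to (sound G) p))
    where open Rec R

Rec-⇔ : ∀ {k} {L L′ : Language k} → (∀ G → L G ⇔ L′ G) → Rec L → Rec L′
Rec-⇔ h (rec {I = I} R) = rec {I = I} record
  { B = B ; B? = B? ; resp = resp ; sound = λ G → mk⇔
      (Equivalence.to (sound G) ∘ Equivalence.from (h G)) (Equivalence.to (h G) ∘ Equivalence.from (sound G)) }
  where open RecOn R

RecOn-weaken : ∀ {k N s s′} {I : Inv k N} {L} → s ≤ s′ → RecOn I s L → RecOn I s′ L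
RecOn-weaken l R = record { B = B ; B? = B? ; resp = λ h h′ → resp h (λ t → ≈-weaken l (h′ t)) ; sound = sound }
  where open RecOn R

rowSum : ∀ M N → (Fin (M * N) → ℕ) → Fin M → ℕ
rowSum M N c t = ∑ {N} λ u → c (combine {M} {N} t u)

columnSum : ∀ M N → (Fin (M * N) → ℕ) → Fin N → ℕ
columnSum M N c u = ∑ {M} λ t → c (combine {M} {N} t u)

count-pairˡ : ∀ {k M N} (I : Inv k M) (J : Inv k N) G t → count I G t ≡ rowSum M N (count (pair I J) G) t
count-pairˡ {M = M} {N} I J G t = trans (#-∑ (sym G) (portVal J G) (val-conn (sym G) J))
  (∑-cong {N} λ u → #-cong (sym G)
    (λ x (_ , e , e′) → cong₂ (combine {M} {N}) e e′)
    (λ x (_ , e) → Fin.combine-injectiveˡ {M} {N} _ _ t u e , Fin.combine-injectiveʳ {M} {N} _ _ t u e))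

count-pairʳ : ∀ {k M N} (I : Inv k M) (J : Inv k N) G u → count J G u ≡ columnSum M N (count (pair I J) G) u
count-pairʳ {M = M} {N} I J G u = trans (#-∑ (sym G) (portVal I G) (val-conn (sym G) I))
  (∑-cong {M} λ t → #-cong (sym G)
    (λ x (_ , e , e′) → cong₂ (combine {M} {N}) e′ e)
    (λ x (_ , e) → Fin.combine-injectiveʳ {M} {N} _ _ t u e , Fin.combine-injectiveˡ {M} {N} _ _ t u e))

-- Passage to a finer invariant: if its counts determine the old ones by a map `K` respecting the
-- threshold, `B` is precomposed with `K`.
RecOn-marginal : ∀ {k M N s} {I : Inv k M} {J : Inv k N} {L} (K : (Fin N → ℕ) → Fin M → ℕ) →
  (∀ {c c′} → (∀ t → c t ≈[ s ] c′ t) → ∀ t → K c t ≈[ s ] K c′ t) →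
  (∀ G t → count I G t ≡ K (count J G) t) → RecOn I s L → RecOn J s L
RecOn-marginal K K-resp h R = record
  { B = λ E c → B E (K c) ; B? = λ E c → B? E (K c)
  ; resp = λ e e′ → resp e (K-resp e′)
  ; sound = λ G → mk⇔ (λ p → resp (λ _ _ → refl) (λ t → inj₁ (h G t)) (Equivalence.to (sound G) p))
      (λ b → Equivalence.from (sound G) (resp (λ _ _ → refl) (λ t → inj₁ (≡-sym (h G t))) b)) }
  where open RecOn R

record Common {k : ℕ} (L₁ L₂ : Language k) : Set₁ where
  field
    {N} : ℕ
    {I} : Inv k N
    {s} : ℕ
    on₁ : RecOn I s L₁
    on₂ : RecOn I s L₂

-- Binary operations need both languages described by the same counts. Those of `I` and `J` are the
-- row and column sums for the pair, and sums preserve `≈[ s ]` without loss, so the larger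
-- threshold suffices.
common : ∀ {k} {L₁ L₂ : Language k} → Rec L₁ → Rec L₂ → Common L₁ L₂
common (rec {M} {I} {s} R) (rec {N} {J} {s′} R′) = record
  { I = pair I J ; s = s ⊔ s′
  ; on₁ = RecOn-marginal (rowSum M N) (λ h t → ≈-∑ {N = N} λ u → h (combine t u)) (count-pairˡ I J)
      (RecOn-weaken (ℕ.m≤m⊔n s s′) R)
  ; on₂ = RecOn-marginal (columnSum M N) (λ h u → ≈-∑ {N = M} λ t → h (combine t u)) (count-pairʳ I J)
      (RecOn-weaken (ℕ.m≤n⊔m s s′) R′) }

Rec-∪ : ∀ {k} {L₁ L₂ : Language k} → Rec L₁ → Rec L₂ → Rec (λ G → L₁ G ⊎ L₂ G)
Rec-∪ R₁ R₂ = rec {I = I} {s} record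
  { B = λ E c → R.B E c ⊎ R′.B E c ; B? = λ E c → R.B? E c ⊎-dec R′.B? E c
  ; resp = λ h h′ → [ inj₁ ∘ R.resp h h′ , inj₂ ∘ R′.resp h h′ ]′
  ; sound = λ G → mk⇔ [ inj₁ ∘ Equivalence.to (R.sound G) , inj₂ ∘ Equivalence.to (R′.sound G) ]′
      [ inj₁ ∘ Equivalence.from (R.sound G) , inj₂ ∘ Equivalence.from (R′.sound G) ]′ }
  where
  open Common (common R₁ R₂)
  module R = RecOn on₁
  module R′ = RecOn on₂

Rec-∩ : ∀ {k} {L₁ L₂ : Language k} → Rec L₁ → Rec L₂ → Rec (λ G → L₁ G × L₂ G)
Rec-∩ R₁ R₂ = rec {I = I} {s} record
  { B = λ E c → R.B E c × R′.B E c ; B? = λ E c → R.B? E c ×-dec R′.B? E c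
  ; resp = λ h h′ (p , q) → R.resp h h′ p , R′.resp h h′ q
  ; sound = λ G → mk⇔ (λ (p , q) → Equivalence.to (R.sound G) p , Equivalence.to (R′.sound G) q)
      (λ (p , q) → Equivalence.from (R.sound G) p , Equivalence.from (R′.sound G) q) }
  where
  open Common (common R₁ R₂)
  module R = RecOn on₁
  module R′ = RecOn on₂

Rec-∁ : ∀ {k} {L : Language k} → Rec L → Rec (λ G → ¬ L G)
Rec-∁ (rec {I = I} {s} R) = rec {I = I} {s} record
  { B = λ E c → ¬ B E c ; B? = λ E c → ¬? (B? E c)
  ; resp = λ h h′ ¬b b → ¬b (resp (λ i j → ≡-sym (h i j)) (λ t → ≈-sym (h′ t)) b)
  ; sound = λ G → mk⇔ (λ ¬p b → ¬p (Equivalence.from (sound G) b)) (λ ¬b p → ¬b (Equivalence.to (sound G) p)) }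
  where open RecOn R

-- Forgetting a port

addPort : ∀ {k} (G : Graph k) v → range (port G) v ≡ false → Graph (suc k)
addPort {k} G v h = record
  { n = n G ; nonempty = nonempty G ; adj = adj G ; sym = sym G ; irrefl = irrefl G
  ; port = snoc (port G) v ; port-inj = λ {i} {j} → port-inj′ i j }
  where
  p = snoc (port G) v
  port-inj′ : ∀ i j → p i ≡ p j → i ≡ j
  port-inj′ = snoc-elim (λ i → ∀ j → p i ≡ p j → i ≡ j)
    (λ i → snoc-elim (λ j → p (inject₁ i) ≡ p j → inject₁ i ≡ j)
      (λ j e → cong inject₁ (port-inj G (trans (≡-sym (snoc-inject₁ (port G) v i)) (trans e (snoc-inject₁ (port G) v j)))))
      (λ e → contradiction (trans (≡-sym (snoc-inject₁ (port G) v i)) (trans e (snoc-fromℕ (port G) v))) (range-false⁻ (port G) h i)))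
    (snoc-elim (λ j → p (fromℕ k) ≡ p j → fromℕ k ≡ j)
      (λ j e → contradiction (trans (≡-sym (snoc-inject₁ (port G) v j)) (trans (≡-sym e) (snoc-fromℕ (port G) v))) (range-false⁻ (port G) h j))
      (λ _ → refl))


-- A form of `forgetL` without isomorphic copies: the forgotten port is a vertex of `G` itself. The
-- two agree on recognised languages, which are invariant under isomorphism.
ForgetAny : ∀ {k} → Language (suc k) → Language k
ForgetAny L G = ∃ λ v → ∃ λ h → L (addPort G v h)

forget-Iso : ∀ {k} {H : Graph (suc k)} {G : Graph k} → Iso (forget H) G → ∃ λ v → ∃ λ h → Iso H (addPort G v h)
forget-Iso {k} {H} {G} iso = to (port H (fromℕ k)) , fresh , record
  { bij = bij ; adj-pres = adj-pres
  ; port-pres = snoc-elim _ (λ i → trans (port-pres i) (≡-sym (snoc-inject₁ (port G) _ i))) (≡-sym (snoc-fromℕ (port G) _)) }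
  where
  open Iso iso
  open Inverse bij using (to)
  fresh = range-false (port G) λ i e → Fin.fromℕ≢inject₁ (≡-sym (port-inj H (to-injective iso (trans (port-pres i) e))))

forget-addPort : ∀ {k} (G : Graph k) v h → Iso (forget (addPort G v h)) G
forget-addPort G v h = record
  { bij = mk↔ₛ′ id id (λ _ → refl) (λ _ → refl) ; adj-pres = λ _ _ → refl ; port-pres = snoc-inject₁ (port G) v }

forgetL⇔ForgetAny : ∀ {k} {L : Language (suc k)} → Rec L → ∀ G → ForgetAny L G ⇔ forgetL L G
forgetL⇔ForgetAny R G = mk⇔ (λ (v , h , p) → addPort G v h , p , forget-addPort G v h)
  (λ (H , p , iso) → let (v , h , iso′) = forget-Iso iso in v , h , Rec-iso iso′ R p)

blank : ∀ {k} → Fin (suc k) → Maybe (Fin k)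
blank = snoc just nothing

recolour-blank : ∀ {m k} (P : Fin k → Fin m → Bool) i → recolour blank P i ≗ snoc P (λ _ → false) i
recolour-blank P i x = snoc-elim (λ i → recolour blank P i x ≡ snoc P (λ _ → false) i x)
  (λ i → trans (cong (maybe (λ j → P j x) false) (snoc-inject₁ just nothing i))
    (cong (λ f → f x) (≡-sym (snoc-inject₁ P (λ _ → false) i))))
  (trans (cong (maybe (λ j → P j x) false) (snoc-fromℕ just nothing))
    (cong (λ f → f x) (≡-sym (snoc-fromℕ P (λ _ → false))))) i

extendTable : ∀ {k} → Table k → (Fin k → Bool) → Table (suc k)
extendTable E r = snoc (λ i → snoc (E i) (r i)) (snoc r false)

module _ {k : ℕ} (E : Table k) (r : Fin k → Bool) where

  private
    rows : Fin k → Fin (suc k) → Bool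
    rows i = snoc (E i) (r i)

  extend-oo : ∀ i j → extendTable E r (inject₁ i) (inject₁ j) ≡ E i j
  extend-oo i j = trans (cong (λ f → f (inject₁ j)) (snoc-inject₁ rows (snoc r false) i)) (snoc-inject₁ (E i) (r i) j)

  extend-on : ∀ i → extendTable E r (inject₁ i) (fromℕ k) ≡ r i
  extend-on i = trans (cong (λ f → f (fromℕ k)) (snoc-inject₁ rows (snoc r false) i)) (snoc-fromℕ (E i) (r i))

  extend-no : ∀ j → extendTable E r (fromℕ k) (inject₁ j) ≡ r j
  extend-no j = trans (cong (λ f → f (inject₁ j)) (snoc-fromℕ rows (snoc r false))) (snoc-inject₁ r false j)

  extend-nn : extendTable E r (fromℕ k) (fromℕ k) ≡ false
  extend-nn = trans (cong (λ f → f (fromℕ k)) (snoc-fromℕ rows (snoc r false))) (snoc-fromℕ r false)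

  extend-unique : (T : Table (suc k)) → (∀ i j → T (inject₁ i) (inject₁ j) ≡ E i j) →
    (∀ i → T (inject₁ i) (fromℕ k) ≡ r i) → (∀ j → T (fromℕ k) (inject₁ j) ≡ r j) → T (fromℕ k) (fromℕ k) ≡ false →
    ∀ i j → T i j ≡ extendTable E r i j
  extend-unique T oo on no′ nn = snoc-elim (λ i → ∀ j → T i j ≡ extendTable E r i j)
    (λ i → snoc-elim (λ j → T (inject₁ i) j ≡ extendTable E r (inject₁ i) j)
      (λ j → trans (oo i j) (≡-sym (extend-oo i j))) (trans (on i) (≡-sym (extend-on i))))
    (snoc-elim (λ j → T (fromℕ k) j ≡ extendTable E r (fromℕ k) j)
      (λ j → trans (no′ j) (≡-sym (extend-no j))) (trans nn (≡-sym extend-nn)))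

extendTable-cong : ∀ {k} {E E′ : Table k} {r r′} → (∀ i j → E i j ≡ E′ i j) → r ≗ r′ →
  ∀ i j → extendTable E r i j ≡ extendTable E′ r′ i j
extendTable-cong {E = E} {E′} {r} {r′} h h′ = extend-unique E′ r′ (extendTable E r)
  (λ i j → trans (extend-oo E r i j) (h i j)) (λ i → trans (extend-on E r i) (h′ i))
  (λ j → trans (extend-no E r j) (h′ j)) (extend-nn E r)

table-addPort : ∀ {k} (G : Graph k) v h i j →
  table (addPort G v h) i j ≡ extendTable (table G) (λ i → adj G (port G i) v) i j
table-addPort {k} G v h = extend-unique (table G) (λ i → adj G (port G i) v) (table (addPort G v h))
  (λ i j → cong₂ (adj G) (old i) (old j)) (λ i → cong₂ (adj G) (old i) new)
  (λ j → trans (cong₂ (adj G) new (old j)) (sym G v (port G j))) (trans (cong₂ (adj G) new new) (irrefl G v))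
  where
  old = snoc-inject₁ (port G) v
  new = snoc-fromℕ (port G) v

module _ {k N : ℕ} (I : Inv (suc k) N) (s : ℕ) where

  exValues : ℕ
  exValues = 2 ^ (2 ^ k * suc s ^ N)

  -- For a new port v, ex describes the component containing v, while ren blank describes the others,
  -- which see no edge to v.
  around : Inv k (N * exValues)
  around = pair (ren blank I) (ex s I)

  module _ (G : Graph k) (v : Fin (n G)) (h : range (port G) v ≡ false) where

    private
      a = adj G
      D = range (port G)
      P : Fin k → Fin (n G) → Bool
      P i = adj G (port G i)
      ⟨_,_⟩ = combine {N} {exValues}

    innerCount : Fin N → ℕ
    innerCount = inner a D (λ v → val a I (D ⊕ v) (snoc P (a v))) v

    private
      v-free : Conn a D v v
      v-free = stop h
      far? : Decidable (λ y → ¬ Conn a D v y)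
      far? y = ¬? (conn? a D v y)
      near : ∀ {x y} → Conn a D x y → Conn a D v x → Conn a D v y
      near c c′ = Conn-trans c′ c
      far : ∀ {x y} → Conn a D x y → ¬ Conn a D v x → ¬ Conn a D v y
      far c ¬c c′ = ¬c (Conn-trans c′ (Conn-sym (sym G) c))

      -- Outside the component of `v`, deleting `v` changes nothing and the colour "adjacent to `v`"
      -- is constantly false, so the identity matches it with the blank colour.
      farLoc : Loc a (D ⊕ v) (snoc P (a v)) a D (recolour blank P) (λ y y′ → y ≡ y′ × D y ≡ false × ¬ Conn a D v y)
      farLoc = record
        { sym₁ = sym G ; sym₂ = sym G
        ; blocked = λ { (refl , d , ¬c) → trans (⊕-false D d (λ { refl → ¬c v-free })) (≡-sym d) }
        ; colour = λ { {y} (refl , d , ¬c) i → trans (colour y d ¬c i) (≡-sym (recolour-blank P i y)) }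
        ; edges = λ { (refl , _) (refl , _) → refl }
        ; fun = λ { (refl , _) (refl , _) e → e } ; inj = λ { (refl , _) (refl , _) e → e }
        ; forth = λ { {y} (refl , d , ¬c) _ e d′ → _ , refl , proj₁ (⊕-false⁻ D d′)
            , far (go d e (stop (proj₁ (⊕-false⁻ D d′)))) ¬c }
        ; back = λ { {y} (refl , d , ¬c) _ e d′ → _ , refl , d′ , far (go d e (stop d′)) ¬c } }
        where
        colour : ∀ y → D y ≡ false → ¬ Conn a D v y → ∀ i → snoc P (a v) i y ≡ snoc P (λ _ → false) i y
        colour y d ¬c = snoc-elim (λ i → snoc P (a v) i y ≡ snoc P (λ _ → false) i y)
          (λ i → cong (λ f → f y) (trans (snoc-inject₁ P (a v) i) (≡-sym (snoc-inject₁ P (λ _ → false) i))))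
          (trans (cong (λ f → f y) (snoc-fromℕ P (a v)))
            (trans (Bool.¬-not (λ e → ¬c (go h e (stop d)))) (≡-sym (cong (λ f → f y) (snoc-fromℕ P (λ _ → false))))))

    count-around : ∀ j → count around G j ≡
      δ (portVal around G v) j + # a D (λ x → (portVal around G x ≟ j) ×-dec far? x)
    count-around j = trans (#-split (sym G) _ (conn? a D v) near) (cong (_+ # a D (λ x → (portVal around G x ≟ j) ×-dec far? x)) here-one)
      where
      here-one : # a D (λ x → (portVal around G x ≟ j) ×-dec conn? a D v x) ≡ δ (portVal around G v) j
      here-one with portVal around G v ≟ j
      ... | yes e = #-one (sym G) v (h , e , v-free) (λ { x (_ , _ , c) → c })
      ... | no ¬e = #-none (sym G) (λ { x (_ , e , c) → ¬e (trans (val-conn (sym G) around c) e) })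

    -- The pieces of the component of `v` give `innerCount`. The other components persist, and their
    -- value under `I` is the first coordinate of `around`; summing over the second counts them,
    -- while `δ` takes off the component of `v`, which has been broken up.
    count-addPort : ∀ t → count I (addPort G v h) t ≡ innerCount t +
      ∑ {exValues} λ u → count around G ⟨ t , u ⟩ ∸ δ (portVal around G v) ⟨ t , u ⟩
    count-addPort t = trans (#-cong-blocked (sym G) D⁺) (trans (#-cong (sym G) {A? = old?} {new?}
        (λ x (_ , e) → trans (≡-sym (same x)) e) (λ x (_ , e) → trans (same x) e))
      (trans (#-split (sym G) new? (conn? a D v) (λ c → near (Conn-⊕⁻ v c)))
        (cong₂ _+_ (#-cong (sym G) (λ x (_ , e , c) → c , e) (λ x (_ , c , e) → e , c))
          (trans away (∑-cong {exValues} each)))))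
      where
      old? = λ x → portVal I (addPort G v h) x ≟ t
      new? = λ x → val a I (D ⊕ v) (snoc P (a v)) x ≟ t
      D⁺ : range (snoc (port G) v) ≗ (D ⊕ v)
      D⁺ = range-snoc (port G) (snoc (port G) v) v (snoc-inject₁ (port G) v) (snoc-fromℕ (port G) v)
      same : portVal I (addPort G v h) ≗ val a I (D ⊕ v) (snoc P (a v))
      same = val-cong (sym G) I D⁺ (snoc-elim _
        (λ i x → trans (cong (λ w → a w x) (snoc-inject₁ (port G) v i)) (cong (λ f → f x) (≡-sym (snoc-inject₁ P (a v) i))))
        (λ x → trans (cong (λ w → a w x) (snoc-fromℕ (port G) v)) (cong (λ f → f x) (≡-sym (snoc-fromℕ P (a v))))))
      blank? = λ x → (portVal (ren blank I) G x ≟ t) ×-dec far? x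
      away : # a (D ⊕ v) (λ x → new? x ×-dec far? x) ≡
        ∑ {exValues} λ u → # a D (λ x → blank? x ×-dec (portVal (ex s I) G x ≟ u))
      away = trans (#-loc {A′? = blank?} farLoc
          (λ { e@(refl , _) (p , q) → trans (≡-sym (val-loc I farLoc e)) p , q })
          (λ { e@(refl , _) (p , q) → trans (val-loc I farLoc e) p , q })
          (λ x (d , _ , f) → x , refl , proj₁ (⊕-false⁻ D d) , f) (λ x (d , _ , f) → x , refl , d , f))
        (#-∑ (sym G) (portVal (ex s I) G) (val-conn (sym G) (ex s I)))
      each : ∀ u → # a D (λ x → blank? x ×-dec (portVal (ex s I) G x ≟ u)) ≡
        count around G ⟨ t , u ⟩ ∸ δ (portVal around G v) ⟨ t , u ⟩
      each u = trans (#-cong (sym G)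
          (λ x (_ , (e , f) , e′) → cong₂ ⟨_,_⟩ e e′ , f)
          (λ x (_ , e , f) → (Fin.combine-injectiveˡ {N} {exValues} _ _ t u e , f) , Fin.combine-injectiveʳ {N} {exValues} _ _ t u e))
        (≡-sym (trans (cong (_∸ δ (portVal around G v) ⟨ t , u ⟩) (count-around ⟨ t , u ⟩))
          (ℕ.m+n∸m≡n (δ (portVal around G v) ⟨ t , u ⟩) _)))

≈-positive : ∀ {s a b} → a ≈[ suc s ] b → 1 ≤ a → 1 ≤ b
≈-positive (inj₁ refl) l = l
≈-positive (inj₂ (_ , s≤s _)) l = s≤s z≤n

-- `B′` guesses the value `⟨ t , u ⟩` of the component holding the forgotten port and a probe `r`,
-- `ĉ` recorded in `u`. Any component of that value will do, since the recorded bit supplies a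
-- vertex in it with this row and these inner counts. The extra unit of threshold pays for removing
-- that component and for checking that one exists.
Rec-ForgetAny : ∀ {k} {L : Language (suc k)} → Rec L → Rec (ForgetAny L)
Rec-ForgetAny {k} {L} (rec {N} {I} {s} R) = rec {I = around I s} {suc s} record
  { B = B′ ; B? = λ E c → Fin.any? λ t → Fin.any? λ u → Fin.any? λ r → Fin.any? λ ĉ →
      (1 ℕ.≤? c ⟨ t , u ⟩) ×-dec (bits (2 ^ k * suc s ^ N) u (combine r ĉ) Bool.≟ true) ×-dec B? _ _
  ; resp = λ h h′ (t , u , r , ĉ , l , e , b) → t , u , r , ĉ , ≈-positive (h′ ⟨ t , u ⟩) l , e
      , resp (extendTable-cong h (λ _ → refl))
          (λ t′ → ≈-+ (≈-refl {s} {toℕ (finToFun {suc s} {N} ĉ t′)})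
            (≈-∑ {s} {M} λ u′ → ≈-∸δ ⟨ t , u ⟩ ⟨ t′ , u′ ⟩ (h′ ⟨ t′ , u′ ⟩))) b
  ; sound = λ G → mk⇔ (to G) (from G) }
  where
  open RecOn R
  M = exValues I s
  ⟨_,_⟩ = combine {N} {M}
  cs : Fin (suc s ^ N) → (Fin (N * M) → ℕ) → Fin (N * M) → Fin N → ℕ
  cs ĉ c j t = toℕ (finToFun {suc s} {N} ĉ t) + ∑ {M} λ u → c ⟨ t , u ⟩ ∸ δ j ⟨ t , u ⟩
  B′ : Table k → (Fin (N * M) → ℕ) → Set
  B′ E c = ∃ λ t → ∃ λ u → ∃ λ r → ∃ λ ĉ → 1 ≤ c ⟨ t , u ⟩ ×
    bits (2 ^ k * suc s ^ N) u (combine r ĉ) ≡ true × B (extendTable E (bits k r)) (cs ĉ c ⟨ t , u ⟩)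
  module _ (G : Graph k) where
    a = adj G
    D = range (port G)
    P : Fin k → Fin (n G) → Bool
    P i = adj G (port G i)
    F : Fin (n G) → Fin (n G) → Fin N
    F v = val a I (D ⊕ v) (snoc P (a v))
    same-count : ∀ v h ĉ j → portVal (around I s) G v ≡ j → (∀ t → cap s (inner a D F v t) ≡ finToFun {suc s} {N} ĉ t) →
      ∀ t → count I (addPort G v h) t ≈[ s ] cs ĉ (count (around I s) G) j t
    same-count v h ĉ _ refl e t = ≈-trans (inj₁ (count-addPort I s G v h t))
      (≈-+ {c = rest} {rest} (subst (λ z → inner a D F v t ≈[ s ] toℕ z) (e t) (≈-sym (cap-≈ s _))) ≈-refl)
      where
      rest = ∑ {M} λ u → count (around I s) G ⟨ t , u ⟩ ∸ δ (portVal (around I s) G v) ⟨ t , u ⟩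
    to : ForgetAny L G → B′ (table G) (count (around I s) G)
    to (v , h , p) = portVal (ren blank I) G v , portVal (ex s I) G v , unbits row , funToFin caps
      , #≥⁻ (sym G) (v ∷ []) refl ((h , refl) ∷ []) ([] ∷ [])
      , Equivalence.from (val-ex I (unbits row) (funToFin caps))
          (v , stop h , (λ i → ≡-sym (bits-unbits row i)) , λ t → ≡-sym (Fin.finToFun-funToFin caps t))
      , resp (λ i j → trans (table-addPort G v h i j)
          (extendTable-cong {E = table G} (λ _ _ → refl) (λ i → ≡-sym (bits-unbits row i)) i j))
          (same-count v h (funToFin caps) _ refl (λ t → ≡-sym (Fin.finToFun-funToFin caps t)))
          (Equivalence.to (sound _) p)
      where
      row = λ i → P i v
      caps = λ t → cap s (inner a D F v t)
    at-probe : ∀ {t u r ĉ x} → portVal (around I s) G x ≡ ⟨ t , u ⟩ →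
      Probe a D F s P x r ĉ → B (extendTable (table G) (bits k r)) (cs ĉ (count (around I s) G) ⟨ t , u ⟩) → ForgetAny L G
    at-probe {ĉ = ĉ} q (v , c , row , caps) b = v , Conn-end c
      , Equivalence.from (sound _) (resp
          (λ i j → ≡-sym (trans (table-addPort G v (Conn-end c) i j) (extendTable-cong {E = table G} (λ _ _ → refl) row i j)))
          (λ t → ≈-sym (same-count v (Conn-end c) ĉ _ (trans (≡-sym (val-conn (sym G) (around I s) c)) q) caps t)) b)
    some : ∀ j → 1 ≤ count (around I s) G j → ∃ λ x → portVal (around I s) G x ≡ j
    some j l with #≥ l
    ... | x ∷ [] , refl , (d , q) ∷ [] , _ = x , q
    from : B′ (table G) (count (around I s) G) → ForgetAny L G
    from (t , u , r , ĉ , l , e , b) = let (x , q) = some ⟨ t , u ⟩ l in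
      at-probe q (Equivalence.to (val-ex I r ĉ)
        (trans (cong (λ z → bits (2 ^ k * suc s ^ N) z (combine r ĉ)) (Fin.combine-injectiveʳ {N} {M} _ _ t u q)) e)) b

Rec-forget : ∀ {k} {L : Language (suc k)} → Rec L → Rec (forgetL L)
Rec-forget R = Rec-⇔ (forgetL⇔ForgetAny R) (Rec-ForgetAny R)

-- Induced subgraphs and cutting a graph at its ports

record Enumeration {m : ℕ} (X : Fin m → Bool) : Set where
  field
    {size} : ℕ
    elem   : Fin size → Fin m
    elem-injective : ∀ {i j} → elem i ≡ elem j → i ≡ j
    elem-X : ∀ i → X (elem i) ≡ true
    index-of : ∀ {v} → X v ≡ true → ∃ λ i → elem i ≡ v

enumerate : ∀ {m} (X : Fin m → Bool) → Enumeration X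
enumerate {zero} X = record { size = 0 ; elem = λ () ; elem-injective = λ {i} → case i of λ () ; elem-X = λ () ; index-of = λ {v} → case v of λ () }
enumerate {suc m} X with enumerate (X ∘ suc) | false-or-true (X zero)
... | T | inj₁ h = record
  { elem = λ i → suc (elem i)
  ; elem-injective = λ e → elem-injective (Fin.suc-injective e)
  ; elem-X = elem-X
  ; index-of = λ { {zero} e → ⊥-elim (true≢false e h) ; {suc v} e → let (i , e′) = index-of e in i , cong suc e′ } }
  where open Enumeration T
... | T | inj₂ h = record
  { elem = λ { zero → zero ; (suc i) → suc (elem i) }
  ; elem-injective = λ { {zero} {zero} _ → refl ; {suc i} {suc j} e → cong suc (elem-injective (Fin.suc-injective e)) }
  ; elem-X = λ { zero → h ; (suc i) → elem-X i }
  ; index-of = λ { {zero} _ → zero , refl ; {suc v} e → let (i , e′) = index-of e in suc i , cong suc e′ } }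
  where open Enumeration T

module _ {k m : ℕ} (b : Fin m → Fin m → Bool) (b-sym : ∀ u v → b u v ≡ b v u) (b-irrefl : ∀ u → b u u ≡ false)
         (X : Fin m → Bool) (q : Fin k → Fin m) (q-inj : ∀ {i j} → q i ≡ q j → i ≡ j) (q-X : ∀ i → X (q i) ≡ true) where

  open Enumeration (enumerate X)

  induced : ∃ (λ v → X v ≡ true) → Graph k
  induced (v , h) = record
    { n = size ; nonempty = occupied (proj₁ (index-of h))
    ; adj = λ i j → b (elem i) (elem j) ; sym = λ i j → b-sym (elem i) (elem j) ; irrefl = λ i → b-irrefl (elem i)
    ; port = λ i → proj₁ (index-of (q-X i))
    ; port-inj = λ {i} {j} e → q-inj (trans (≡-sym (proj₂ (index-of (q-X i)))) (trans (cong elem e) (proj₂ (index-of (q-X j))))) }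
    where
    occupied : ∀ {l} → Fin l → 0 < l
    occupied zero = s≤s z≤n
    occupied (suc _) = s≤s z≤n

record PortEdges (k : ℕ) : Set where
  field
    E        : Table k
    E-sym    : ∀ i j → E i j ≡ E j i
    E-irrefl : ∀ i → E i i ≡ false

module _ {k : ℕ} (G : Graph k) (S : Fin (n G) → Bool) (T : PortEdges k) where

  open PortEdges T

  private
    D = range (port G)

  -- A fusion may divide the edges between ports arbitrarily between its factors, so these are
  -- prescribed by `E`; an edge with an end outside the ports is inherited from `G`.
  data PartEdge (u v : Fin (n G)) : Set where
    inside : D u ≡ false ⊎ D v ≡ false → adj G u v ≡ true → PartEdge u v
    ports  : ∀ i j → port G i ≡ u → port G j ≡ v → E i j ≡ true → PartEdge u v

  partEdge? : ∀ u v → Dec (PartEdge u v)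
  partEdge? u v = map′
    [ uncurry inside , (λ (i , j , p , q , e) → ports i j p q e) ]′
    (λ { (inside d e) → inj₁ (d , e) ; (ports i j p q e) → inj₂ (i , j , p , q , e) })
    ((((D u Bool.≟ false) ⊎-dec (D v Bool.≟ false)) ×-dec (adj G u v Bool.≟ true))
      ⊎-dec Fin.any? λ i → Fin.any? λ j → (port G i ≟ u) ×-dec (port G j ≟ v) ×-dec (E i j Bool.≟ true))

  partEdge-sym : ∀ {u v} → PartEdge u v → PartEdge v u
  partEdge-sym (inside d e) = inside (swap d) (trans (sym G _ _) e)
  partEdge-sym (ports i j p q e) = ports j i q p (trans (E-sym j i) e)

  keep : Fin (n G) → Bool
  keep v = D v ∨ S v

  partAdj : Fin (n G) → Fin (n G) → Bool
  partAdj u v = does (partEdge? u v)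

  part : ∃ (λ v → keep v ≡ true) → Graph k
  part = induced partAdj
    (λ u v → does-ext (partEdge? u v) (partEdge? v u) partEdge-sym partEdge-sym)
    (λ u → dec-false (partEdge? u u) λ
      { (inside _ e) → true≢false e (irrefl G u)
      ; (ports i j p q e) → true≢false e (subst (λ j → E i j ≡ false) (port-inj G (trans p (≡-sym q))) (E-irrefl i)) })
    keep (port G) (port-inj G) (λ i → cong (_∨ S (port G i)) (range-true (port G) i))

  module _ (w : ∃ (λ v → keep v ≡ true)) where

    open Enumeration (enumerate keep)

    part-embed : Fin (n (part w)) → Fin (n G)
    part-embed = elem

    part-injective : ∀ {u v} → part-embed u ≡ part-embed v → u ≡ v
    part-injective = elem-injective

    part-keep : ∀ u → keep (part-embed u) ≡ true
    part-keep = elem-X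

    part-port : ∀ i → part-embed (port (part w) i) ≡ port G i
    part-port i = proj₂ (index-of _)

    part-surjective : ∀ {v} → keep v ≡ true → ∃ λ u → part-embed u ≡ v
    part-surjective = index-of

    part-edge : ∀ {u v} → adj (part w) u v ≡ true → PartEdge (part-embed u) (part-embed v)
    part-edge {u} {v} = does-true (partEdge? (part-embed u) (part-embed v))

    part-edge⁻ : ∀ {u v} → PartEdge (part-embed u) (part-embed v) → adj (part w) u v ≡ true
    part-edge⁻ {u} {v} = dec-true (partEdge? (part-embed u) (part-embed v))

    part-table : ∀ i j → table (part w) i j ≡ E i j
    part-table i j = bool-ext
      (λ e → unports (subst₂ PartEdge (part-port i) (part-port j) (part-edge e)))
      (λ e → part-edge⁻ (ports i j (≡-sym (part-port i)) (≡-sym (part-port j)) e))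
      where
      unports : PartEdge (port G i) (port G j) → E i j ≡ true
      unports (inside (inj₁ d) _) = ⊥-elim (true≢false (range-true (port G) i) d)
      unports (inside (inj₂ d) _) = ⊥-elim (true≢false (range-true (port G) j) d)
      unports (ports i′ j′ p q e) = subst₂ (λ i j → E i j ≡ true) (port-inj G p) (port-inj G q) e

module _ {k : ℕ} (G : Graph k) (S : Fin (n G) → Bool)
  (closed : ∀ {u v} → range (port G) u ≡ false → range (port G) v ≡ false → adj G u v ≡ true → S u ≡ S v)
  (T₁ T₂ : PortEdges k)
  (E₁∨E₂ : ∀ i j → table G i j ≡ PortEdges.E T₁ i j ∨ PortEdges.E T₂ i j)
  (w₁ : ∃ λ v → keep G S T₁ v ≡ true)
  (w₂ : ∃ λ v → keep G (not ∘ S) T₂ v ≡ true) where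

  open PortEdges T₁ using () renaming (E to E₁)
  open PortEdges T₂ using () renaming (E to E₂)

  private
    D = range (port G)
    G₁ = part G S T₁ w₁
    G₂ = part G (not ∘ S) T₂ w₂
    f₁ = part-embed G S T₁ w₁
    f₂ = part-embed G (not ∘ S) T₂ w₂
    onto₁ = λ {v} → part-surjective G S T₁ w₁ {v}
    onto₂ = λ {v} → part-surjective G (not ∘ S) T₂ w₂ {v}
    port₁ = part-port G S T₁ w₁
    port₂ = part-port G (not ∘ S) T₂ w₂

    keep₁ : ∀ {v} → S v ≡ true ⊎ D v ≡ true → D v ∨ S v ≡ true
    keep₁ {v} (inj₁ h) = trans (cong (D v ∨_) h) (Bool.∨-zeroʳ (D v))
    keep₁ {v} (inj₂ h) = cong (_∨ S v) h

    keep₂ : ∀ {v} → S v ≡ false ⊎ D v ≡ true → D v ∨ not (S v) ≡ true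
    keep₂ {v} (inj₁ h) = trans (cong (λ b → D v ∨ not b) h) (Bool.∨-zeroʳ (D v))
    keep₂ {v} (inj₂ h) = cong (_∨ not (S v)) h

    both : ∀ {v} → D v ∨ S v ≡ true → D v ∨ not (S v) ≡ true → D v ≡ true
    both {v} p q with D v | S v
    ... | true | _ = refl
    both {v} () q | false | false
    both {v} p () | false | true

    classify : ∀ {u v} → adj G u v ≡ true →
      (D u ≡ true × D v ≡ true) ⊎
      ((D u ≡ false ⊎ D v ≡ false) × ((S u ≡ true ⊎ D u ≡ true) × (S v ≡ true ⊎ D v ≡ true) ⊎
        (S u ≡ false ⊎ D u ≡ true) × (S v ≡ false ⊎ D v ≡ true)))
    classify {u} {v} e with false-or-true (D u) | false-or-true (D v)
    ... | inj₂ p | inj₂ q = inj₁ (p , q)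
    ... | inj₂ p | inj₁ q with false-or-true (S v)
    ...   | inj₁ r = inj₂ (inj₂ q , inj₂ (inj₂ p , inj₁ r))
    ...   | inj₂ r = inj₂ (inj₂ q , inj₁ (inj₂ p , inj₁ r))
    classify {u} {v} e | inj₁ p | inj₂ q with false-or-true (S u)
    ... | inj₁ r = inj₂ (inj₁ p , inj₂ (inj₁ r , inj₂ q))
    ... | inj₂ r = inj₂ (inj₁ p , inj₁ (inj₁ r , inj₂ q))
    classify {u} {v} e | inj₁ p | inj₁ q with false-or-true (S u)
    ... | inj₁ r = inj₂ (inj₁ p , inj₂ (inj₁ r , inj₁ (trans (≡-sym (closed p q e)) r)))
    ... | inj₂ r = inj₂ (inj₁ p , inj₁ (inj₁ r , inj₁ (trans (≡-sym (closed p q e)) r)))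

    Edges : Fin (n G) → Fin (n G) → Set
    Edges a b = (∃[ u ] ∃[ v ] (f₁ u ≡ a × f₁ v ≡ b × adj G₁ u v ≡ true)) ⊎
                (∃[ u ] ∃[ v ] (f₂ u ≡ a × f₂ v ≡ b × adj G₂ u v ≡ true))

    split-edge : ∀ {a b} → adj G a b ≡ true → Edges a b
    split-edge e with classify e
    ... | inj₂ (d , inj₁ (p , q)) with onto₁ (keep₁ p) | onto₁ (keep₁ q)
    ...   | u , refl | v , refl = inj₁ (u , v , refl , refl , part-edge⁻ G S T₁ w₁ (inside d e))
    split-edge e | inj₂ (d , inj₂ (p , q)) with onto₂ (keep₂ p) | onto₂ (keep₂ q)
    ...   | u , refl | v , refl = inj₂ (u , v , refl , refl , part-edge⁻ G (not ∘ S) T₂ w₂ (inside d e))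
    split-edge e | inj₁ (p , q) with range-true⁻ (port G) p | range-true⁻ (port G) q
    ... | i , refl | j , refl with false-or-true (E₁ i j)
    ...   | inj₂ h = inj₁ (port G₁ i , port G₁ j , port₁ i , port₁ j , trans (part-table G S T₁ w₁ i j) h)
    ...   | inj₁ h = inj₂ (port G₂ i , port G₂ j , port₂ i , port₂ j
            , trans (part-table G (not ∘ S) T₂ w₂ i j) (trans (≡-sym (cong (_∨ E₂ i j) h)) (trans (≡-sym (E₁∨E₂ i j)) e)))

    join-edge : ∀ {a b} → Edges a b → adj G a b ≡ true
    join-edge (inj₁ (u , v , refl , refl , e)) with part-edge G S T₁ w₁ e
    ... | inside _ e′ = e′
    ... | ports i j p q e′ = subst₂ (λ a b → adj G a b ≡ true) p q (trans (E₁∨E₂ i j) (cong (_∨ E₂ i j) e′))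
    join-edge (inj₂ (u , v , refl , refl , e)) with part-edge G (not ∘ S) T₂ w₂ e
    ... | inside _ e′ = e′
    ... | ports i j p q e′ = subst₂ (λ a b → adj G a b ≡ true) p q
            (trans (E₁∨E₂ i j) (trans (cong (E₁ i j ∨_) e′) (Bool.∨-zeroʳ (E₁ i j))))

  -- An edge with a non-port end belongs to the side of that end, and `closed` rules out a conflict
  -- when both ends are non-ports. Edges between ports are shared out by `E₁∨E₂`.
  part-fusion : IsFusion G₁ G₂ G
  part-fusion = record
    { e₁ = f₁ ; e₂ = f₂
    ; e₁-inj = part-injective G S T₁ w₁ ; e₂-inj = part-injective G (not ∘ S) T₂ w₂
    ; port₁ = port₁ ; port₂ = port₂
    ; shared = shared
    ; cover = cover′
    ; edges = λ a b → mk⇔ split-edge join-edge }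
    where
    shared : ∀ u v → f₁ u ≡ f₂ v → ∃[ i ] (u ≡ port G₁ i × v ≡ port G₂ i)
    shared u v e with range-true⁻ (port G) (both (part-keep G S T₁ w₁ u)
      (subst (λ z → D z ∨ not (S z) ≡ true) (≡-sym e) (part-keep G (not ∘ S) T₂ w₂ v)))
    ... | i , h = i , part-injective G S T₁ w₁ (trans (≡-sym h) (≡-sym (port₁ i)))
        , part-injective G (not ∘ S) T₂ w₂ (trans (≡-sym e) (trans (≡-sym h) (≡-sym (port₂ i))))
    cover′ : ∀ w → (∃[ u ] f₁ u ≡ w) ⊎ (∃[ v ] f₂ v ≡ w)
    cover′ w with false-or-true (S w)
    ... | inj₂ h = inj₁ (onto₁ (keep₁ (inj₁ h)))
    ... | inj₁ h = inj₂ (onto₂ (keep₂ (inj₁ h)))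

-- Fusion

IsFusion-swap : ∀ {k} {G₁ G₂ G : Graph k} → IsFusion G₁ G₂ G → IsFusion G₂ G₁ G
IsFusion-swap F = record
  { e₁ = e₂ ; e₂ = e₁ ; e₁-inj = e₂-inj ; e₂-inj = e₁-inj ; port₁ = port₂ ; port₂ = port₁
  ; shared = λ u v e → let (i , p , q) = shared v u (≡-sym e) in i , q , p
  ; cover = swap ∘ IsFusion.cover F
  ; edges = λ a b → mk⇔ (swap ∘ Equivalence.to (edges a b)) (Equivalence.from (edges a b) ∘ swap) }
  where open IsFusion F

module _ {k : ℕ} {G₁ G₂ G : Graph k} (F : IsFusion G₁ G₂ G) where

  open IsFusion F

  e₁-free : ∀ {u} → range (port G₁) u ≡ false → range (port G) (e₁ u) ≡ false
  e₁-free d = range-false (port G) λ i p → range-false⁻ (port G₁) d i (e₁-inj (trans (port₁ i) p))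

  e₁-free⁻ : ∀ {u} → range (port G) (e₁ u) ≡ false → range (port G₁) u ≡ false
  e₁-free⁻ d = range-false (port G₁) λ i p → range-false⁻ (port G) d i (trans (≡-sym (port₁ i)) (cong e₁ p))

  not-shared : ∀ {u v} → range (port G₁) u ≡ false → e₁ u ≢ e₂ v
  not-shared {u} {v} d e = let (i , p , _) = shared u v e in range-false⁻ (port G₁) d i (≡-sym p)

  e₁-adj : ∀ {u} z → range (port G₁) u ≡ false → adj G₁ z u ≡ adj G (e₁ z) (e₁ u)
  e₁-adj {u} z d = bool-ext (λ h → Equivalence.from (edges _ _) (inj₁ (z , u , refl , refl , h)))
    (λ h → [ (λ { (x , y , p , q , h′) → subst₂ (λ x y → adj G₁ x y ≡ true) (e₁-inj p) (e₁-inj q) h′ })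
           , (λ { (x , y , p , q , h′) → ⊥-elim (not-shared d (≡-sym q)) }) ]′ (Equivalence.to (edges _ _) h))

  -- Only ports are shared, so a non-port of a factor acquires no further edges in the fusion, and
  -- its component is unchanged.
  fusionLoc : portLoc G₁ G (λ u w → e₁ u ≡ w × range (port G₁) u ≡ false)
  fusionLoc = record
    { sym₁ = sym G₁ ; sym₂ = sym G
    ; blocked = λ { (refl , d) → trans d (≡-sym (e₁-free d)) }
    ; colour = λ { {y} (refl , d) i → trans (e₁-adj (port G₁ i) d) (cong (λ w → adj G w (e₁ y)) (port₁ i)) }
    ; edges = λ { {y} (refl , _) (refl , d) → e₁-adj y d }
    ; fun = λ { (refl , _) (refl , _) → cong e₁ } ; inj = λ { (refl , _) (refl , _) → e₁-inj }
    ; forth = λ _ _ _ d → _ , refl , d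
    ; back = λ { {y} {_} {z} (refl , d) _ h d′ → back d d′ (Equivalence.to (IsFusion.edges F (e₁ y) z) h) } }
    where
    back : ∀ {y z} → range (port G₁) y ≡ false → range (port G) z ≡ false → _ →
      ∃ λ x → e₁ x ≡ z × range (port G₁) x ≡ false
    back d d′ (inj₁ (u , v , p , refl , h)) = v , refl , e₁-free⁻ d′
    back d d′ (inj₂ (u , v , p , q , h)) = ⊥-elim (not-shared d (≡-sym p))

  left? : ∀ x → Dec (∃ λ u → e₁ u ≡ x)
  left? x = Fin.any? λ u → e₁ u ≟ x

  left-inv : ∀ {x y} → Conn (adj G) (range (port G)) x y → (∃ λ u → e₁ u ≡ x) → ∃ λ u → e₁ u ≡ y
  left-inv c (u , refl) = let (v , (p , _) , _) = Loc-conn (Loc-swap fusionLoc) (refl , e₁-free⁻ (Conn-start c)) c in v , p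

  count-left : ∀ {N} (I : Inv k N) t →
    count I G₁ t ≡ # (adj G) (range (port G)) (λ x → (portVal I G x ≟ t) ×-dec left? x)
  count-left I t = #-loc fusionLoc
    (λ { e@(refl , _) p → trans (≡-sym (val-loc I fusionLoc e)) p , _ , refl })
    (λ { e@(refl , _) (p , _) → trans (val-loc I fusionLoc e) p })
    (λ x (d , _) → e₁ x , refl , d)
    (λ { x (d , _ , u , refl) → u , refl , e₁-free⁻ d })

  table-fusion : ∀ i j → table G i j ≡ table G₁ i j ∨ table G₂ i j
  table-fusion i j = bool-ext
    (λ h → [ (λ { (x , y , p , q , h′) → cong (_∨ table G₂ i j) (subst₂ (λ x y → adj G₁ x y ≡ true)
                  (e₁-inj (trans p (≡-sym (port₁ i)))) (e₁-inj (trans q (≡-sym (port₁ j)))) h′) })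
           , (λ { (x , y , p , q , h′) → trans (cong (table G₁ i j ∨_) (subst₂ (λ x y → adj G₂ x y ≡ true)
                  (e₂-inj (trans p (≡-sym (port₂ i)))) (e₂-inj (trans q (≡-sym (port₂ j)))) h′)) (Bool.∨-zeroʳ _) }) ]′
           (Equivalence.to (edges _ _) h))
    (λ h → Equivalence.from (edges _ _) (from h))
    where
    from : table G₁ i j ∨ table G₂ i j ≡ true → _
    from h with false-or-true (table G₁ i j)
    ... | inj₂ h₁ = inj₁ (port G₁ i , port G₁ j , port₁ i , port₁ j , h₁)
    ... | inj₁ h₁ = inj₂ (port G₂ i , port G₂ j , port₂ i , port₂ j , trans (cong (_∨ table G₂ i j) (≡-sym h₁)) h)

-- With the ports deleted, no edge joins the two factors, so every component comes from exactly one
-- of them.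
count-fusion : ∀ {k N} (I : Inv k N) {G₁ G₂ G : Graph k} → IsFusion G₁ G₂ G → ∀ t →
  count I G t ≡ count I G₁ t + count I G₂ t
count-fusion I {G₁} {G₂} {G} F t = trans (#-split (sym G) (λ x → portVal I G x ≟ t) (left? F) (left-inv F))
  (cong₂ _+_ (≡-sym (count-left F I t)) (trans (#-cong (sym G)
      (λ x (d , p , ¬l) → p , [ (λ l → contradiction l ¬l) , id ]′ (IsFusion.cover F x))
      (λ { x (d , p , v , refl) → p , λ { (u , e) → not-shared (IsFusion-swap F) (e₁-free⁻ (IsFusion-swap F) d) (≡-sym e) } }))
    (≡-sym (count-left (IsFusion-swap F) I t))))

Split : ℕ → ℕ → ℕ → ℕ → Set
Split s c x y = ∃ λ a → ∃ λ b → a + b ≡ c × a ≈[ s ] x × b ≈[ s ] y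

≈? : ∀ s a b → Dec (a ≈[ s ] b)
≈? s a b = (a ℕ.≟ b) ⊎-dec ((s ℕ.≤? a) ×-dec (s ℕ.≤? b))

split? : ∀ s c x y → Dec (Split s c x y)
split? s c x y = map′
  (λ (i , p , q) → toℕ i , c ∸ toℕ i , ℕ.m+[n∸m]≡n (s≤s⁻¹ (Fin.toℕ<n i)) , p , q)
  (λ { (a , b , refl , p , q) → fromℕ< (s≤s (ℕ.m≤m+n a b))
     , subst (λ z → z ≈[ s ] x) (≡-sym (Fin.toℕ-fromℕ< _)) p
     , subst (λ z → z ≈[ s ] y) (≡-sym (trans (cong (a + b ∸_) (Fin.toℕ-fromℕ< (s≤s (ℕ.m≤m+n a b)))) (ℕ.m+n∸m≡n a b))) q })
  (Fin.any? {suc c} λ i → ≈? s (toℕ i) x ×-dec ≈? s (c ∸ toℕ i) y)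

-- Origin of the doubled threshold: of two parts of a number that is at least `s + s`, one is at
-- least `s`. If the other is at most `s` it is kept and the large one absorbs the difference; if
-- both are large, `s` and the remainder work.
Split-resp : ∀ {s c c′ x y} → c ≈[ s + s ] c′ → Split s c x y → Split s c′ x y
Split-resp (inj₁ refl) h = h
Split-resp {s} {c} {c′} (inj₂ (l , l′)) (a , b , refl , p , q) with ℕ.≤-total s a | ℕ.≤-total s b
... | inj₁ sa | inj₁ sb = s , c′ ∸ s , ℕ.m+[n∸m]≡n (ℕ.m+n≤o⇒m≤o s l′)
    , ≈-trans (inj₂ (ℕ.≤-refl , sa)) p , ≈-trans (inj₂ (ℕ.m+n≤o⇒m≤o∸n s l′ , sb)) q
... | inj₂ as | _ = a , c′ ∸ a , ℕ.m+[n∸m]≡n (ℕ.≤-trans as (ℕ.m+n≤o⇒m≤o s l′)) , p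
    , ≈-trans (inj₂ (ℕ.≤-trans (ℕ.m+n≤o⇒m≤o∸n s l′) (ℕ.∸-monoʳ-≤ c′ as)
        , ℕ.+-cancelˡ-≤ a s b (ℕ.≤-trans (ℕ.+-monoˡ-≤ s as) l))) q
... | inj₁ sa | inj₂ bs = c′ ∸ b , b , ℕ.m∸n+n≡m (ℕ.≤-trans bs (ℕ.m+n≤o⇒m≤o s l′))
    , ≈-trans (inj₂ (ℕ.≤-trans (ℕ.m+n≤o⇒m≤o∸n s l′) (ℕ.∸-monoʳ-≤ c′ bs) , sa)) p , q

-- A factor has to be a nonempty graph: it has a port, or else some component must be assigned to
-- it.
Inhabited : ∀ k {N} → (Fin N → ℕ) → Set
Inhabited k c = 0 < k ⊎ ∃ λ t → 1 ≤ c t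

inhabited? : ∀ k {N} (c : Fin N → ℕ) → Dec (Inhabited k c)
inhabited? k c = (0 ℕ.<? k) ⊎-dec Fin.any? λ t → 1 ℕ.≤? c t

Inhabited-resp : ∀ {k s N} {c c′ : Fin N → ℕ} → (∀ t → c t ≈[ suc s ] c′ t) → Inhabited k c → Inhabited k c′
Inhabited-resp h (inj₁ l) = inj₁ l
Inhabited-resp h (inj₂ (t , l)) = inj₂ (t , ≈-positive (h t) l)

count-inhabited : ∀ {k N} (I : Inv k N) G → Inhabited k (count I G)
count-inhabited {suc k} I G = inj₁ (s≤s z≤n)
count-inhabited {zero} I G = inj₂ (portVal I G x₀
  , #≥⁻ (sym G) (x₀ ∷ []) refl ((range-false (port G) {x₀} (λ ()) , refl) ∷ []) ([] ∷ []))
  where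
  x₀ : Fin (n G)
  x₀ = fromℕ< (nonempty G)

Proper : ∀ {k} → Table k → Set
Proper E = (∀ i j → E i j ≡ E j i) × (∀ i → E i i ≡ false)

Proper-resp : ∀ {k} {E E′ : Table k} → (∀ i j → E i j ≡ E′ i j) → Proper E → Proper E′
Proper-resp h (p , q) = (λ i j → trans (≡-sym (h i j)) (trans (p i j) (h j i))) , λ i → trans (≡-sym (h i i)) (q i)

table-proper : ∀ {k} (G : Graph k) → Proper (table G)
table-proper G = (λ i j → sym G (port G i) (port G j)) , λ i → irrefl G (port G i)

proper? : ∀ {k} (E : Table k) → Dec (Proper E)
proper? E = Fin.all? (λ i → Fin.all? λ j → E i j Bool.≟ E j i) ×-dec Fin.all? (λ i → E i i Bool.≟ false)

module _ {k N s : ℕ} {I : Inv k N} {L₁ L₂ : Language k} (R₁ : RecOn I (suc s) L₁) (R₂ : RecOn I (suc s) L₂) where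

  private
    module R₁ = RecOn R₁
    module R₂ = RecOn R₂
    σ = suc s

  -- A certificate that a fusion exists. The counts `c₁` and `c₂` matter only up to `σ`; exact
  -- numbers with the right sum come from `split`. As `σ` is positive, `Inhabited` is unaffected by
  -- capping.
  record Pieces (E : Table k) (c : Fin N → ℕ) (E₁ E₂ : Table k) (c₁ c₂ : Fin N → ℕ) : Set where
    constructor pieces
    field
      proper₁ : Proper E₁
      proper₂ : Proper E₂
      joint   : ∀ i j → E i j ≡ E₁ i j ∨ E₂ i j
      B₁      : R₁.B E₁ c₁
      B₂      : R₂.B E₂ c₂
      some₁   : Inhabited k c₁
      some₂   : Inhabited k c₂
      split   : ∀ t → Split σ (c t) (c₁ t) (c₂ t)

  pieces? : ∀ E c E₁ E₂ c₁ c₂ → Dec (Pieces E c E₁ E₂ c₁ c₂)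
  pieces? E c E₁ E₂ c₁ c₂ = map′
    (λ (a , b , d , e , f , g , h , i) → pieces a b d e f g h i)
    (λ (pieces a b d e f g h i) → a , b , d , e , f , g , h , i)
    (proper? E₁ ×-dec proper? E₂ ×-dec Fin.all? (λ i → Fin.all? λ j → E i j Bool.≟ (E₁ i j ∨ E₂ i j))
      ×-dec R₁.B? E₁ c₁ ×-dec R₂.B? E₂ c₂ ×-dec inhabited? k c₁ ×-dec inhabited? k c₂
      ×-dec Fin.all? λ t → split? σ (c t) (c₁ t) (c₂ t))

  Pieces-resp : ∀ {E E′ c c′ E₁ E₂ c₁ c₂} → (∀ i j → E i j ≡ E′ i j) → (∀ t → c t ≈[ σ + σ ] c′ t) →
    Pieces E c E₁ E₂ c₁ c₂ → Pieces E′ c′ E₁ E₂ c₁ c₂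
  Pieces-resp h h′ (pieces a b d e f g i j) =
    pieces a b (λ i j → trans (≡-sym (h i j)) (d i j)) e f g i (λ t → Split-resp (h′ t) (j t))

  Pieces-resp′ : ∀ {E c E₁ E₁′ E₂ E₂′ c₁ c₁′ c₂ c₂′} →
    (∀ i j → E₁ i j ≡ E₁′ i j) → (∀ i j → E₂ i j ≡ E₂′ i j) →
    (∀ t → c₁ t ≈[ σ ] c₁′ t) → (∀ t → c₂ t ≈[ σ ] c₂′ t) →
    Pieces E c E₁ E₂ c₁ c₂ → Pieces E c E₁′ E₂′ c₁′ c₂′
  Pieces-resp′ h₁ h₂ g₁ g₂ P = record
    { proper₁ = Proper-resp h₁ proper₁ ; proper₂ = Proper-resp h₂ proper₂
    ; joint = λ i j → trans (joint i j) (cong₂ _∨_ (h₁ i j) (h₂ i j))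
    ; B₁ = R₁.resp h₁ g₁ B₁ ; B₂ = R₂.resp h₂ g₂ B₂
    ; some₁ = Inhabited-resp g₁ some₁ ; some₂ = Inhabited-resp g₂ some₂
    ; split = λ t → let (a , b , e , p , q) = split t in a , b , e , ≈-trans p (g₁ t) , ≈-trans q (g₂ t) }
    where open Pieces P

  module _ {G : Graph k} where

    fuse⇒pieces : ∀ {G₁ G₂} → L₁ G₁ → L₂ G₂ → IsFusion G₁ G₂ G →
      Pieces (table G) (count I G) (table G₁) (table G₂) (count I G₁) (count I G₂)
    fuse⇒pieces {G₁} {G₂} p q F = record
      { proper₁ = table-proper G₁ ; proper₂ = table-proper G₂ ; joint = table-fusion F
      ; B₁ = Equivalence.to (R₁.sound G₁) p ; B₂ = Equivalence.to (R₂.sound G₂) q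
      ; some₁ = count-inhabited I G₁ ; some₂ = count-inhabited I G₂
      ; split = λ t → _ , _ , ≡-sym (count-fusion I F t) , ≈-refl , ≈-refl }

    module _ {E₁ E₂ c₁ c₂} (P : Pieces (table G) (count I G) E₁ E₂ c₁ c₂) where

      open Pieces P

      private
        D = range (port G)
        x₁ x₂ : Fin N → ℕ
        x₁ t = proj₁ (split t)
        x₂ t = proj₁ (proj₂ (split t))
        x₁+x₂ : ∀ t → x₁ t + x₂ t ≡ count I G t
        x₁+x₂ t = proj₁ (proj₂ (proj₂ (split t)))
        x₁≈ : ∀ t → x₁ t ≈[ σ ] c₁ t
        x₁≈ t = proj₁ (proj₂ (proj₂ (proj₂ (split t))))
        x₂≈ : ∀ t → x₂ t ≈[ σ ] c₂ t
        x₂≈ t = proj₂ (proj₂ (proj₂ (proj₂ (split t))))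
        x₁≤ : ∀ t → x₁ t ≤ count I G t
        x₁≤ t = ℕ.≤-trans (ℕ.m≤m+n (x₁ t) (x₂ t)) (ℕ.≤-reflexive (x₁+x₂ t))

        S : Fin (n G) → Bool
        S = select (sym G) (portVal I G) (val-conn (sym G) I) x₁ x₁≤
        S-inv : ∀ {x y} → Conn (adj G) D x y → S x ≡ S y
        S-inv = select-inv (sym G) (portVal I G) (val-conn (sym G) I) x₁ x₁≤
        A? : ∀ t → Decidable (λ x → portVal I G x ≡ t)
        A? t x = portVal I G x ≟ t
        #-S : ∀ t → # (adj G) D (λ x → A? t x ×-dec (S x Bool.≟ true)) ≡ x₁ t
        #-S = #-select (sym G) (portVal I G) (val-conn (sym G) I) x₁ x₁≤
        #-¬S : ∀ t → # (adj G) D (λ x → A? t x ×-dec ¬? (S x Bool.≟ true)) ≡ x₂ t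
        #-¬S t = ℕ.+-cancelˡ-≡ (x₁ t) _ _ (trans (cong (_+ # (adj G) D (λ x → A? t x ×-dec ¬? (S x Bool.≟ true))) (≡-sym (#-S t)))
          (trans (≡-sym (#-split (sym G) (A? t) (λ x → S x Bool.≟ true) (λ c → trans (≡-sym (S-inv c))))) (≡-sym (x₁+x₂ t))))

        T₁ T₂ : PortEdges k
        T₁ = record { E = E₁ ; E-sym = proj₁ proper₁ ; E-irrefl = proj₂ proper₁ }
        T₂ = record { E = E₂ ; E-sym = proj₁ proper₂ ; E-irrefl = proj₂ proper₂ }

        witness : ∀ {A} {A? : Decidable A} → 1 ≤ # (adj G) D A? → ∃ A
        witness l with #≥ l
        ... | x ∷ [] , refl , (_ , p) ∷ [] , _ = x , p

        first-port : 0 < k → ∃ λ v → D v ≡ true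
        first-port (s≤s _) = port G zero , range-true (port G) zero

        w₁ : ∃ λ v → keep G S T₁ v ≡ true
        w₁ with Inhabited-resp (λ t → ≈-sym (x₁≈ t)) some₁
        ... | inj₁ l = let (v , d) = first-port l in v , cong (_∨ S v) d
        ... | inj₂ (t , l) = let (v , _ , e) = witness (ℕ.≤-trans l (ℕ.≤-reflexive (≡-sym (#-S t)))) in
          v , trans (cong (D v ∨_) e) (Bool.∨-zeroʳ (D v))

        w₂ : ∃ λ v → keep G (not ∘ S) T₂ v ≡ true
        w₂ with Inhabited-resp (λ t → ≈-sym (x₂≈ t)) some₂
        ... | inj₁ l = let (v , d) = first-port l in v , cong (_∨ not (S v)) d
        ... | inj₂ (t , l) = let (v , _ , e) = witness (ℕ.≤-trans l (ℕ.≤-reflexive (≡-sym (#-¬S t)))) in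
          v , trans (cong (λ b → D v ∨ not b) (Bool.¬-not e)) (Bool.∨-zeroʳ (D v))

        G₁ = part G S T₁ w₁
        G₂ = part G (not ∘ S) T₂ w₂

        F : IsFusion G₁ G₂ G
        F = part-fusion G S (λ d d′ e → S-inv (go d e (stop d′))) T₁ T₂ joint w₁ w₂

        count₁ : ∀ t → count I G₁ t ≡ x₁ t
        count₁ t = trans (count-left F I t) (trans (#-cong (sym G)
          (λ { x (d , e , u , refl) → e , trans (cong (_∨ S x) (≡-sym d)) (part-keep G S T₁ w₁ u) })
          (λ x (d , e , h) → e , part-surjective G S T₁ w₁ (trans (cong (D x ∨_) h) (Bool.∨-zeroʳ (D x))))) (#-S t))

        count₂ : ∀ t → count I G₂ t ≡ x₂ t
        count₂ t = ℕ.+-cancelˡ-≡ (x₁ t) _ _ (trans (cong (_+ count I G₂ t) (≡-sym (count₁ t)))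
          (trans (≡-sym (count-fusion I F t)) (≡-sym (x₁+x₂ t))))

      -- For each value `t`, `S` marks exactly `x₁ t` components, so `x₂ t` remain. Cutting `G`
      -- along `S`, with the port edges given by the certificate, produces factors whose counts
      -- agree with `c₁` and `c₂` up to `σ`.
      pieces⇒fuse : fuseL L₁ L₂ G
      pieces⇒fuse = G₁ , G₂
        , Equivalence.from (R₁.sound G₁) (R₁.resp (λ i j → ≡-sym (part-table G S T₁ w₁ i j))
            (λ t → ≈-trans (≈-sym (x₁≈ t)) (inj₁ (≡-sym (count₁ t)))) B₁)
        , Equivalence.from (R₂.sound G₂) (R₂.resp (λ i j → ≡-sym (part-table G (not ∘ S) T₂ w₂ i j))
            (λ t → ≈-trans (≈-sym (x₂≈ t)) (inj₁ (≡-sym (count₂ t)))) B₂)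
        , F

  -- Tables and counts capped at `σ` range over finite sets, so a certificate can be searched for;
  -- `Pieces-resp′` shows that capping loses none.
  RecOn-fusion : RecOn I (σ + σ) (fuseL L₁ L₂)
  RecOn-fusion = record
    { B = λ E c → ∃ λ e₁ → ∃ λ e₂ → ∃ λ ĉ₁ → ∃ λ ĉ₂ → Pieces E c (decode e₁) (decode e₂) (small ĉ₁) (small ĉ₂)
    ; B? = λ E c → Fin.any? λ e₁ → Fin.any? λ e₂ → Fin.any? λ ĉ₁ → Fin.any? λ ĉ₂ →
        pieces? E c (decode e₁) (decode e₂) (small ĉ₁) (small ĉ₂)
    ; resp = λ h h′ (e₁ , e₂ , ĉ₁ , ĉ₂ , P) → e₁ , e₂ , ĉ₁ , ĉ₂ , Pieces-resp h h′ P
    ; sound = λ G → mk⇔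
        (λ (G₁ , G₂ , p , q , F) → encode (table G₁) , encode (table G₂) , shrink (count I G₁) , shrink (count I G₂)
          , Pieces-resp′ (λ i j → ≡-sym (decode-encode (table G₁) i j)) (λ i j → ≡-sym (decode-encode (table G₂) i j))
              (small-shrink (count I G₁)) (small-shrink (count I G₂)) (fuse⇒pieces p q F))
        (λ (e₁ , e₂ , ĉ₁ , ĉ₂ , P) → pieces⇒fuse P) }
    where
    small : Fin (suc σ ^ N) → Fin N → ℕ
    small ĉ t = toℕ (finToFun {suc σ} {N} ĉ t)
    shrink : (Fin N → ℕ) → Fin (suc σ ^ N)
    shrink c = funToFin (λ t → cap σ (c t))
    small-shrink : ∀ c t → c t ≈[ σ ] small (shrink c) t
    small-shrink c t = ≈-sym (subst (λ z → toℕ z ≈[ σ ] c t) (≡-sym (Fin.finToFun-funToFin (λ t → cap σ (c t)) t)) (cap-≈ σ (c t)))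

Rec-fusion : ∀ {k} {L₁ L₂ : Language k} → Rec L₁ → Rec L₂ → Rec (fuseL L₁ L₂)
Rec-fusion R₁ R₂ = rec (RecOn-fusion (RecOn-weaken (ℕ.n≤1+n s) on₁) (RecOn-weaken (ℕ.n≤1+n s) on₂))
  where open Common (common R₁ R₂)

-- Port edges and permutations of ports

Rec-edge : ∀ {k} (i j : Fin k) → Rec (λ G → table G i j ≡ true)
Rec-edge i j = rec {I = triv} {0} record
  { B = λ E _ → E i j ≡ true ; B? = λ E _ → E i j Bool.≟ true
  ; resp = λ h _ → trans (≡-sym (h i j)) ; sound = λ G → mk⇔ id id }

count-ren : ∀ {k k′ N} (I : Inv k N) (r : Fin k → Maybe (Fin k′)) {G : Graph k} {H : Graph k′} {E} →
  Loc (adj G) (range (port G)) (λ i → adj G (port G i)) (adj H) (range (port H)) (recolour r (λ i → adj H (port H i))) E →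
  (∀ x → range (port G) x ≡ false → ∃ λ x′ → E x x′) → (∀ x′ → range (port H) x′ ≡ false → ∃ λ x → E x x′) →
  ∀ t → count I G t ≡ count (ren r I) H t
count-ren I r L total total′ t = #-loc L (λ e → trans (≡-sym (val-loc I L e))) (λ e → trans (val-loc I L e))
  (λ x p → total x (proj₁ p)) (λ x p → total′ x (proj₁ p))

module _ {k : ℕ} (π : Permutation k k) where

  permLoc : ∀ (G : Graph k) → let H = permute (flip π) G in
    Loc (adj H) (range (port H)) (λ i → adj H (port H i)) (adj G) (range (port G))
      (recolour (λ i → just (π ⟨$⟩ˡ i)) (λ i → adj G (port G i))) _≡_
  permLoc G = record
    { sym₁ = sym G ; sym₂ = sym G
    ; blocked = λ { {y} refl → does-ext (Fin.any? λ i → port G (π ⟨$⟩ˡ i) ≟ y) (Fin.any? λ i → port G i ≟ y)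
        (λ (i , e) → π ⟨$⟩ˡ i , e) (λ (i , e) → π ⟨$⟩ʳ i , trans (cong (port G) (inverseˡ π)) e) }
    ; colour = λ { refl i → refl } ; edges = λ { refl refl → refl }
    ; fun = λ { refl refl e → e } ; inj = λ { refl refl e → e }
    ; forth = λ _ _ _ _ → _ , refl ; back = λ _ _ _ _ → _ , refl }

  Rec-permute : ∀ {L} → Rec L → Rec (λ G → L (permute (flip π) G))
  Rec-permute {L} (rec {I = I} {s} R) = rec {I = ren (λ i → just (π ⟨$⟩ˡ i)) I} {s} record
    { B = λ E c → B (λ i j → E (π ⟨$⟩ˡ i) (π ⟨$⟩ˡ j)) c ; B? = λ E c → B? _ c
    ; resp = λ h h′ → resp (λ i j → h _ _) h′
    ; sound = λ G → mk⇔
        (λ p → resp (λ _ _ → refl) (λ t → inj₁ (same G t)) (Equivalence.to (sound (permute (flip π) G)) p))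
        (λ b → Equivalence.from (sound (permute (flip π) G)) (resp (λ _ _ → refl) (λ t → inj₁ (≡-sym (same G t))) b)) }
    where
    open RecOn R
    same : ∀ G t → count I (permute (flip π) G) t ≡ count (ren (λ i → just (π ⟨$⟩ˡ i)) I) G t
    same G = count-ren I (λ i → just (π ⟨$⟩ˡ i)) {permute (flip π) G} {G} (permLoc G) (λ x _ → x , refl) (λ x _ → x , refl)

  -- Instead of some isomorphic copy, the preimage is taken on the vertices of `G` itself, with the
  -- ports reordered by the inverse permutation.
  Rec-perm : ∀ {L} → Rec L → Rec (permuteL π L)
  Rec-perm {L} R = Rec-⇔ (λ G → mk⇔
      (λ p → permute (flip π) G , p , record
        { bij = mk↔ₛ′ id id (λ _ → refl) (λ _ → refl) ; adj-pres = λ _ _ → refl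
        ; port-pres = λ i → cong (port G) (inverseˡ π) })
      (λ (H , p , iso) → Rec-iso (record
        { bij = Iso.bij iso ; adj-pres = Iso.adj-pres iso
        ; port-pres = λ i → trans (cong (Inverse.to (Iso.bij iso) ∘ port H) (≡-sym (inverseʳ π))) (Iso.port-pres iso (π ⟨$⟩ˡ i)) }) R p))
    (Rec-permute R)

-- Adding an isolated port

module _ {k : ℕ} where

  private
    last : Fin (suc k)
    last = fromℕ k

    old : Fin (suc k) → Set
    old i = ∃ λ j → i ≡ inject₁ j

  module _ {G : Graph k} {G′ : Graph (suc k)} (A : IsAdd G G′) where

    open IsAdd A

    addLoc : Loc (adj G) (range (port G)) (λ i → adj G (port G i)) (adj G′) (range (port G′))
      (recolour (λ i → just (inject₁ i)) (λ i → adj G′ (port G′ i))) (λ u w → e u ≡ w)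
    addLoc = record
      { sym₁ = sym G ; sym₂ = sym G′
      ; blocked = λ { {u} refl → does-ext (Fin.any? λ i → port G i ≟ u) (Fin.any? λ i → port G′ i ≟ e u)
          (λ { (i , refl) → inject₁ i , ≡-sym (old-ports i) })
          (λ (i , p) → snoc-elim (λ i → port G′ i ≡ e u → ∃ λ j → port G j ≡ u)
            (λ i p → i , e-inj (trans (old-ports i) p)) (λ p → ⊥-elim (fresh u (≡-sym p))) i p) }
      ; colour = λ { {u} refl i → trans (≡-sym (adj-pres (port G i) u)) (cong (λ w → adj G′ w (e u)) (old-ports i)) }
      ; edges = λ { {u} {z = v} refl refl → ≡-sym (adj-pres u v) }
      ; fun = λ { refl refl → cong e } ; inj = λ { refl refl → e-inj }
      ; forth = λ _ _ _ _ → _ , refl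
      ; back = λ { {z′ = w} _ _ _ d → free-old w d } }
      where
      free-old : ∀ w → range (port G′) w ≡ false → ∃ λ u → e u ≡ w
      free-old w d = [ id , (λ p → contradiction (≡-sym p) (range-false⁻ (port G′) d last)) ]′ (cover w)

    count-add : ∀ {N} (I : Inv k N) t → count I G t ≡ count (ren (λ i → just (inject₁ i)) I) G′ t
    count-add I = count-ren I (λ i → just (inject₁ i)) {G} {G′} addLoc (λ x _ → e x , refl)
      (λ w d → [ id , (λ p → contradiction (≡-sym p) (range-false⁻ (port G′) d last)) ]′ (cover w))

    table-add : ∀ i j → table G i j ≡ table G′ (inject₁ i) (inject₁ j)
    table-add i j = trans (≡-sym (adj-pres (port G i) (port G j))) (cong₂ (adj G′) (old-ports i) (old-ports j))

  module _ (G′ : Graph (suc k)) (iso : ∀ w → adj G′ (port G′ last) w ≡ false)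
           (w : ∃ λ v → port G′ last ≢ v) where

    private
      X : Fin (n G′) → Bool
      X v = not (does (port G′ last ≟ v))
      X-true : ∀ {v} → port G′ last ≢ v → X v ≡ true
      X-true ne = cong not (dec-false (port G′ last ≟ _) ne)
      X-true⁻ : ∀ {v} → X v ≡ true → port G′ last ≢ v
      X-true⁻ {v} h e with port G′ last ≟ v
      ... | no ne = ne e
      X-true⁻ {v} () e | yes _
      open Enumeration (enumerate X)
      X-port : ∀ i → X (port G′ (inject₁ i)) ≡ true
      X-port i = X-true λ e → Fin.fromℕ≢inject₁ (port-inj G′ e)

    dropLast : Graph k
    dropLast = induced (adj G′) (sym G′) (irrefl G′) X (port G′ ∘ inject₁) (Fin.inject₁-injective ∘ port-inj G′)
      X-port (proj₁ w , X-true (proj₂ w))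

    dropLast-add : IsAdd dropLast G′
    dropLast-add = record
      { e = elem ; e-inj = elem-injective ; adj-pres = λ _ _ → refl
      ; fresh = λ u p → X-true⁻ (elem-X u) (≡-sym p)
      ; isolated = iso
      ; cover = cover′
      ; old-ports = λ i → proj₂ (index-of (X-port i)) }
      where
      cover′ : ∀ v → (∃ λ u → elem u ≡ v) ⊎ (v ≡ port G′ last)
      cover′ v with port G′ last ≟ v in eq
      ... | yes p = inj₂ (≡-sym p)
      ... | no ne = inj₁ (index-of (X-true ne))

  private
    -- A table records only edges between ports. Edges from the last port to non-ports are therefore
    -- captured by naming the other end as one more port and forgetting it again.
    SeesLast : Language (suc k)
    SeesLast = ForgetAny (λ H → table H (inject₁ last) (fromℕ (suc k)) ≡ true)

    isolated-last : ∀ G′ → (∀ i → table G′ last i ≡ false) → ¬ SeesLast G′ → ∀ w → adj G′ (port G′ last) w ≡ false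
    isolated-last G′ h ¬s w with false-or-true (range (port G′) w)
    ... | inj₁ d = Bool.¬-not λ e → ¬s (w , d , trans
          (cong₂ (adj G′) (snoc-inject₁ (port G′) w last) (snoc-fromℕ (port G′) w)) e)
    ... | inj₂ d with range-true⁻ (port G′) d
    ...   | i , refl = h i

    isolated⇒¬sees : ∀ G′ → (∀ w → adj G′ (port G′ last) w ≡ false) → ¬ SeesLast G′
    isolated⇒¬sees G′ h (w , d , e) = true≢false
      (trans (≡-sym (cong₂ (adj G′) (snoc-inject₁ (port G′) w last) (snoc-fromℕ (port G′) w))) e) (h w)

  -- The last port is isolated iff it has no edge to a port, which the table shows, and none to a
  -- non-port, which is `¬ SeesLast`. Deleting it leaves the components unchanged; `Inhabited`
  -- ensures that the remaining graph is nonempty.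
  Rec-add : ∀ {L : Language k} → Rec L → Rec (addL L)
  Rec-add {L} (rec {N} {I} {s} R₀) = Rec-⇔ (λ G′ → mk⇔ (from G′) (to G′))
    (Rec-∩ (Rec-∁ (Rec-ForgetAny (Rec-edge (inject₁ last) (fromℕ (suc k)))))
      (rec {L = Core} {I = I′} {suc s} record
        { B = λ E c → (∀ i → E last i ≡ false) × Inhabited k c × B (λ i j → E (inject₁ i) (inject₁ j)) c
        ; B? = λ E c → Fin.all? (λ i → E last i Bool.≟ false) ×-dec inhabited? k c ×-dec B? _ c
        ; resp = λ h h′ (p , q , b) → (λ i → trans (≡-sym (h last i)) (p i)) , Inhabited-resp h′ q , resp (λ i j → h _ _) h′ b
        ; sound = λ G′ → mk⇔ id id }))
    where
    R : RecOn I (suc s) L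
    R = RecOn-weaken (ℕ.n≤1+n s) R₀
    open RecOn R
    I′ = ren (λ i → just (inject₁ i)) I
    Core : Language (suc k)
    Core G′ = (∀ i → table G′ last i ≡ false) × Inhabited k (count I′ G′) ×
      B (λ i j → table G′ (inject₁ i) (inject₁ j)) (count I′ G′)
    to : ∀ G′ → addL L G′ → ¬ SeesLast G′ × Core G′
    to G′ (G , p , A) = isolated⇒¬sees G′ (IsAdd.isolated A) , (λ i → IsAdd.isolated A (port G′ i))
      , Inhabited-resp {s = s} (λ t → inj₁ (count-add A I t)) (count-inhabited I G)
      , resp (table-add A) (λ t → inj₁ (count-add A I t)) (Equivalence.to (sound G) p)
    other : ∀ G′ → Inhabited k (count I′ G′) → ∃ λ v → port G′ last ≢ v
    other G′ (inj₁ (s≤s _)) = port G′ zero , λ e → Fin.0≢1+n (≡-sym (port-inj G′ e))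
    other G′ (inj₂ (t , l)) with #≥ l
    ... | x ∷ [] , refl , (d , _) ∷ [] , _ = x , range-false⁻ (port G′) d last
    from : ∀ G′ → ¬ SeesLast G′ × Core G′ → addL L G′
    from G′ (¬s , p , q , b) = G , Equivalence.from (sound G)
        (resp (λ i j → ≡-sym (table-add A i j)) (λ t → inj₁ (≡-sym (count-add A I t))) b) , A
      where
      iso = isolated-last G′ p ¬s
      G = dropLast G′ iso (other G′ q)
      A = dropLast-add G′ iso (other G′ q)

-- Finite languages

addPort-Iso⁻ : ∀ {k} {G G₀ : Graph k} {v h v₀ h₀} → Iso (addPort G v h) (addPort G₀ v₀ h₀) → Iso G G₀
addPort-Iso⁻ {G = G} {G₀} {v} {v₀ = v₀} iso = record
  { bij = bij ; adj-pres = adj-pres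
  ; port-pres = λ i → trans (cong (Inverse.to bij) (≡-sym (snoc-inject₁ (port G) v i)))
      (trans (port-pres (inject₁ i)) (snoc-inject₁ (port G₀) v₀ i)) }
  where open Iso iso

addPort-Iso : ∀ {k} {G G₀ : Graph k} {v₀ h₀} → Iso G G₀ → ForgetAny (λ H → Iso H (addPort G₀ v₀ h₀)) G
addPort-Iso {G = G} {G₀} {v₀} {h₀} iso = v , trans (Loc.blocked (Iso-Loc iso) {v} refl)
    (subst (λ w → range (port G₀) w ≡ false) (≡-sym (strictlyInverseˡ v₀)) h₀)
  , record
    { bij = bij ; adj-pres = adj-pres
    ; port-pres = snoc-elim (λ i → to (snoc (port G) v i) ≡ snoc (port G₀) v₀ i)
        (λ i → trans (cong to (snoc-inject₁ (port G) v i)) (trans (port-pres i) (≡-sym (snoc-inject₁ (port G₀) v₀ i))))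
        (trans (cong to (snoc-fromℕ (port G) v)) (trans (strictlyInverseˡ v₀) (≡-sym (snoc-fromℕ (port G₀) v₀)))) }
  where
  open Iso iso
  open Inverse bij using (to; from; strictlyInverseˡ)
  v = from v₀

all-ports : ∀ {k} (G : Graph k) → (∀ v → range (port G) v ≢ false) → ∀ v → ∃ λ i → port G i ≡ v
all-ports G h v = [ (λ d → contradiction d (h v)) , range-true⁻ (port G) ]′ (false-or-true (range (port G) v))

all-ports-Iso : ∀ {k} (G H : Graph k) → (∀ v → ∃ λ i → port G i ≡ v) → (∀ v → ∃ λ i → port H i ≡ v) →
  (∀ i j → table G i j ≡ table H i j) → Iso G H
all-ports-Iso G H g h e = record
  { bij = mk↔ₛ′ to from
      (λ w → trans (port-to (proj₁ (h w))) (proj₂ (h w))) (λ v → trans (port-from (proj₁ (g v))) (proj₂ (g v)))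
  ; adj-pres = λ u v → trans (≡-sym (e _ _)) (cong₂ (adj G) (proj₂ (g u)) (proj₂ (g v)))
  ; port-pres = port-to }
  where
  to : Fin (n G) → Fin (n H)
  to v = port H (proj₁ (g v))
  from : Fin (n H) → Fin (n G)
  from w = port G (proj₁ (h w))
  port-to : ∀ i → to (port G i) ≡ port H i
  port-to i = cong (port H) (port-inj G (proj₂ (g (port G i))))
  port-from : ∀ i → from (port H i) ≡ port G i
  port-from i = cong (port G) (port-inj H (proj₂ (h (port H i))))

-- Making a non-port `v₀` of `G₀` a port reduces the claim to one arity higher, since isomorphism
-- with `G₀` means that some vertex can play the part of `v₀`. When every vertex is a port, the
-- table and the absence of components determine the graph; threshold one detects that absence.
Rec-single : ∀ d {k} (G₀ : Graph k) → n G₀ ≤ k + d → Rec (λ G → Iso G G₀)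
Rec-single d {k} G₀ l with Fin.any? (λ v → range (port G₀) v Bool.≟ false)
-- With `d` equal to zero there are at most `k` vertices, yet a non-port would make `suc k` distinct
-- ports.
Rec-single zero {k} G₀ l | yes (v₀ , h₀) = contradiction
  (ℕ.≤-trans (Fin.injective⇒≤ {f = port (addPort G₀ v₀ h₀)} (port-inj (addPort G₀ v₀ h₀))) l)
  (ℕ.<⇒≱ (ℕ.≤-reflexive (cong suc (ℕ.+-identityʳ k))))
Rec-single (suc d) {k} G₀ l | yes (v₀ , h₀) = Rec-⇔
  (λ G → mk⇔ (λ (v , h , iso) → addPort-Iso⁻ {v = v} {h} {v₀} {h₀} iso) (addPort-Iso {v₀ = v₀} {h₀}))
  (Rec-ForgetAny (Rec-single d (addPort G₀ v₀ h₀) (ℕ.≤-trans l (ℕ.≤-reflexive (ℕ.+-suc k d)))))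
Rec-single d {k} G₀ l | no ¬free = rec {I = triv} {1} record
  { B = λ E c → (∀ i j → E i j ≡ table G₀ i j) × c zero ≡ 0
  ; B? = λ E c → Fin.all? (λ i → Fin.all? λ j → E i j Bool.≟ table G₀ i j) ×-dec (c zero ℕ.≟ 0)
  ; resp = λ h h′ (p , q) → (λ i j → trans (≡-sym (h i j)) (p i j)) , stay (h′ zero) q
  ; sound = λ G → mk⇔ (to G) (from G) }
  where
  stay : ∀ {a b} → a ≈[ 1 ] b → a ≡ 0 → b ≡ 0
  stay (inj₁ refl) e = e
  stay (inj₂ (s≤s _ , _)) ()
  to : ∀ G → Iso G G₀ → (∀ i j → table G i j ≡ table G₀ i j) × count triv G zero ≡ 0
  to G iso = (λ i j → trans (≡-sym (Iso.adj-pres iso (port G i) (port G j)))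
      (cong₂ (adj G₀) (Iso.port-pres iso i) (Iso.port-pres iso j)))
    , trans (count-loc triv {G} {G₀} (Iso-Loc iso) (λ x _ → Inverse.to (Iso.bij iso) x , refl)
        (λ x _ → Inverse.from (Iso.bij iso) x , Inverse.strictlyInverseˡ (Iso.bij iso) x) zero)
      (#-none (sym G₀) λ x (d , _) → ¬free (x , d))
  from : ∀ G → (∀ i j → table G i j ≡ table G₀ i j) × count triv G zero ≡ 0 → Iso G G₀
  from G (p , q) = all-ports-Iso G G₀
    (all-ports G λ v d → ℕ.1+n≰n (ℕ.≤-trans (#≥⁻ (sym G) {j = 1} (v ∷ []) refl ((d , refl) ∷ []) ([] ∷ [])) (ℕ.≤-reflexive q)))
    (all-ports G₀ λ v d → ¬free (v , d)) p

Rec-∅ : ∀ {k} → Rec {k} (λ _ → ⊥)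
Rec-∅ = rec {I = triv} {0} record
  { B = λ _ _ → ⊥ ; B? = λ _ _ → no id ; resp = λ _ _ → id ; sound = λ G → mk⇔ id id }

Rec-finite : ∀ {k} (Gs : List (Graph k)) → Rec (finiteL Gs)
Rec-finite [] = Rec-⇔ (λ G → mk⇔ (λ ()) (λ ())) Rec-∅
Rec-finite {k} (G₀ ∷ Gs) = Rec-⇔ (λ G → mk⇔ [ here , there ]′ λ { (here p) → inj₁ p ; (there p) → inj₂ p })
  (Rec-∪ (Rec-single (n G₀) G₀ (ℕ.m≤n+m (n G₀) k)) (Rec-finite Gs))

StarFree⇒Rec : ∀ {k L} → StarFree k L → Rec L
StarFree⇒Rec (finite Gs) = Rec-finite Gs
StarFree⇒Rec (union S T) = Rec-∪ (StarFree⇒Rec S) (StarFree⇒Rec T)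
StarFree⇒Rec (inter S T) = Rec-∩ (StarFree⇒Rec S) (StarFree⇒Rec T)
StarFree⇒Rec (compl S) = Rec-∁ (StarFree⇒Rec S)
StarFree⇒Rec (fusion S T) = Rec-fusion (StarFree⇒Rec S) (StarFree⇒Rec T)
StarFree⇒Rec (forgetS S) = Rec-forget (StarFree⇒Rec S)
StarFree⇒Rec (addS S) = Rec-add (StarFree⇒Rec S)
StarFree⇒Rec (permS π S) = Rec-perm π (StarFree⇒Rec S)
StarFree⇒Rec (ext S h) = Rec-⇔ h (StarFree⇒Rec S)

-- From formulas to star-free languages

SF-⊤ : ∀ {k} → StarFree k (λ G → ⊤)
SF-⊤ = ext (compl (finite [])) λ G → mk⇔ (λ _ → tt) λ _ ()

SF-dec : ∀ {k} {A : Set} → Dec A → StarFree k (λ G → A)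
SF-dec (yes a) = ext SF-⊤ λ G → mk⇔ (λ _ → a) λ _ → tt
SF-dec (no ¬a) = ext (compl SF-⊤) λ G → mk⇔ (λ h → ⊥-elim (h tt)) λ a → contradiction a ¬a

SF-∃Fin : ∀ {k N} {L : Fin N → Language k} → (∀ i → StarFree k (L i)) → StarFree k (λ G → ∃ λ i → L i G)
SF-∃Fin {N = zero} h = ext (SF-dec {A = ⊥} (no id)) λ G → mk⇔ (λ ()) λ ()
SF-∃Fin {N = suc N} h = ext (union (h zero) (SF-∃Fin (h ∘ suc))) λ G → mk⇔
  [ (λ p → zero , p) , (λ (i , p) → suc i , p) ]′ λ { (zero , p) → inj₁ p ; (suc i , p) → inj₂ (i , p) }

SF-∀Fin : ∀ {k N} {L : Fin N → Language k} → (∀ i → StarFree k (L i)) → StarFree k (λ G → ∀ i → L i G)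
SF-∀Fin {N = zero} h = ext SF-⊤ λ G → mk⇔ (λ _ ()) λ _ → tt
SF-∀Fin {N = suc N} h = ext (inter (h zero) (SF-∀Fin (h ∘ suc))) λ G → mk⇔
  (λ { (p , q) zero → p ; (p , q) (suc i) → q i }) λ h → h zero , h ∘ suc

SF-ForgetAny : ∀ {k L} → StarFree (suc k) L → StarFree k (ForgetAny L)
SF-ForgetAny S = ext (forgetS S) λ G → let h = forgetL⇔ForgetAny (StarFree⇒Rec S) G in
  mk⇔ (Equivalence.from h) (Equivalence.to h)

-- Edges and isolated ports as star-free languages

module _ {k : ℕ} (i j : Fin k) (i≢j : i ≢ j) where

  Joins : Fin k → Fin k → Set
  Joins u v = (u ≡ i × v ≡ j) ⊎ (u ≡ j × v ≡ i)

  joins? : ∀ u v → Dec (Joins u v)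
  joins? u v = ((u ≟ i) ×-dec (v ≟ j)) ⊎-dec ((u ≟ j) ×-dec (v ≟ i))

  singleEdge : Graph k
  singleEdge = record
    { n = k ; nonempty = ℕ.≤-trans (s≤s z≤n) (Fin.toℕ<n i)
    ; adj = λ u v → does (joins? u v)
    ; sym = λ u v → does-ext (joins? u v) (joins? v u) [ (λ (p , q) → inj₂ (q , p)) , (λ (p , q) → inj₁ (q , p)) ]′
        [ (λ (p , q) → inj₂ (q , p)) , (λ (p , q) → inj₁ (q , p)) ]′
    ; irrefl = λ u → dec-false (joins? u u) [ (λ (p , q) → i≢j (trans (≡-sym p) q)) , (λ (p , q) → i≢j (trans (≡-sym q) p)) ]′
    ; port = id ; port-inj = id }

  -- Parallel edges merge in a fusion, so a graph that already has the edge is unchanged by fusing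
  -- one more copy of it.
  absorb : ∀ G → table G i j ≡ true → IsFusion singleEdge G G
  absorb G h = record
    { e₁ = port G ; e₂ = id ; e₁-inj = port-inj G ; e₂-inj = id ; port₁ = λ _ → refl ; port₂ = λ _ → refl
    ; shared = λ u v e → u , refl , ≡-sym e ; cover = λ w → inj₂ (w , refl)
    ; edges = λ a b → mk⇔ (λ e → inj₂ (a , b , refl , refl , e))
        λ { (inj₁ (u , v , refl , refl , e)) → joined (does-true (joins? u v) e) ; (inj₂ (_ , _ , refl , refl , e)) → e } }
    where
    joined : ∀ {u v} → Joins u v → adj G (port G u) (port G v) ≡ true
    joined (inj₁ (refl , refl)) = h
    joined (inj₂ (refl , refl)) = trans (sym G _ _) h

-- The finite language of the single edge, fused with all graphs, consists of the graphs that
-- contain this edge.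
SF-edge : ∀ {k} (i j : Fin k) → StarFree k (λ G → table G i j ≡ true)
SF-edge {k} i j with i ≟ j
... | yes refl = ext (SF-dec {A = ⊥} (no id)) λ G → mk⇔ (λ ()) λ e → true≢false e (irrefl G (port G i))
... | no i≢j = ext (fusion (finite (K ∷ [])) SF-⊤) λ G → mk⇔ to λ e → K , G , here K-refl , tt , absorb i j i≢j G e
  where
  K = singleEdge i j i≢j
  K-refl : Iso K K
  K-refl = record { bij = mk↔ₛ′ id id (λ _ → refl) (λ _ → refl) ; adj-pres = λ _ _ → refl ; port-pres = λ _ → refl }
  to : ∀ {G} → fuseL (finiteL (K ∷ [])) (λ _ → ⊤) G → table G i j ≡ true
  to (G₁ , G₂ , here iso , _ , F) = trans (table-fusion F i j) (cong (_∨ table G₂ i j)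
    (trans (≡-sym (Iso.adj-pres iso (port G₁ i) (port G₁ j)))
      (trans (cong₂ (adj K) (Iso.port-pres iso i) (Iso.port-pres iso j)) (dec-true (joins? i j i≢j i j) (inj₁ (refl , refl))))))

Isolated : ∀ {k} → Fin k → Language k
Isolated i G = ∀ w → adj G (port G i) w ≡ false

-- Edges to ports are excluded directly, edges to other vertices by forgetting a port adjacent to
-- `i`.
SF-isolated : ∀ {k} (i : Fin k) → StarFree k (Isolated i)
SF-isolated {k} i = ext (inter (SF-∀Fin λ j → compl (SF-edge i j)) (compl (SF-ForgetAny (SF-edge (inject₁ i) (fromℕ k)))))
  λ G → mk⇔ (to G) (from G)
  where
  new : ∀ G w → adj G (snoc (port G) w (inject₁ i)) (snoc (port G) w (fromℕ k)) ≡ adj G (port G i) w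
  new G w = cong₂ (adj G) (snoc-inject₁ (port G) w i) (snoc-fromℕ (port G) w)
  to : ∀ G → (∀ j → ¬ table G i j ≡ true) × ¬ ForgetAny (λ H → table H (inject₁ i) (fromℕ k) ≡ true) G → Isolated i G
  to G (p , q) w with false-or-true (range (port G) w)
  ... | inj₁ d = Bool.¬-not λ e → q (w , d , trans (new G w) e)
  ... | inj₂ d with range-true⁻ (port G) d
  ...   | j , refl = Bool.¬-not (p j)
  from : ∀ G → Isolated i G → (∀ j → ¬ table G i j ≡ true) × ¬ ForgetAny (λ H → table H (inject₁ i) (fromℕ k) ≡ true) G
  from G h = (λ j e → true≢false e (h (port G j))) , λ (w , d , e) → true≢false (trans (≡-sym (new G w)) e) (h w)

-- Separation by ports as a fusion

range-port : ∀ {k l} (G : Graph k) (z : Fin l → Fin k) i → range (port G ∘ z) (port G i) ≡ range z i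
range-port G z i = does-ext (Fin.any? λ q → port G (z q) ≟ port G i) (Fin.any? λ q → z q ≟ i)
  (λ (q , e) → q , port-inj G e) (λ { (q , refl) → q , refl })

-- The ports z separate port a from port b iff G is a fusion of two graphs such that every port
-- outside z is isolated in one of the factors, a in the second and b in the first.
module _ {k l : ℕ} (z : Fin l → Fin k) (c : Fin k → Bool) where

  Side : Bool → Language k
  Side b G = ∀ i → range z i ≡ false × c i ≡ b → Isolated i G

  SF-side : ∀ b → StarFree k (Side b)
  SF-side b = SF-∀Fin λ i → side i
    where
    side : ∀ i → StarFree k (λ G → range z i ≡ false × c i ≡ b → Isolated i G)
    side i with (range z i Bool.≟ false) ×-dec (c i Bool.≟ b)
    ... | yes p = ext (SF-isolated i) λ G → mk⇔ (λ h _ → h) λ h → h p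
    ... | no ¬p = ext SF-⊤ λ G → mk⇔ (λ _ p → contradiction p ¬p) λ _ → tt

  module _ {G₁ G₂ G : Graph k} (F : IsFusion G₁ G₂ G) (side₁ : Side false G₁) (side₂ : Side true G₂) where

    open IsFusion F

    private
      D = range (port G ∘ z)
      Left : Fin (n G) → Set
      Left w = (∃ λ u → e₁ u ≡ w × range (port G₁) u ≡ false) ⊎ (∃ λ i → port G i ≡ w × c i ≡ true)

      -- An undeleted port is isolated in the second factor if its colour is true and in the first
      -- if it is false. Hence an edge of the first factor cannot enter a false port, and no edge of
      -- the second can start in `Left`.
      Left-edge : ∀ {x w} → D x ≡ false → adj G x w ≡ true → D w ≡ false → Left x → Left w
      Left-edge {x} {w} dx h d L with Equivalence.to (edges x w) h
      ... | inj₁ (u , v , p , refl , h′) with false-or-true (range (port G₁) v)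
      ...   | inj₁ f = inj₁ (v , refl , f)
      ...   | inj₂ t with range-true⁻ (port G₁) t
      ...     | j , refl with false-or-true (c j)
      ...       | inj₂ cj = inj₂ (j , ≡-sym (port₁ j) , cj)
      ...       | inj₁ cj = ⊥-elim (true≢false (trans (sym G₁ _ _) h′)
                    (side₁ j (trans (≡-sym (range-port G z j)) (trans (cong D (≡-sym (port₁ j))) d) , cj) u))
      Left-edge dx h d (inj₁ (u′ , refl , f)) | inj₂ (u , v , p , q , h′) = ⊥-elim (not-shared F f (≡-sym p))
      Left-edge dx h d (inj₂ (i , refl , ci)) | inj₂ (u , v , p , q , h′) with e₂-inj (trans p (≡-sym (port₂ i)))
      ... | refl = ⊥-elim (true≢false h′ (side₂ i (trans (≡-sym (range-port G z i)) dx , ci) v))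

      Left-conn : ∀ {x y} → Conn (adj G) D x y → Left x → Left y
      Left-conn (stop _) L = L
      Left-conn (go d h r) L = Left-conn r (Left-edge d h (Conn-start r) L)

    sides⇒¬conn : ∀ {a b} → c a ≡ true → c b ≡ false → ¬ Conn (adj G) D (port G a) (port G b)
    sides⇒¬conn {a} {b} ca cb r with Left-conn r (inj₂ (a , refl , ca))
    ... | inj₁ (u , p , f) = range-false⁻ (port G₁) f b (e₁-inj (trans (port₁ b) (≡-sym p)))
    ... | inj₂ (i , p , ci) = true≢false ci (trans (cong c (port-inj G p)) cb)

  module _ (G : Graph k) (a : Fin k) (a∉z : range z a ≡ false) where

    private
      D = range (port G ∘ z)

      S? : ∀ v → Dec (Conn (adj G) D (port G a) v)
      S? = conn? (adj G) D (port G a)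

    reach : Fin (n G) → Bool
    reach v = does (S? v)

    module _ (c-reach : ∀ i → c i ≡ reach (port G i)) where

      private
        D-false : ∀ {v} → range (port G) v ≡ false → D v ≡ false
        D-false h = range-false (port G ∘ z) λ q → range-false⁻ (port G) h (z q)

        push : ∀ {u v} → D v ≡ false → adj G u v ≡ true → reach u ≡ true → reach v ≡ true
        push {u} {v} d h r = dec-true (S? v)
          (Conn-trans (does-true (S? u) r) (go (Conn-end (does-true (S? u) r)) h (stop d)))

        reach-edge : ∀ {u v} → D u ≡ false → D v ≡ false → adj G u v ≡ true → reach u ≡ reach v
        reach-edge du dv h = bool-ext (push dv h) (push du (trans (sym G _ _) h))

        -- Port edges are divided by colour: the first factor keeps those among `z` and the ports
        -- reached from `a`, the second those among `z` and the unreached ports. Edges inside `z` go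
        -- to both.
        restrict : (Fin k → Bool) → PortEdges k
        restrict ok = record
          { E = λ i j → table G i j ∧ (ok i ∧ ok j)
          ; E-sym = λ i j → cong₂ _∧_ (sym G (port G i) (port G j)) (Bool.∧-comm (ok i) (ok j))
          ; E-irrefl = λ i → cong (_∧ (ok i ∧ ok i)) (irrefl G (port G i)) }

        ok₁ ok₂ : Fin k → Bool
        ok₁ i = range z i ∨ c i
        ok₂ i = range z i ∨ not (c i)

        -- An edge between two ports outside `z` has both ends reached or both unreached, so it fits
        -- one factor; an edge meeting `z` fits the factor allowed by its other end.
        joint : ∀ i j → table G i j ≡ (table G i j ∧ (ok₁ i ∧ ok₁ j)) ∨ (table G i j ∧ (ok₂ i ∧ ok₂ j))
        joint i j with false-or-true (table G i j)
        ... | inj₁ h rewrite h = refl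
        ... | inj₂ h = trans h (≡-sym (trans (cong (λ e → e ∧ (ok₁ i ∧ ok₁ j) ∨ e ∧ (ok₂ i ∧ ok₂ j)) h) (covers i j h)))
          where
          covers : ∀ i j → table G i j ≡ true → (ok₁ i ∧ ok₁ j) ∨ (ok₂ i ∧ ok₂ j) ≡ true
          covers i j h with range z i in zi | range z j in zj
          ... | true | true = refl
          ... | true | false with c j
          ...   | true = refl
          ...   | false = refl
          covers i j h | false | true with c i
          ... | true = refl
          ... | false = refl
          covers i j h | false | false
            with c i | c j | trans (c-reach i) (trans (reach-edge (trans (range-port G z i) zi) (trans (range-port G z j) zj) h) (≡-sym (c-reach j)))
          ... | true | .true | refl = refl
          ... | false | .false | refl = refl

        T₁ T₂ : PortEdges k
        T₁ = restrict ok₁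
        T₂ = restrict ok₂

        w₁ : ∃ λ v → keep G reach T₁ v ≡ true
        w₁ = port G a , cong (_∨ reach (port G a)) (range-true (port G) a)

        w₂ : ∃ λ v → keep G (not ∘ reach) T₂ v ≡ true
        w₂ = port G a , cong (_∨ not (reach (port G a))) (range-true (port G) a)

        ∧-true : ∀ {x y} → x ∧ y ≡ true → x ≡ true × y ≡ true
        ∧-true {true} {true} _ = refl , refl

        side₁ : Side false (part G reach T₁ w₁)
        side₁ i (zi , ci) w = Bool.¬-not λ h →
          refute (subst (λ x → PartEdge G reach T₁ x _) (part-port G reach T₁ w₁ i) (part-edge G reach T₁ w₁ h))
          where
          refute : PartEdge G reach T₁ (port G i) (part-embed G reach T₁ w₁ w) → ⊥
          refute (inside (inj₁ d) h) = true≢false (range-true (port G) i) d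
          refute (inside (inj₂ d) h) = true≢false
            (push (trans (range-port G z i) zi) (trans (sym G _ _) h)
              (trans (cong (_∨ reach (part-embed G reach T₁ w₁ w)) (≡-sym d)) (part-keep G reach T₁ w₁ w)))
            (trans (≡-sym (c-reach i)) ci)
          refute (ports i′ j′ p q h) with port-inj G p
          ... | refl = true≢false (proj₁ (∧-true (proj₂ (∧-true {table G i j′} h)))) (cong₂ _∨_ zi ci)

        side₂ : Side true (part G (not ∘ reach) T₂ w₂)
        side₂ i (zi , ci) w = Bool.¬-not λ h →
          refute (subst (λ x → PartEdge G (not ∘ reach) T₂ x _) (part-port G (not ∘ reach) T₂ w₂ i)
            (part-edge G (not ∘ reach) T₂ w₂ h))
          where
          refute : PartEdge G (not ∘ reach) T₂ (port G i) (part-embed G (not ∘ reach) T₂ w₂ w) → ⊥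
          refute (inside (inj₁ d) h) = true≢false (range-true (port G) i) d
          refute (inside (inj₂ d) h) = true≢false
            (part-keep G (not ∘ reach) T₂ w₂ w)
            (trans (cong (_∨ not (reach (part-embed G (not ∘ reach) T₂ w₂ w))) d) (cong not (push (D-false d) h (trans (≡-sym (c-reach i)) ci))))
          refute (ports i′ j′ p q h) with port-inj G p
          ... | refl = true≢false (proj₁ (∧-true (proj₂ (∧-true {table G i j′} h)))) (cong₂ (λ x y → x ∨ not y) zi ci)

      reach-fusion : fuseL (Side false) (Side true) G
      reach-fusion = _ , _ , side₁ , side₂
        , part-fusion G reach (λ d d′ → reach-edge (D-false d) (D-false d′)) T₁ T₂ joint w₁ w₂

-- Which ports are reached from `a` varies with the graph, so a union is taken over all colourings
-- of the ports that tell `a` from `b`. If `a` or `b` is in `z`, separation is automatic.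
SF-¬conn : ∀ {k l} (z : Fin l → Fin k) a b →
  StarFree k (λ G → ¬ Conn (adj G) (range (port G ∘ z)) (port G a) (port G b))
SF-¬conn {k} z a b with false-or-true (range z a) | false-or-true (range z b)
... | inj₂ t | _ = ext SF-⊤ λ G → mk⇔ (λ _ r → true≢false t (trans (≡-sym (range-port G z a)) (Conn-start r))) λ _ → tt
... | inj₁ _ | inj₂ t = ext SF-⊤ λ G → mk⇔ (λ _ r → true≢false t (trans (≡-sym (range-port G z b)) (Conn-end r))) λ _ → tt
... | inj₁ za | inj₁ zb = ext
  (SF-∃Fin λ c → inter (SF-dec ((bits k c a Bool.≟ true) ×-dec (bits k c b Bool.≟ false)))
    (fusion (SF-side z (bits k c) false) (SF-side z (bits k c) true)))
  λ G → mk⇔ (λ (c , (ca , cb) , G₁ , G₂ , s₁ , s₂ , F) → sides⇒¬conn z (bits k c) F s₁ s₂ ca cb) (from G)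
  where
  from : ∀ G → ¬ Conn (adj G) (range (port G ∘ z)) (port G a) (port G b) → _
  from G ¬r = unbits c , (trans (c≡ a) (dec-true (conn? _ _ _ _) (stop (trans (range-port G z a) za)))
      , trans (c≡ b) (dec-false (conn? _ _ _ _) ¬r))
    , reach-fusion z (bits k (unbits c)) G a za c≡
    where
    c : Fin k → Bool
    -- The colouring is being defined from `reach`, so a constant one stands in for the colouring
    -- parameter here.
    c i = reach z (λ _ → false) G a za (port G i)
    c≡ : bits k (unbits c) ≗ c
    c≡ = bits-unbits c

-- Quantifiers and the translation of formulas

module _ {k : ℕ} (G : Graph k) {v} {h : range (port G) v ≡ false} where

  private
    H = addPort G v h

    walk→ : ∀ {x y vs} → Walk G x y vs → Walk H x y vs
    walk→ (Walk.here x) = Walk.here x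
    walk→ (Walk.step e w) = Walk.step e (walk→ w)

    walk← : ∀ {x y vs} → Walk H x y vs → Walk G x y vs
    walk← (Walk.here x) = Walk.here x
    walk← (Walk.step e w) = Walk.step e (walk← w)

  -- A new port changes neither vertices nor edges, but `Walk` is indexed by the graph together with
  -- its ports, so separation atoms need a conversion. Both directions are proved together because
  -- negation exchanges them.
  Sat→ : ∀ {m} (ρ : Fin m → Fin (n G)) φ → Sat G ρ φ → Sat H ρ φ
  Sat← : ∀ {m} (ρ : Fin m → Fin (n G)) φ → Sat H ρ φ → Sat G ρ φ

  Sat→ ρ (edge i j) s = s
  Sat→ ρ (equal i j) s = s
  Sat→ ρ (sep l x y zs) s vs (w , u) = s vs (walk← w , u)
  Sat→ ρ (neg φ) s t = s (Sat← ρ φ t)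
  Sat→ ρ (and φ ψ) (s , t) = Sat→ ρ φ s , Sat→ ρ ψ t
  Sat→ ρ (or φ ψ) (inj₁ s) = inj₁ (Sat→ ρ φ s)
  Sat→ ρ (or φ ψ) (inj₂ s) = inj₂ (Sat→ ρ ψ s)
  Sat→ ρ (ex′ φ) (x , s) = x , Sat→ (x ∷ᶠ ρ) φ s
  Sat→ ρ (all′ φ) s x = Sat→ (x ∷ᶠ ρ) φ (s x)

  Sat← ρ (edge i j) s = s
  Sat← ρ (equal i j) s = s
  Sat← ρ (sep l x y zs) s vs (w , u) = s vs (walk→ w , u)
  Sat← ρ (neg φ) s t = s (Sat→ ρ φ t)
  Sat← ρ (and φ ψ) (s , t) = Sat← ρ φ s , Sat← ρ ψ t
  Sat← ρ (or φ ψ) (inj₁ s) = inj₁ (Sat← ρ φ s)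
  Sat← ρ (or φ ψ) (inj₂ s) = inj₂ (Sat← ρ ψ s)
  Sat← ρ (ex′ φ) (x , s) = x , Sat← (x ∷ᶠ ρ) φ s
  Sat← ρ (all′ φ) s x = Sat← (x ∷ᶠ ρ) φ (s x)

-- The assignment need not be injective or surjective: a quantified vertex may coincide with a port
-- already in use, and several variables may share it.
At : ∀ {m k} → Formula m → (Fin m → Fin k) → Language k
At φ f G = Sat G (port G ∘ f) φ

fresh : ∀ {m k} → (Fin m → Fin k) → Fin (suc m) → Fin (suc k)
fresh {k = k} f = fromℕ k ∷ᶠ (inject₁ ∘ f)

module _ {m k : ℕ} (φ : Formula (suc m)) (f : Fin m → Fin k) (G : Graph k) where

  at-port : ∀ i → At φ (i ∷ᶠ f) G ⇔ Sat G (port G i ∷ᶠ (port G ∘ f)) φ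
  at-port i = mk⇔ (Sat-ext G (λ { zero → refl ; (suc j) → refl }) φ) (Sat-ext G (λ { zero → refl ; (suc j) → refl }) φ)

  at-fresh : ∀ v h → At φ (fresh f) (addPort G v h) ⇔ Sat G (v ∷ᶠ (port G ∘ f)) φ
  at-fresh v h = mk⇔
    (λ s → Sat-ext G same φ (Sat← G {v} {h} _ φ s))
    (λ s → Sat→ G {v} {h} _ φ (Sat-ext G (≡-sym ∘ same) φ s))
    where
    same : snoc (port G) v ∘ fresh f ≗ (v ∷ᶠ (port G ∘ f))
    same zero = snoc-fromℕ (port G) v
    same (suc j) = snoc-inject₁ (port G) v (f j)

  at-any : (∃ λ v → Sat G (v ∷ᶠ (port G ∘ f)) φ) ⇔ ((∃ λ i → At φ (i ∷ᶠ f) G) ⊎ ForgetAny (At φ (fresh f)) G)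
  at-any = mk⇔ to [ (λ (i , s) → port G i , Equivalence.to (at-port i) s) , (λ (v , h , s) → v , Equivalence.to (at-fresh v h) s) ]′
    where
    to : (∃ λ v → Sat G (v ∷ᶠ (port G ∘ f)) φ) → (∃ λ i → At φ (i ∷ᶠ f) G) ⊎ ForgetAny (At φ (fresh f)) G
    to (v , s) with false-or-true (range (port G) v)
    ... | inj₁ h = inj₂ (v , h , Equivalence.from (at-fresh v h) s)
    ... | inj₂ t with range-true⁻ (port G) t
    ...   | i , refl = inj₁ (i , Equivalence.from (at-port i) s)

SF-ex : ∀ {m} (φ : Formula (suc m)) → (∀ {k} (f : Fin (suc m) → Fin k) → StarFree k (At φ f)) →
  ∀ {k} (f : Fin m → Fin k) → StarFree k (At (ex′ φ) f)
SF-ex φ h f = ext (union (SF-∃Fin λ i → h (i ∷ᶠ f)) (SF-ForgetAny (h (fresh f)))) λ G →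
  mk⇔ (Equivalence.from (at-any φ f G)) (Equivalence.to (at-any φ f G))

SF-At : ∀ {m} (φ : Formula m) {k} (f : Fin m → Fin k) → StarFree k (At φ f)
SF-At (edge i j) f = SF-edge (f i) (f j)
SF-At (equal i j) f = ext (SF-dec (f i ≟ f j)) λ G → mk⇔ (cong (port G)) (port-inj G)
SF-At (sep l x y zs) f = ext (SF-¬conn (f ∘ Vec.lookup zs) (f x) (f y)) λ G → mk⇔
  (Equivalence.from (separates⇔¬conn G (member G))) (Equivalence.to (separates⇔¬conn G (member G)))
  where
  member : ∀ G v → (range (port G ∘ f ∘ Vec.lookup zs) v ≡ true) ⇔ (v ∈ᵥ Vec.map (port G ∘ f) zs)
  member G v = subst (λ us → (range (port G ∘ f ∘ Vec.lookup zs) v ≡ true) ⇔ (v ∈ᵥ us))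
    (trans (Vec.tabulate-∘ (port G ∘ f) (Vec.lookup zs)) (cong (Vec.map (port G ∘ f)) (Vec.tabulate∘lookup zs)))
    (range⇔∈ (port G ∘ f ∘ Vec.lookup zs))
SF-At (neg φ) f = compl (SF-At φ f)
SF-At (and φ ψ) f = inter (SF-At φ f) (SF-At ψ f)
SF-At (or φ ψ) f = union (SF-At φ f) (SF-At ψ f)
SF-At (ex′ φ) f = SF-ex φ (SF-At φ) f
-- The quantifier is translated as the negation of an existential one. Removing the double negation
-- needs satisfaction of `φ` to be decidable, which follows because the languages obtained for `φ`
-- are star-free and hence recognised.
SF-At (all′ φ) f = ext (compl (SF-ex (neg φ) (compl ∘ SF-At φ) f)) λ G → mk⇔
  (λ h v → decidable-stable (dec G v) λ ¬s → h (v , ¬s)) (λ h (v , ¬s) → ¬s (h v))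
  where
  dec : ∀ G v → Dec (Sat G (v ∷ᶠ (port G ∘ f)) φ)
  dec G v with false-or-true (range (port G) v)
  ... | inj₁ h = map′ (Equivalence.to (at-fresh φ f G v h)) (Equivalence.from (at-fresh φ f G v h))
    (Rec-dec (StarFree⇒Rec (SF-At φ (fresh f))) (addPort G v h))
  ... | inj₂ t with range-true⁻ (port G) t
  ...   | i , refl = map′ (Equivalence.to (at-port φ f G i)) (Equivalence.from (at-port φ f G i))
    (Rec-dec (StarFree⇒Rec (SF-At φ (i ∷ᶠ f))) G)

mainTheorem1 : (k : ℕ) (L : Language k) →
    (StarFree k L → Definable k L) × (Definable k L → StarFree k L)
mainTheorem1 k L = (λ S → Rec⇒Definable (StarFree⇒Rec S))
  , λ (φ , h) → ext (SF-At φ id) λ G → mk⇔ (Equivalence.from (h G)) (Equivalence.to (h G))
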